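{- Let $w\in S_\mathbb{Z}$, $n\ge1$, and $A\subseteq\mathrm{Inv}(w)$. When nonempty, the sets $\mathrm{RF}^+_n(w,A)$ and $\mathrm{RF}^+_n(w)$, with weight function $\mathrm{wt}$ and crystal operators $e_i,f_i$ ($i\in[n-1]$) as defined below, are normal $\mathfrak{gl}_n$-crystals, and the map $\mathsf{unprime}:\mathrm{RF}^+_n(w,A)\to\mathrm{RF}_n(w)$ is a $\mathfrak{gl}_n$-crystal isomorphism.
   Context: $S_\mathbb{Z}$ is the group of finitary permutations of $\mathbb{Z}$ generated by $s_i=(i\ i+1)$; $\mathcal{R}(w)$ is the set of reduced words of $w$; $\mathrm{Inv}(w)=\{(a,b)\in\mathbb{Z}^2:a<b,\ w(a)>w(b)\}$. Primed letters: $\mathbb{Z}'=\{m-\tfrac12\}$, $m'=m-\tfrac12$, order $\cdots<1'<1<2'<2<\cdots$, $\lceil\cdot\rceil$ removes primes (letterwise on words). For a primed word $i=i_1\cdots i_\ell$ with $\lceil i\rceil\in\mathcal{R}(w)$ put $a_j=s_{\lceil i_\ell\rceil}\cdots s_{\lceil i_{j+1}\rceil}(\lceil i_j\rceil)$, $b_j=s_{\lceil i_\ell\rceil}\cdots s_{\lceil i_{j+1}\rceil}(\lceil i_j\rceil+1)$, and $\mathrm{Marked}(i)=\{(a_j,b_j):i_j\in\mathbb{Z}'\}$. $\mathrm{RF}^+_n(w)$ is the set of $n$-tuples $a=(a^1,\dots,a^n)$ of strictly decreasing primed words whose concatenation $i$ has $\lceil i\rceil\in\mathcal{R}(w)$;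 $\mathrm{RF}^+_n(w,A)$ is the subset with $\mathrm{Marked}(a^1\cdots a^n)=A$; $\mathrm{RF}_n(w)=\mathrm{RF}^+_n(w,\emptyset)$ (no primes); $\mathsf{unprime}(a)=(\lceil a^1\rceil,\dots,\lceil a^n\rceil)$; $\mathrm{wt}(a)=(\ell(a^1),\dots,\ell(a^n))$. Pairing of strictly decreasing primed words $(u,v)$: letters $c$ of $v$, taken right to left, are paired with the largest unpaired $b\in u$ with $\lceil b\rceil<\lceil c\rceil$. Swapping the primes on two letters reverses both primes if exactly one is primed, and does nothing otherwise. For $i\in[n-1]$: $e_ia=\mathbf{0}$ if all letters of $a^{i+1}$ are paired in the pairing of $(a^i,a^{i+1})$; else let $x$ be the largest unpaired letter of $a^{i+1}$, $q\ge0$ minimal with $\lceil x\rceil+q\notin\lceil a^i\rceil$; remove $x$ from $a^{i+1}$, insert $x+q$ into $a^i$ in decreasing position, and swap the primes on each pair $(b,c)$ with $\lceil x\rceil+q\ge\lceil c\rceil>\lceil x\rceil$. $f_ia=\mathbf{0}$ if all letters of $a^i$ are paired; else let $y$ be the smallest unpaired letter of $a^i$, $q\ge0$ minimal with $\lceil y\rceil-q\notin\lceil a^{i+1}\rceil$; remove $y$ from $a^i$, insert $y-q$ into $a^{i+1}$, and swap the primes on each pair $(b,c)$ with $\lceil y\rceil>\lceil b\rceil\ge\lceil y\rceil-q$. The statistics are $\varepsilon_i(a)=\max\{k:e_i^ka\ne\mathbf{0}\}$, $\varphi_i(a)=\max\{k:f_i^ka\ne\mathbf{0}\}$. Normal $\mathfrak{gl}_n$-crystals: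 the standard crystal is $\{1,\dots,n\}$ with $\mathrm{wt}(j)=\mathbf{e}_j$, $f_i(i)=i+1$ and $f_i(j)=\mathbf{0}$ otherwise. On $b_1\otimes\cdots\otimes b_m$ (weight the sum of weights) $e_i,f_i$ act by the signature rule: write ")" for each factor equal to $i$ and "(" for each factor equal to $i+1$, cancel adjacent "()" pairs repeatedly to get $)^p(^q$; $e_i$ changes the factor of the leftmost unmatched "(" to $i$ ($\mathbf{0}$ if $q=0$), and $f_i$ changes the factor of the rightmost unmatched ")" to $i+1$ ($\mathbf{0}$ if $p=0$). A normal $\mathfrak{gl}_n$-crystal is a set with weight map and operators $e_i,f_i$ ($i\in[n-1]$) admitting a weight-preserving bijection commuting with all $e_i,f_i$ onto a finite disjoint union of connected components of such tensor powers. A $\mathfrak{gl}_n$-crystal isomorphism is a weight-preserving bijection commuting with all $e_i,f_i$. -}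

module Defs where

open import Data.Nat as ℕ using (ℕ; zero; suc; _≤_; _<_; _∸_; _≡ᵇ_)
open import Data.Integer as ℤ using (ℤ; +_; 0ℤ; 1ℤ)
open import Data.Bool using (Bool; true; false; if_then_else_; _∧_; _∨_; not; _xor_)
open import Data.List using (List; []; _∷_; _++_; map; reverse; length; concat; foldr; last)
open import Data.List.Membership.Propositional using (_∈_)
open import Data.List.Relation.Unary.All using (All)
open import Data.List.Relation.Unary.Linked using (Linked)
open import Data.Vec as Vec using (Vec)
import Data.Vec.Relation.Unary.All as VecAll
open import Data.Maybe as Maybe using (Maybe; just; nothing)
open import Data.Product using (Σ; _×_; _,_; proj₁; proj₂; ∃)
open import Data.Fin using (Fin; toℕ)
open import Data.Unit using (⊤)
open import Data.Empty using (⊥)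
open import Relation.Nullary.Decidable using (⌊_⌋)
open import Relation.Binary.PropositionalEquality using (_≡_)
open import Function.Bundles using (_⇔_)

_==ℤ_ : ℤ → ℤ → Bool
x ==ℤ y = ⌊ x ℤ.≟ y ⌋

ltℤ : ℤ → ℤ → Bool
ltℤ x y = ⌊ x ℤ.<? y ⌋

leℤ : ℤ → ℤ → Bool
leℤ x y = ⌊ x ℤ.≤? y ⌋

filterB : {A : Set} → (A → Bool) → List A → List A
filterB p [] = []
filterB p (x ∷ xs) = if p x then x ∷ filterB p xs else filterB p xs

anyB : {A : Set} → (A → Bool) → List A → Bool
anyB p [] = false
anyB p (x ∷ xs) = p x ∨ anyB p xs

countB : {A : Set} → (A → Bool) → List A → ℕ
countB p [] = zero
countB p (x ∷ xs) = if p x then suc (countB p xs) else countB p xs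

memℤ : ℤ → List ℤ → Bool
memℤ m = anyB (λ k → k ==ℤ m)

-- S_ℤ : finitary permutations of ℤ, generated by s_i = (i i+1).
-- An element of S_ℤ is given by any word in the generators; the
-- permutation denoted by a word c₁ ⋯ c_k is s_{c₁} ∘ ⋯ ∘ s_{c_k}.

s : ℤ → ℤ → ℤ
s i x = if x ==ℤ i then i ℤ.+ 1ℤ else (if x ==ℤ (i ℤ.+ 1ℤ) then i else x)

perm : List ℤ → ℤ → ℤ
perm [] x = x
perm (c ∷ cs) x = s c (perm cs x)

IsReducedWord : (ℤ → ℤ) → List ℤ → Set
IsReducedWord w cs =
  (∀ x → perm cs x ≡ w x) ×
  (∀ ds → (∀ x → perm ds x ≡ w x) → length cs ≤ length ds)

_∈Inv_ : ℤ × ℤ → (ℤ → ℤ) → Set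
(a , b) ∈Inv w = (a ℤ.< b) × (w b ℤ.< w a)

-- Primed letters: (m , false) is m, (m , true) is m' = m - 1/2.

Letter : Set
Letter = ℤ × Bool

⌈_⌉ : Letter → ℤ
⌈ x ⌉ = proj₁ x

primed : Letter → Bool
primed = proj₂

-- order-embedding of ℤ ∪ ℤ' into ℤ (multiply by 2): ⋯ < 1' < 1 < 2' < 2 < ⋯
key : Letter → ℤ
key (m , p) = (+ 2) ℤ.* m ℤ.- (if p then 1ℤ else 0ℤ)

eqL : Letter → Letter → Bool
eqL (m , p) (k , q) = (m ==ℤ k) ∧ not (p xor q)

-- x + k (for x primed, (m - 1/2) + k = (m + k)')
shift : Letter → ℤ → Letter
shift (m , p) k = (m ℤ.+ k , p)

flipL : Letter → Letter
flipL (m , p) = (m , not p)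

StrictlyDecreasing : List Letter → Set
StrictlyDecreasing = Linked (λ x y → key y ℤ.< key x)

marked : List Letter → List (ℤ × ℤ)
marked [] = []
marked ((m , p) ∷ rest) =
  (if p then (g m , g (m ℤ.+ 1ℤ)) ∷ [] else []) ++ marked rest
  where
  g : ℤ → ℤ
  g = perm (reverse (map ⌈_⌉ rest))

Tuple : ℕ → Set
Tuple n = Vec (List Letter) n

word : {n : ℕ} → Tuple n → List Letter
word a = concat (Vec.toList a)

RFplus : (n : ℕ) → (ℤ → ℤ) → Tuple n → Set
RFplus n w a = VecAll.All StrictlyDecreasing a × IsReducedWord w (map ⌈_⌉ (word a))

RFplusA : (n : ℕ) → (ℤ → ℤ) → List (ℤ × ℤ) → Tuple n → Set
RFplusA n w A a = RFplus n w a × (∀ p → (p ∈ marked (word a)) ⇔ (p ∈ A))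

RF : (n : ℕ) → (ℤ → ℤ) → Tuple n → Set
RF n w = RFplusA n w []

unprime : {n : ℕ} → Tuple n → Tuple n
unprime = Vec.map (map (λ x → (⌈ x ⌉ , false)))

wtRF : (n : ℕ) → Tuple n → Vec ℕ n
wtRF n = Vec.map length

largest : List Letter → Maybe Letter
largest [] = nothing
largest (x ∷ xs) with largest xs
... | nothing = just x
... | just y = if ltℤ (key x) (key y) then just y else just x

smallest : List Letter → Maybe Letter
smallest [] = nothing
smallest (x ∷ xs) with smallest xs
... | nothing = just x
... | just y = if ltℤ (key y) (key x) then just y else just x

removeL : Letter → List Letter → List Letter
removeL y [] = []
removeL y (x ∷ xs) = if eqL x y then xs else x ∷ removeL y xs

-- state: (pairs , unpaired letters of u , unpaired letters of v)
PairState : Set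
PairState = List (Letter × Letter) × List Letter × List Letter

pairStep : Letter → PairState → PairState
pairStep c (ps , avail , unV) with largest (filterB (λ b → ltℤ ⌈ b ⌉ ⌈ c ⌉) avail)
... | nothing = (ps , avail , c ∷ unV)
... | just b = ((b , c) ∷ ps , removeL b avail , unV)

pairing : List Letter → List Letter → PairState
pairing u v = foldr pairStep ([] , u , []) v

-- swapping primes on the selected pairs (simultaneously)
swapFst : List (Letter × Letter) → Letter → Letter
swapFst sel b =
  if anyB (λ bc → eqL (proj₁ bc) b ∧ (primed (proj₁ bc) xor primed (proj₂ bc))) sel
  then flipL b else b

swapSnd : List (Letter × Letter) → Letter → Letter
swapSnd sel c =
  if anyB (λ bc → eqL (proj₂ bc) c ∧ (primed (proj₁ bc) xor primed (proj₂ bc))) sel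
  then flipL c else c

insertDesc : Letter → List Letter → List Letter
insertDesc y [] = y ∷ []
insertDesc y (b ∷ bs) = if ltℤ (key b) (key y) then y ∷ b ∷ bs else b ∷ insertDesc y bs

-- minimal q ≥ 0 with m + q ∉ us (resp. m - q ∉ us); fuel length us + 1 suffices
gapUp : ℤ → List ℤ → ℕ → ℕ
gapUp m us zero = zero
gapUp m us (suc k) = if memℤ m us then suc (gapUp (m ℤ.+ 1ℤ) us k) else zero

gapDown : ℤ → List ℤ → ℕ → ℕ
gapDown m us zero = zero
gapDown m us (suc k) = if memℤ m us then suc (gapDown (m ℤ.- 1ℤ) us k) else zero

ePair : List Letter → List Letter → Maybe (List Letter × List Letter)
ePair u v with pairing u v
... | (ps , unU , unV) with largest unV
...   | nothing = nothing
...   | just x = just (insertDesc (shift x (+ q)) (map (swapFst sel) u) ,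
                        map (swapSnd sel) (removeL x v))
  where
  m : ℤ
  m = ⌈ x ⌉
  q : ℕ
  q = gapUp m (map ⌈_⌉ u) (suc (length u))
  sel : List (Letter × Letter)
  sel = filterB (λ bc → leℤ ⌈ proj₂ bc ⌉ (m ℤ.+ (+ q)) ∧ ltℤ m ⌈ proj₂ bc ⌉) ps

fPair : List Letter → List Letter → Maybe (List Letter × List Letter)
fPair u v with pairing u v
... | (ps , unU , unV) with smallest unU
...   | nothing = nothing
...   | just y = just (map (swapFst sel) (removeL y u) ,
                        insertDesc (shift y (ℤ.- (+ q))) (map (swapSnd sel) v))
  where
  m : ℤ
  m = ⌈ y ⌉
  q : ℕ
  q = gapDown m (map ⌈_⌉ v) (suc (length v))
  sel : List (Letter × Letter)
  sel = filterB (λ bc → ltℤ ⌈ proj₁ bc ⌉ m ∧ leℤ (m ℤ.- (+ q)) ⌈ proj₁ bc ⌉) ps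

-- act on the factors at (0-based) positions k and k+1
liftPair : {n : ℕ} → (List Letter → List Letter → Maybe (List Letter × List Letter)) →
           ℕ → Tuple n → Maybe (Tuple n)
liftPair g zero Vec.[] = nothing
liftPair g zero (u Vec.∷ Vec.[]) = nothing
liftPair g zero (u Vec.∷ v Vec.∷ rest) =
  Maybe.map (λ uv → proj₁ uv Vec.∷ proj₂ uv Vec.∷ rest) (g u v)
liftPair g (suc k) Vec.[] = nothing
liftPair g (suc k) (u Vec.∷ rest) = Maybe.map (u Vec.∷_) (liftPair g k rest)

-- e_i, f_i for i ∈ [n-1] (paper's 1-based index i acts on a^i, a^{i+1});
-- nothing plays the role of 𝟎
eRF : (n : ℕ) → ℕ → Tuple n → Maybe (Tuple n)
eRF n i = liftPair ePair (i ∸ 1)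

fRF : (n : ℕ) → ℕ → Tuple n → Maybe (Tuple n)
fRF n i = liftPair fPair (i ∸ 1)

-- Tensor powers of the standard gl_n crystal {1,…,n}: words in ℕ with
-- letters in [1,n]; signature rule.

setAt : ℕ → ℕ → List ℕ → List ℕ
setAt p y [] = []
setAt zero y (x ∷ xs) = y ∷ xs
setAt (suc p) y (x ∷ xs) = x ∷ setAt p y xs

-- scan left to right; ")" = factor i, "(" = factor i+1.
-- returns (positions of unmatched "(" , newest first ; positions of unmatched ")" , newest first)
sigScan : ℕ → ℕ → List ℕ → List ℕ → List ℕ → List ℕ × List ℕ
sigScan i pos os cs [] = (os , cs)
sigScan i pos os cs (x ∷ xs) with x ≡ᵇ suc i | x ≡ᵇ i | os
... | true | _ | _ = sigScan i (suc pos) (pos ∷ os) cs xs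
... | false | true | [] = sigScan i (suc pos) [] (pos ∷ cs) xs
... | false | true | (_ ∷ os') = sigScan i (suc pos) os' cs xs
... | false | false | _ = sigScan i (suc pos) os cs xs

eT : ℕ → List ℕ → Maybe (List ℕ)
eT i t with last (proj₁ (sigScan i 0 [] [] t))
... | nothing = nothing
... | just p = just (setAt p i t)

fT : ℕ → List ℕ → Maybe (List ℕ)
fT i t with proj₂ (sigScan i 0 [] [] t)
... | [] = nothing
... | p ∷ _ = just (setAt p (suc i) t)

wtT : (n : ℕ) → List ℕ → Vec ℕ n
wtT n t = Vec.tabulate (λ j → countB (λ x → x ≡ᵇ suc (toℕ j)) t)

data Reach (n : ℕ) (r : List ℕ) : List ℕ → Set where
  here : Reach n r r
  viaE : ∀ {t t'} i → 1 ≤ i → i < n → Reach n r t → eT i t ≡ just t' → Reach n r t'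
  viaF : ∀ {t t'} i → 1 ≤ i → i < n → Reach n r t → fT i t ≡ just t' → Reach n r t'

-- Normal gl_n-crystals and crystal isomorphisms, for a crystal given as a
-- subset P of an ambient type X with weight and partial operators.

Compat : {X T : Set} → (X → Set) → (X → T) → Maybe X → Maybe T → Set
Compat P ψ nothing nothing = ⊤
Compat P ψ (just y) (just t) = P y × ψ y ≡ t
Compat P ψ _ _ = ⊥

-- target: finite disjoint union (tagged by Fin K) of the connected
-- components of roots k ∈ B^{⊗ m_k}
onComp : {K : ℕ} → (ℕ → List ℕ → Maybe (List ℕ)) → ℕ →
         Fin K × List ℕ → Maybe (Fin K × List ℕ)
onComp op i (k , t) = Maybe.map (k ,_) (op i t)

record IsNormalCrystal (n : ℕ) {X : Set} (P : X → Set) (wt : X → Vec ℕ n)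
                       (e f : ℕ → X → Maybe X) : Set where
  field
    K : ℕ
    roots : Fin K → List ℕ
    roots-in-range : ∀ k → All (λ x → 1 ≤ x × x ≤ n) (roots k)
    ψ : X → Fin K × List ℕ
    ψ-into : ∀ x → P x → Reach n (roots (proj₁ (ψ x))) (proj₂ (ψ x))
    ψ-injective : ∀ x y → P x → P y → ψ x ≡ ψ y → x ≡ y
    ψ-surjective : ∀ k t → Reach n (roots k) t → ∃ λ x → P x × ψ x ≡ (k , t)
    ψ-wt : ∀ x → P x → wtT n (proj₂ (ψ x)) ≡ wt x
    ψ-e : ∀ i → 1 ≤ i → i < n → ∀ x → P x → Compat P ψ (e i x) (onComp eT i (ψ x))
    ψ-f : ∀ i → 1 ≤ i → i < n → ∀ x → P x → Compat P ψ (f i x) (onComp fT i (ψ x))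

record IsCrystalIso (n : ℕ) {X : Set} (P Q : X → Set) (wtP wtQ : X → Vec ℕ n)
                    (eP fP eQ fQ : ℕ → X → Maybe X) (φ : X → X) : Set where
  field
    into : ∀ x → P x → Q (φ x)
    injective : ∀ x y → P x → P y → φ x ≡ φ y → x ≡ y
    surjective : ∀ y → Q y → ∃ λ x → P x × φ x ≡ y
    wt-preserving : ∀ x → P x → wtQ (φ x) ≡ wtP x
    commute-e : ∀ i → 1 ≤ i → i < n → ∀ x → P x → Maybe.map φ (eP i x) ≡ eQ i (φ x)
    commute-f : ∀ i → 1 ≤ i → i < n → ∀ x → P x → Maybe.map φ (fP i x) ≡ fQ i (φ x)

{-# OPTIONS --safe #-}

-- Commutation and braid moves extend to primed words so that the marked pairs are preserved.  In a reduced
-- word, a letter y removed by f and its replacement y - q bound a segment y - q, …, y on which both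
-- factors are full, so that f is a composition of such moves and keeps the permutation, the length and the
-- marked pairs; e undoes f.  The primes of a reduced word are determined by its marked pairs, and priming
-- the letters of an unprimed word which cross the pairs of A inverts unprime.
--
-- For the comparison with words, forget the primes and row-insert the factors a¹, …, aⁿ, in the sense of
-- Edelman and Greene, into an empty row.  This yields bumped factors b¹, …, bⁿ, a final row and the column
-- of those i for which aⁱ lengthened the row.  The operators f and e act on the column followed by b as on
-- a tensor product and do not change the row.  Iterating, the columns form a word θ(a), while the rows form
-- the insertion tableau, which is constant on connected components; together they determine a.

module Submission where

open import Defs
open import Level using (0ℓ)
open import Data.Nat as ℕ using (ℕ; zero; suc; _≤_; _<_; _+_; _∸_; _≡ᵇ_; z≤n; s≤s)
import Data.Nat.Properties as ℕP
open import Data.Integer as ℤ using (ℤ; +_; 0ℤ; 1ℤ)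
import Data.Integer.Properties as ℤP
open import Data.Bool using (Bool; true; false; if_then_else_; _∧_; _xor_)
open import Data.List using (List; []; _∷_; _++_; map; reverse; length; concat; foldr; last; drop; upTo; lookup; deduplicate; filter)
open import Data.List.Properties using (unfold-reverse; map-∘; ++-assoc; length-++; length-map; map-++; ++-identityʳ; foldr-++; ∷-injective; ∷ʳ-injective)
open import Data.List.Membership.Propositional using (_∈_)
open import Data.List.Relation.Unary.All as All using (All; []; _∷_)
open import Data.List.Relation.Binary.Permutation.Propositional using (_↭_)
import Data.List.Relation.Binary.Permutation.Propositional as ↭
import Data.List.Relation.Binary.Permutation.Propositional.Properties as ↭P
open import Data.Maybe as Maybe using (Maybe; just; nothing)
open import Data.Product using (_×_; _,_; proj₁; proj₂; ∃; ∃₂)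
open import Data.Sum using (_⊎_; inj₁; inj₂)
open import Data.Unit using (⊤; tt)
open import Data.Empty using (⊥; ⊥-elim)
open import Function using (_∘_)
open import Relation.Nullary using (¬_; Dec; yes; no)
open import Relation.Binary using (Setoid; tri<; tri≈; tri>)
import Relation.Binary.Reasoning.Setoid as SetoidReasoning
open import Relation.Binary.PropositionalEquality using (_≡_; _≢_; refl; sym; trans; cong; cong₂; subst; subst₂; module ≡-Reasoning)
open import Algebra.Bundles using (module AbelianGroup)
open import Algebra.Properties.Group (AbelianGroup.group ℤP.+-0-abelianGroup) using () renaming (∙-cancelˡ to +ℤ-cancelˡ; ∙-cancelʳ to +ℤ-cancelʳ)
import Data.List.Membership.Propositional.Properties as ∈P
open import Data.List.Membership.DecPropositional ℤ._≟_ using () renaming (_∈?_ to _∈ℤ?_)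
open import Data.List.Relation.Unary.Any using (here; there)
import Data.List.Relation.Unary.All.Properties as AllP
open import Data.Vec as Vec using (Vec; []; _∷_)
open import Data.List.Relation.Unary.AllPairs using (AllPairs; []; _∷_)
open import Data.Bool.Properties using (∨-identityʳ; xor-comm)
open import Data.Fin as Fin using (Fin; toℕ)
import Data.List.Relation.Unary.Any as Any
import Data.List.Relation.Unary.Any.Properties as AnyP
import Data.List.Relation.Unary.Unique.DecPropositional.Properties as UniqueP
open import Data.List.Relation.Unary.Unique.Propositional using (Unique)
open import Data.Maybe.Properties using (just-injective)
open import Relation.Nullary.Decidable using (⌊_⌋; map′; _×-dec_)
open import Relation.Binary using (DecidableEquality)
open import Data.List.Relation.Unary.Linked as Linked using (Linked; []; [-]; _∷_)
open import Data.List.Relation.Unary.Linked.Properties using (Linked⇒AllPairs)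
import Data.Vec.Relation.Unary.All as VecAll
import Data.Vec.Properties as VecP
import Data.List.Relation.Unary.Linked.Properties as LinkedP
import Data.List.Properties as ListP
import Data.Bool.Properties as BoolP
import Data.Product.Properties as ProductP
open import Function.Bundles using (_⇔_; mk⇔; module Equivalence)

-- A factor is stored as the cells of a window common to all factorizations, and every construction
-- reads this window upwards. Pairing, the operators and insertion become finite-state processes,
-- and statements about them reduce to checks on one cell. The gap search of the definitions returns
-- only where `fPair` and `ePair` are compared with the cell version. For the operators and for
-- insertion, reducedness enters through squares: an unwanted configuration is brought by moves to a
-- word with two equal adjacent letters. Insertion carries a row through a factor by moves, so the
-- bumped factors form a reduced factorization again, and a shorter one, because the first nonempty
-- factor lengthens the empty row. This permits the iteration. Labels are left out of it, since the
-- marked pairs recover them. Different components may yield the same words, so an element is sent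
-- to its word together with the number of its component. The components have to be computed; this
-- works because candidates fill finitely many cells and a given element reveals the length of
-- reduced words, which makes membership decidable.

i≢i+1 : ∀ i → i ≢ i ℤ.+ 1ℤ
i≢i+1 i eq = ℤP.i≢suc[i] {i} (trans eq (ℤP.+-comm i 1ℤ))

s-at : ∀ i → s i i ≡ i ℤ.+ 1ℤ
s-at i with i ℤ.≟ i
... | yes _ = refl
... | no ¬p = ⊥-elim (¬p refl)

s-next : ∀ i → s i (i ℤ.+ 1ℤ) ≡ i
s-next i with (i ℤ.+ 1ℤ) ℤ.≟ i
... | yes p = ⊥-elim (i≢i+1 i (sym p))
... | no _ with (i ℤ.+ 1ℤ) ℤ.≟ (i ℤ.+ 1ℤ)
...   | yes _ = refl
...   | no ¬p = ⊥-elim (¬p refl)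

s-off : ∀ {i x} → x ≢ i → x ≢ i ℤ.+ 1ℤ → s i x ≡ x
s-off {i} {x} p q with x ℤ.≟ i
... | yes e = ⊥-elim (p e)
... | no _ with x ℤ.≟ (i ℤ.+ 1ℤ)
...   | yes e = ⊥-elim (q e)
...   | no _ = refl

data SView (i : ℤ) : ℤ → Set where
  at   : SView i i
  next : SView i (i ℤ.+ 1ℤ)
  off  : ∀ {x} → x ≢ i → x ≢ i ℤ.+ 1ℤ → SView i x

sview : ∀ i x → SView i x
sview i x with x ℤ.≟ i | x ℤ.≟ (i ℤ.+ 1ℤ)
... | yes refl | _ = at
... | no _ | yes refl = next
... | no p | no q = off p q

s-invol : ∀ i x → s i (s i x) ≡ x
s-invol i x with sview i x
... | at = trans (cong (s i) (s-at i)) (s-next i)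
... | next = trans (cong (s i) (s-next i)) (s-at i)
... | off p q = trans (cong (s i) (s-off p q)) (s-off p q)

Inj : (ℤ → ℤ) → Set
Inj g = ∀ {x y} → g x ≡ g y → x ≡ y

s-inj : ∀ i → Inj (s i)
s-inj i {x} {y} e = trans (sym (s-invol i x)) (trans (cong (s i) e) (s-invol i y))

perm-inj : ∀ cs → Inj (perm cs)
perm-inj [] e = e
perm-inj (c ∷ cs) e = perm-inj cs (s-inj c e)

perm-++ : ∀ u v x → perm (u ++ v) x ≡ perm u (perm v x)
perm-++ [] v x = refl
perm-++ (c ∷ u) v x = cong (s c) (perm-++ u v x)

-- Conjugating a transposition transposes the images. `conj` is the case that preserves the order of
-- the two values, `conj′` the case that reverses it.
conj : ∀ {c d} g → Inj g → g d ≡ c → g (d ℤ.+ 1ℤ) ≡ c ℤ.+ 1ℤ → ∀ x → s c (g x) ≡ g (s d x)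
conj {c} {d} g inj e e' x with sview d x
... | at = trans (cong (s c) e) (trans (s-at c) (trans (sym e') (cong g (sym (s-at d)))))
... | next = trans (cong (s c) e') (trans (s-next c) (trans (sym e) (cong g (sym (s-next d)))))
... | off p q = trans (s-off (λ z → p (inj (trans z (sym e)))) (λ z → q (inj (trans z (sym e'))))) (cong g (sym (s-off p q)))

conj′ : ∀ {c d} g → Inj g → g d ≡ c ℤ.+ 1ℤ → g (d ℤ.+ 1ℤ) ≡ c → ∀ x → s c (g x) ≡ g (s d x)
conj′ {c} {d} g inj e e' x with sview d x
... | at = trans (cong (s c) e) (trans (s-next c) (trans (sym e') (cong g (sym (s-at d)))))
... | next = trans (cong (s c) e') (trans (s-at c) (trans (sym e) (cong g (sym (s-next d)))))
... | off p q = trans (s-off (λ z → q (inj (trans z (sym e')))) (λ z → p (inj (trans z (sym e))))) (cong g (sym (s-off p q)))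

perm-reverse-∷ : ∀ c cs x → perm (reverse (c ∷ cs)) x ≡ perm (reverse cs) (s c x)
perm-reverse-∷ c cs x = trans (cong (λ l → perm l x) (unfold-reverse c cs)) (perm-++ (reverse cs) (c ∷ []) x)

perm-reverseˡ : ∀ cs x → perm (reverse cs) (perm cs x) ≡ x
perm-reverseˡ [] x = refl
perm-reverseˡ (c ∷ cs) x =
  trans (perm-reverse-∷ c cs (s c (perm cs x)))
        (trans (cong (perm (reverse cs)) (s-invol c (perm cs x))) (perm-reverseˡ cs x))

perm-reverseʳ : ∀ cs x → perm cs (perm (reverse cs) x) ≡ x
perm-reverseʳ [] x = refl
perm-reverseʳ (c ∷ cs) x =
  trans (cong (s c) (trans (cong (perm cs) (perm-reverse-∷ c cs x)) (perm-reverseʳ cs (s c x)))) (s-invol c x)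

-- Commutation and braid moves on labelled words

-- Words in ℕ × A encode words of (labelled) letters in the window starting at β.

val : ℤ → ℕ → ℤ
val β k = β ℤ.+ (+ k)

val-suc : ∀ β k → val β (suc k) ≡ val β k ℤ.+ 1ℤ
val-suc β k = trans (cong (λ z → β ℤ.+ (+ z)) (ℕP.+-comm 1 k)) (sym (ℤP.+-assoc β (+ k) 1ℤ))

val-inj : ∀ β {j k} → val β j ≡ val β k → j ≡ k
val-inj β {j} {k} e = ℤP.+-injective (+ℤ-cancelˡ β (+ j) (+ k) e)

Word : Set → Set
Word A = List (ℕ × A)

vals : {A : Set} → ℤ → Word A → List ℤ
vals β = map (λ x → val β (proj₁ x))

emb : ℤ → Word Bool → List Letter
emb β = map (λ x → val β (proj₁ x) , proj₂ x)

⌈emb⌉ : ∀ β w → map ⌈_⌉ (emb β w) ≡ vals β w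
⌈emb⌉ β w = sym (map-∘ w)

infix 4 _∼_
-- The labels stay with the crossings. Two commuting letters carry theirs along; a braid move
-- produces its three crossings in the opposite order, so its labels are reversed.
data _∼_ {A : Set} : Word A → Word A → Set where
  refl∼  : ∀ {u} → u ∼ u
  sym∼   : ∀ {u v} → u ∼ v → v ∼ u
  trans∼ : ∀ {u v w} → u ∼ v → v ∼ w → u ∼ w
  cons∼  : ∀ x {u v} → u ∼ v → x ∷ u ∼ x ∷ v
  comm∼  : ∀ {a b p q} w → suc a < b → (a , p) ∷ (b , q) ∷ w ∼ (b , q) ∷ (a , p) ∷ w
  braid∼ : ∀ {a p q r} w →
           (a , p) ∷ (suc a , q) ∷ (a , r) ∷ w ∼ (suc a , r) ∷ (a , q) ∷ (suc a , p) ∷ w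

∼-reflexive : {A : Set} {u v : Word A} → u ≡ v → u ∼ v
∼-reflexive refl = refl∼

++ˡ∼ : {A : Set} (p : Word A) {u v : Word A} → u ∼ v → p ++ u ∼ p ++ v
++ˡ∼ [] e = e
++ˡ∼ (x ∷ p) e = cons∼ x (++ˡ∼ p e)

++ʳ∼ : {A : Set} {u v : Word A} (r : Word A) → u ∼ v → u ++ r ∼ v ++ r
++ʳ∼ r refl∼ = refl∼
++ʳ∼ r (sym∼ e) = sym∼ (++ʳ∼ r e)
++ʳ∼ r (trans∼ e e') = trans∼ (++ʳ∼ r e) (++ʳ∼ r e')
++ʳ∼ r (cons∼ x e) = cons∼ x (++ʳ∼ r e)
++ʳ∼ r (comm∼ w l) = comm∼ (w ++ r) l
++ʳ∼ r (braid∼ w) = braid∼ (w ++ r)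

∼-setoid : Set → Setoid 0ℓ 0ℓ
∼-setoid A = record { Carrier = Word A ; _≈_ = _∼_ ; isEquivalence = record { refl = refl∼ ; sym = sym∼ ; trans = trans∼ } }

module ∼-Reasoning {A : Set} = SetoidReasoning (∼-setoid A)

∼-length : {A : Set} {u v : Word A} → u ∼ v → length u ≡ length v
∼-length refl∼ = refl
∼-length (sym∼ e) = sym (∼-length e)
∼-length (trans∼ e e') = trans (∼-length e) (∼-length e')
∼-length (cons∼ x e) = cong suc (∼-length e)
∼-length (comm∼ w l) = refl
∼-length (braid∼ w) = refl

val-far₁ : ∀ β {a b} → suc a < b → val β a ≢ val β b
val-far₁ β l e = ℕP.<⇒≢ (ℕP.<-trans (ℕP.n<1+n _) l) (val-inj β e)

val-far₂ : ∀ β {a b} → suc a < b → val β a ≢ val β b ℤ.+ 1ℤ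
val-far₂ β {a} {b} l e = ℕP.<⇒≢ (ℕP.m≤n⇒m≤1+n (ℕP.<-trans (ℕP.n<1+n _) l)) (val-inj β (trans e (sym (val-suc β b))))

val-far₃ : ∀ β {a b} → suc a < b → val β b ≢ val β a ℤ.+ 1ℤ
val-far₃ β {a} {b} l e = ℕP.<⇒≢ l (sym (val-inj β (trans e (sym (val-suc β a)))))

val-far₄ : ∀ β {a b} → suc a < b → val β a ℤ.+ 1ℤ ≢ val β b ℤ.+ 1ℤ
val-far₄ β {a} {b} l e = val-far₁ β l (+ℤ-cancelʳ 1ℤ _ _ e)

s-comm : ∀ β {a b} → suc a < b → ∀ x → s (val β a) (s (val β b) x) ≡ s (val β b) (s (val β a) x)
s-comm β {a} {b} l = conj (s (val β b)) (s-inj (val β b))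
  (s-off (val-far₁ β l) (val-far₂ β l))
  (s-off (λ e → val-far₃ β l (sym e)) (val-far₄ β l))

s-i-i+2 : ∀ i → s i ((i ℤ.+ 1ℤ) ℤ.+ 1ℤ) ≡ (i ℤ.+ 1ℤ) ℤ.+ 1ℤ
s-i-i+2 i = s-off i+2≢i (λ e → i≢i+1 (i ℤ.+ 1ℤ) (sym e))
  where
  i+2≢i : (i ℤ.+ 1ℤ) ℤ.+ 1ℤ ≢ i
  i+2≢i e with +ℤ-cancelˡ i (1ℤ ℤ.+ 1ℤ) 0ℤ (trans (sym (ℤP.+-assoc i 1ℤ 1ℤ)) (trans e (sym (ℤP.+-identityʳ i))))
  ... | ()

s-i+1-i : ∀ i → s (i ℤ.+ 1ℤ) i ≡ i
s-i+1-i i = s-off (i≢i+1 i) (λ e → i+2≢i (sym e))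
  where
  i+2≢i : (i ℤ.+ 1ℤ) ℤ.+ 1ℤ ≢ i
  i+2≢i e = i≢i+1 (i ℤ.+ 1ℤ) (s-inj i (trans (s-next i) (trans (sym e) (sym (s-i-i+2 i)))))

-- Conjugation by `s i` after `s (i + 1)`, which sends `i`, `i + 1` to `i + 1`, `i + 2`.
s-braid : ∀ i x → s i (s (i ℤ.+ 1ℤ) (s i x)) ≡ s (i ℤ.+ 1ℤ) (s i (s (i ℤ.+ 1ℤ) x))
s-braid i x = sym (conj {i ℤ.+ 1ℤ} {i} (λ y → s i (s (i ℤ.+ 1ℤ) y)) (λ e → s-inj (i ℤ.+ 1ℤ) (s-inj i e))
  (trans (cong (s i) (s-i+1-i i)) (s-at i))
  (trans (cong (s i) (s-at (i ℤ.+ 1ℤ))) (s-i-i+2 i)) x)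

∼-perm : ∀ β {A : Set} {u v : Word A} → u ∼ v → ∀ x → perm (vals β u) x ≡ perm (vals β v) x
∼-perm β refl∼ x = refl
∼-perm β (sym∼ e) x = sym (∼-perm β e x)
∼-perm β (trans∼ e e') x = trans (∼-perm β e x) (∼-perm β e' x)
∼-perm β (cons∼ y e) x = cong (s _) (∼-perm β e x)
∼-perm β (comm∼ w l) x = s-comm β l (perm (vals β w) x)
∼-perm β (braid∼ {a} w) x rewrite val-suc β a = s-braid (val β a) (perm (vals β w) x)

perm-reverse-cong : ∀ {u v} → (∀ x → perm u x ≡ perm v x) → ∀ y → perm (reverse u) y ≡ perm (reverse v) y
perm-reverse-cong {u} {v} e y =
  trans (sym (perm-reverseˡ v (perm (reverse u) y)))
        (cong (perm (reverse v)) (trans (sym (e (perm (reverse u) y))) (perm-reverseʳ u y)))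

markIf : Bool → ℤ × ℤ → List (ℤ × ℤ)
markIf p ab = if p then ab ∷ [] else []

markIf-cong : ∀ p {a a' b b'} → a ≡ a' → b ≡ b' → markIf p (a , b) ≡ markIf p (a' , b')
markIf-cong p refl refl = refl

↭-markIf₂ : ∀ P Q {R P' Q' : List (ℤ × ℤ)} → P ≡ P' → Q ≡ Q' → P ++ Q' ++ R ↭ Q ++ P' ++ R
↭-markIf₂ P Q {R} refl refl = ↭P.shifts P Q

↭-markIf₃ : ∀ P Q R {W P' Q' R' : List (ℤ × ℤ)} → P ≡ P' → Q ≡ Q' → R ≡ R' →
            P ++ Q ++ R ++ W ↭ R' ++ Q' ++ P' ++ W
↭-markIf₃ P Q R {W} refl refl refl =
  ↭.trans (↭P.++⁺ˡ P (↭P.shifts Q R)) (↭.trans (↭P.shifts P R) (↭P.++⁺ˡ R (↭P.shifts P Q)))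

-- The pair recorded by a letter depends only on the permutation of the letters to its right. A move
-- reorders the recorded pairs, so they are preserved as a multiset and not as a list.
∼-marked : ∀ β {u v : Word Bool} → u ∼ v → marked (emb β u) ↭ marked (emb β v)
∼-marked β refl∼ = ↭.refl
∼-marked β (sym∼ e) = ↭.↭-sym (∼-marked β e)
∼-marked β (trans∼ e e') = ↭.trans (∼-marked β e) (∼-marked β e')
∼-marked β (cons∼ (k , p) {u} {v} e) =
  subst (λ l → l ++ marked (emb β u) ↭ _) (markIf-cong p (h (val β k)) (h (val β k ℤ.+ 1ℤ)))
    (↭P.++⁺ˡ (markIf p _) (∼-marked β e))
  where
  h : ∀ y → perm (reverse (map ⌈_⌉ (emb β v))) y ≡ perm (reverse (map ⌈_⌉ (emb β u))) y
  h y = perm-reverse-cong {map ⌈_⌉ (emb β v)} {map ⌈_⌉ (emb β u)} (λ x → trans (cong (λ l → perm l x) (⌈emb⌉ β v))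
          (trans (sym (∼-perm β e x)) (cong (λ l → perm l x) (sym (⌈emb⌉ β u))))) y
∼-marked β (comm∼ {a} {b} {p} {q} w l) =
  ↭-markIf₂ _ _
    (markIf-cong p
      (trans (perm-reverse-∷ (val β b) W i) (cong (perm (reverse W)) (s-off (val-far₁ β l) (val-far₂ β l))))
      (trans (perm-reverse-∷ (val β b) W (i ℤ.+ 1ℤ)) (cong (perm (reverse W)) (s-off (λ e → val-far₃ β l (sym e)) (val-far₄ β l)))))
    (markIf-cong q
      (trans (perm-reverse-∷ i W (val β b)) (cong (perm (reverse W)) (s-off (λ e → val-far₁ β l (sym e)) (val-far₃ β l))))
      (trans (perm-reverse-∷ i W (val β b ℤ.+ 1ℤ)) (cong (perm (reverse W)) (s-off (λ e → val-far₂ β l (sym e)) (λ e → val-far₄ β l (sym e))))))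
  where
  i = val β a
  W = map ⌈_⌉ (emb β w)
∼-marked β (braid∼ {a} {p} {q} {r} w) rewrite val-suc β a =
  ↭-markIf₃ (markIf p _) (markIf q _) (markIf r _)
    (markIf-cong p
      (trans (rev₂ (i ℤ.+ 1ℤ) i i) (cong h (trans (cong (s i) (s-i+1-i i)) (s-at i))))
      (trans (rev₂ (i ℤ.+ 1ℤ) i (i ℤ.+ 1ℤ)) (cong h (trans (cong (s i) (s-at (i ℤ.+ 1ℤ))) (s-i-i+2 i)))))
    (markIf-cong q
      (trans (rev₁ i (i ℤ.+ 1ℤ)) (trans (cong h (trans (s-next i) (sym (s-i+1-i i)))) (sym (rev₁ (i ℤ.+ 1ℤ) i))))
      (trans (rev₁ i ((i ℤ.+ 1ℤ) ℤ.+ 1ℤ)) (trans (cong h (trans (s-i-i+2 i) (sym (s-at (i ℤ.+ 1ℤ))))) (sym (rev₁ (i ℤ.+ 1ℤ) (i ℤ.+ 1ℤ))))))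
    (markIf-cong r
      (sym (trans (rev₂ i (i ℤ.+ 1ℤ) (i ℤ.+ 1ℤ)) (cong h (trans (cong (s (i ℤ.+ 1ℤ)) (s-next i)) (s-i+1-i i)))))
      (sym (trans (rev₂ i (i ℤ.+ 1ℤ) ((i ℤ.+ 1ℤ) ℤ.+ 1ℤ)) (cong h (trans (cong (s (i ℤ.+ 1ℤ)) (s-i-i+2 i)) (s-next (i ℤ.+ 1ℤ)))))))
  where
  i = val β a
  W = map ⌈_⌉ (emb β w)
  h = perm (reverse W)
  rev₁ : ∀ c x → perm (reverse (c ∷ W)) x ≡ h (s c x)
  rev₁ c x = perm-reverse-∷ c W x
  rev₂ : ∀ c d x → perm (reverse (c ∷ d ∷ W)) x ≡ h (s d (s c x))
  rev₂ c d x = trans (perm-reverse-∷ c (d ∷ W) x) (rev₁ d (s c x))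

-- Reduced words and the pairs they cross

infix 4 _≗ₚ_
_≗ₚ_ : List ℤ → List ℤ → Set
u ≗ₚ v = ∀ x → perm u x ≡ perm v x

Red : List ℤ → Set
Red cs = ∀ ds → ds ≗ₚ cs → length cs ≤ length ds

Red-resp : ∀ {u v} → u ≗ₚ v → length u ≡ length v → Red u → Red v
Red-resp e l R ds h = subst (_≤ length ds) l (R ds (λ x → trans (h x) (sym (e x))))

-- A shorter word for the factor would shorten the whole word.
Red-mid : ∀ p q r → Red (p ++ q ++ r) → Red q
Red-mid p q r R ds h = ℕP.+-cancelʳ-≤ (length r) _ _ (ℕP.+-cancelˡ-≤ (length p) _ _ (subst₂ _≤_ (len q) (len ds) (R (p ++ ds ++ r) h')))
  where
  len : ∀ z → length (p ++ z ++ r) ≡ length p + (length z + length r)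
  len z = trans (length-++ p) (cong (_+_ (length p)) (length-++ z))
  h' : p ++ ds ++ r ≗ₚ p ++ q ++ r
  h' x rewrite perm-++ p (ds ++ r) x | perm-++ p (q ++ r) x | perm-++ ds r x | perm-++ q r x = cong (perm p) (h (perm r x))

¬Red-square : ∀ c → ¬ Red (c ∷ c ∷ [])
¬Red-square c R with R [] (λ x → sym (s-invol c x))
... | ()

-- The hypothesis cancels the two outer letters: `c ∷ mid ++ d ∷ []` and `mid` give the same
-- permutation.
¬Red-conj : ∀ c mid d → (∀ x → s c (perm mid x) ≡ perm mid (s d x)) → ¬ Red (c ∷ mid ++ d ∷ [])
¬Red-conj c mid d e R = ℕP.<-irrefl refl (ℕP.≤-trans (ℕP.≤-reflexive (cong suc (sym (trans (length-++ mid) (ℕP.+-comm (length mid) 1))))) (ℕP.m≤n⇒m≤1+n (R mid h)))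
  where
  h : mid ≗ₚ c ∷ mid ++ d ∷ []
  h x = sym (trans (cong (s c) (perm-++ mid (d ∷ []) x)) (trans (e (s d x)) (cong (perm mid) (s-invol d x))))

RedW : {A : Set} → ℤ → Word A → Set
RedW β w = Red (vals β w)

RedW-∼ : ∀ β {A : Set} {u v : Word A} → u ∼ v → RedW β u → RedW β v
RedW-∼ β {u = u} {v} e = Red-resp {vals β u} {vals β v} (∼-perm β e) (trans (length-map _ u) (trans (∼-length e) (sym (length-map _ v))))

RedW-mid : ∀ β {A : Set} (p q r : Word A) → RedW β (p ++ q ++ r) → RedW β q
RedW-mid β p q r R = Red-mid (vals β p) (vals β q) (vals β r)
  (subst Red (trans (map-++ _ p (q ++ r)) (cong (vals β p ++_) (map-++ _ q r))) R)

¬RedW-square : ∀ β {A : Set} p {k} {a b : A} r → ¬ RedW β (p ++ (k , a) ∷ (k , b) ∷ r)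
¬RedW-square β p {k} r R = ¬Red-square (val β k) (RedW-mid β p (_ ∷ _ ∷ []) r R)

-- The pairs (a_j , b_j) of all letters, primed or not.
crossings : List ℤ → List (ℤ × ℤ)
crossings [] = []
crossings (c ∷ r) = (perm (reverse r) c , perm (reverse r) (c ℤ.+ 1ℤ)) ∷ crossings r

∈-crossings : ∀ {a b} cs → (a , b) ∈ crossings cs →
              ∃ λ p → ∃ λ c → ∃ λ r → cs ≡ p ++ c ∷ r × perm r a ≡ c × perm r b ≡ c ℤ.+ 1ℤ
∈-crossings (c ∷ r) (here refl) = [] , c , r , refl , perm-reverseʳ r c , perm-reverseʳ r (c ℤ.+ 1ℤ)
∈-crossings (c ∷ r) (there m) with ∈-crossings r m
... | p , d , r' , refl , e , e' = c ∷ p , d , r' , refl , e , e'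

i<i+1 : ∀ i → i ℤ.< i ℤ.+ 1ℤ
i<i+1 i = subst (i ℤ.<_) (ℤP.+-comm 1ℤ i) (ℤP.suc[i]≤j⇒i<j ℤP.≤-refl)

<⇒+1≤ : ∀ {i j} → i ℤ.< j → i ℤ.+ 1ℤ ℤ.≤ j
<⇒+1≤ {i} {j} l = subst (ℤ._≤ j) (ℤP.+-comm 1ℤ i) (ℤP.i<j⇒suc[i]≤j l)

s-flips : ∀ c {x y} → x ℤ.< y → s c y ℤ.< s c x → x ≡ c × y ≡ c ℤ.+ 1ℤ
s-flips c {x} {y} l m with sview c x | sview c y
... | at | at = ⊥-elim (ℤP.<-irrefl refl l)
... | at | next = refl , refl
... | at | off p q rewrite s-at c | s-off p q = ⊥-elim (ℤP.<-irrefl refl (ℤP.<-≤-trans m (<⇒+1≤ l)))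
... | next | at = ⊥-elim (ℤP.<-asym l (i<i+1 c))
... | next | next = ⊥-elim (ℤP.<-irrefl refl l)
... | next | off p q rewrite s-next c | s-off p q =
  ⊥-elim (ℤP.<-asym m (ℤP.<-trans (i<i+1 c) l))
... | off p q | at rewrite s-at c | s-off p q =
  ⊥-elim (ℤP.<-asym m (ℤP.<-trans l (i<i+1 c)))
... | off p q | next rewrite s-next c | s-off p q =
  ⊥-elim (ℤP.<-irrefl refl (ℤP.<-≤-trans l (<⇒+1≤ m)))
... | off p q | off p' q' rewrite s-off p q | s-off p' q' = ⊥-elim (ℤP.<-asym l m)

-- Some letter must reverse the order of the two images, and by `s-flips` it does so only when they
-- are its own two values.
inversion⇒crossing : ∀ {a b} cs → a ℤ.< b → perm cs b ℤ.< perm cs a → (a , b) ∈ crossings cs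
inversion⇒crossing [] l m = ⊥-elim (ℤP.<-asym l m)
inversion⇒crossing {a} {b} (c ∷ r) l m with ℤP.<-cmp (perm r a) (perm r b)
... | tri> _ _ g = there (inversion⇒crossing r l g)
... | tri≈ _ e _ = ⊥-elim (ℤP.<⇒≢ l (perm-inj r e))
... | tri< g _ _ with s-flips c g m
...   | e , e' = here (cong₂ _,_ (trans (sym (perm-reverseˡ r a)) (cong (perm (reverse r)) e))
                                 (trans (sym (perm-reverseˡ r b)) (cong (perm (reverse r)) e')))

-- If a letter `d` of `r` had crossed the same pair, the letters in between would carry `d`, `d + 1`
-- to `c + 1`, `c`, and the two letters would cancel. The reversal comes from `d` itself having
-- exchanged the pair.
Red⇒crossing-new : ∀ c r → Red (c ∷ r) → ¬ (perm (reverse r) c , perm (reverse r) (c ℤ.+ 1ℤ)) ∈ crossings r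
Red⇒crossing-new c r R m with ∈-crossings r m
... | p , d , r' , refl , e , e' =
  ¬Red-conj c p d (conj′ (perm p) (perm-inj p) lo hi) (Red-mid [] (c ∷ p ++ d ∷ []) r' (subst Red (cong (c ∷_) (sym (++-assoc p (d ∷ []) r'))) R))
  where
  whole : ∀ x → perm p (s d (perm r' x)) ≡ perm (p ++ d ∷ r') x
  whole x = sym (perm-++ p (d ∷ r') x)
  hi : perm p (d ℤ.+ 1ℤ) ≡ c
  hi = trans (cong (perm p) (sym (trans (cong (s d) e) (s-at d)))) (trans (whole _) (perm-reverseʳ (p ++ d ∷ r') c))
  lo : perm p d ≡ c ℤ.+ 1ℤ
  lo = trans (cong (perm p) (sym (trans (cong (s d) e') (s-next d)))) (trans (whole _) (perm-reverseʳ (p ++ d ∷ r') (c ℤ.+ 1ℤ)))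

-- Otherwise the inversion created by `c` would be undone by a letter of `p` that crosses the two
-- values back, and this letter would cancel against `c`.
Red⇒inverted : ∀ p c r → Red (p ++ c ∷ r) → ∀ {a b} → perm r a ≡ c → perm r b ≡ c ℤ.+ 1ℤ →
               ¬ perm (p ++ c ∷ r) a ℤ.< perm (p ++ c ∷ r) b
Red⇒inverted p c r R {a} {b} e e' l with
  ∈-crossings p (inversion⇒crossing p (i<i+1 c)
    (subst₂ ℤ._<_ (whole a (c ℤ.+ 1ℤ) (trans (cong (s c) e) (s-at c))) (whole b c (trans (cong (s c) e') (s-next c))) l))
  where
  whole : ∀ x y → s c (perm r x) ≡ y → perm (p ++ c ∷ r) x ≡ perm p y
  whole x y h = trans (perm-++ p (c ∷ r) x) (cong (perm p) h)
... | p₁ , d , r₁ , refl , f , f' =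
  ¬Red-conj d r₁ c (conj (perm r₁) (perm-inj r₁) f f')
    (Red-mid p₁ (d ∷ r₁ ++ c ∷ []) r (subst Red (trans (++-assoc p₁ (d ∷ r₁) (c ∷ r)) (cong (λ z → p₁ ++ d ∷ z) (sym (++-assoc r₁ (c ∷ []) r)))) R))

s-preserves-≤ : ∀ {c d x} → d ≢ c → x ℤ.≤ c → s d x ℤ.≤ c
s-preserves-≤ {c} {d} {x} n l with sview d x
... | at rewrite s-at d = <⇒+1≤ (ℤP.≤∧≢⇒< l n)
... | next rewrite s-next d = ℤP.≤-trans (ℤP.<⇒≤ (i<i+1 d)) l
... | off p q rewrite s-off p q = l

s-preserves-> : ∀ {c d x} → d ≢ c → c ℤ.< x → c ℤ.< s d x
s-preserves-> {c} {d} {x} n l with sview d x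
... | at rewrite s-at d = ℤP.<-trans l (i<i+1 d)
... | next rewrite s-next d =
  ℤP.≤∧≢⇒< (ℤP.≮⇒≥ λ d<c → ℤP.<-irrefl refl (ℤP.<-≤-trans l (<⇒+1≤ d<c))) (λ e → n (sym e))
... | off p q rewrite s-off p q = l

perm-preserves-≤ : ∀ {c x} u → ¬ c ∈ u → x ℤ.≤ c → perm u x ℤ.≤ c
perm-preserves-≤ [] n l = l
perm-preserves-≤ (d ∷ u) n l = s-preserves-≤ (λ e → n (here (sym e))) (perm-preserves-≤ u (n ∘ there) l)

perm-preserves-> : ∀ {c x} u → ¬ c ∈ u → c ℤ.< x → c ℤ.< perm u x
perm-preserves-> [] n l = l
perm-preserves-> (d ∷ u) n l = s-preserves-> (λ e → n (here (sym e))) (perm-preserves-> u (n ∘ there) l)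

last-occurrence : ∀ {c} cs → c ∈ cs → ∃ λ p → ∃ λ r → cs ≡ p ++ c ∷ r × ¬ c ∈ r
last-occurrence {c} (x ∷ cs) m with c ∈ℤ? cs
... | yes m' with last-occurrence cs m'
...   | p , r , refl , n = x ∷ p , r , refl , n
last-occurrence (x ∷ cs) (here refl) | no n = [] , cs , refl , n
last-occurrence (x ∷ cs) (there m) | no n = ⊥-elim (n m)

-- If c does not occur in u then w = perm u preserves { x ≤ c }, whereas the last occurrence of c in
-- a reduced word of w would create an inversion between { x ≤ c } and its complement.
Red-support : ∀ {u cs c} → Red cs → cs ≗ₚ u → c ∈ cs → c ∈ u
Red-support {u} {cs} {c} R e m with c ∈ℤ? u
... | yes h = h
... | no n with last-occurrence cs m
...   | p , r , refl , n' = ⊥-elim (Red⇒inverted p c r R {a} {b} (perm-reverseʳ r c) (perm-reverseʳ r (c ℤ.+ 1ℤ))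
          (subst₂ ℤ._<_ (sym (e a)) (sym (e b)) (ℤP.≤-<-trans
            (perm-preserves-≤ u n (perm-preserves-≤ (reverse r) n'' ℤP.≤-refl))
            (perm-preserves-> u n (perm-preserves-> (reverse r) n'' (i<i+1 c))))))
  where
  a = perm (reverse r) c
  b = perm (reverse r) (c ℤ.+ 1ℤ)
  n'' : ¬ c ∈ reverse r
  n'' h = n' (↭P.∈-resp-↭ (↭P.↭-reverse r) h)

-- Factors as cells, their pairing and signature

-- A factor whose letters lie in a window of size m is a vector of m cells, the highest value first.

private variable
  A B : Set
  m n k : ℕ

Cells : Set → ℕ → Set
Cells A m = Vec (Maybe A) m

dec : Cells A m → Word A
dec [] = []
dec (nothing ∷ U) = dec U
dec {m = suc m} (just a ∷ U) = (m , a) ∷ dec U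

Below Above From Gap : ℕ → Word A → Set
Below m = All λ x → proj₁ x < m
Above m = All λ x → m < proj₁ x
From m = All λ x → m ≤ proj₁ x
Gap m = All λ x → suc (proj₁ x) < m

dec-< : (U : Cells A m) → Below m (dec U)
dec-< [] = []
dec-< (nothing ∷ U) = All.map ℕP.m≤n⇒m≤1+n (dec-< U)
dec-< (just a ∷ U) = ℕP.≤-refl ∷ All.map ℕP.m≤n⇒m≤1+n (dec-< U)

closeC openB : ℕ × ℕ → ℕ × ℕ
closeC (x , zero) = suc x , zero
closeC (x , suc o) = x , o
openB (x , o) = x , suc o

-- The numbers of unpaired letters of V and of unpaired letters of U.
sig : Cells A m → Cells A m → ℕ × ℕ
sig [] [] = 0 , 0
sig (x ∷ U) (y ∷ V) = Maybe.maybe′ (λ _ → openB) (λ st → st) x (Maybe.maybe′ (λ _ → closeC) (λ st → st) y (sig U V))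

Pairs : Set → Set
Pairs A = List ((ℕ × A) × (ℕ × A))

MatchState : Set → Set
MatchState A = Pairs A × Word A × Word A

closeM openM : (ℕ × A) → MatchState A → MatchState A
closeM c (ps , [] , un) = ps , [] , c ∷ un
closeM c (ps , b ∷ op , un) = (b , c) ∷ ps , op , un
openM b (ps , op , un) = ps , b ∷ op , un

-- The letters of `V` are taken in increasing order, and the largest smaller unpaired letter of `U`
-- is the one opened last, so pairing is a stack. At equal values `V` is read before `U`, because
-- pairs are strict.
match : Cells A m → Cells A m → MatchState A
match [] [] = [] , [] , []
match {m = suc m} (x ∷ U) (y ∷ V) =
  Maybe.maybe′ (λ b → openM (m , b)) (λ st → st) x (Maybe.maybe′ (λ c → closeM (m , c)) (λ st → st) y (match U V))

lengths : MatchState A → ℕ × ℕ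
lengths (ps , op , un) = length un , length op

lengths-closeM : ∀ (c : ℕ × A) st → lengths (closeM c st) ≡ closeC (lengths st)
lengths-closeM c (ps , [] , un) = refl
lengths-closeM c (ps , b ∷ op , un) = refl

sig-match : (U V : Cells A m) → lengths (match U V) ≡ sig U V
sig-match [] [] = refl
sig-match (nothing ∷ U) (nothing ∷ V) = sig-match U V
sig-match (just a ∷ U) (nothing ∷ V) = cong openB (sig-match U V)
sig-match (nothing ∷ U) (just c ∷ V) = trans (lengths-closeM _ (match U V)) (cong closeC (sig-match U V))
sig-match (just a ∷ U) (just c ∷ V) = cong openB (trans (lengths-closeM _ (match U V)) (cong closeC (sig-match U V)))

record Bounded (m : ℕ) (st : MatchState A) : Set where
  constructor bounded
  field
    pairs<    : All (λ p → proj₁ (proj₁ p) < m × proj₁ (proj₂ p) < m) (proj₁ st)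
    open<     : Below m (proj₁ (proj₂ st))
    unpaired< : Below m (proj₂ (proj₂ st))
open Bounded

Bounded-suc : ∀ {st : MatchState A} → Bounded m st → Bounded (suc m) st
Bounded-suc (bounded a b c) =
  bounded (All.map (λ (l , l') → ℕP.m≤n⇒m≤1+n l , ℕP.m≤n⇒m≤1+n l') a) (All.map ℕP.m≤n⇒m≤1+n b) (All.map ℕP.m≤n⇒m≤1+n c)

Bounded-closeM : ∀ {c} {st : MatchState A} → Bounded (suc m) st → Bounded (suc m) (closeM (m , c) st)
Bounded-closeM {st = ps , [] , un} (bounded a b c) = bounded a b (ℕP.≤-refl ∷ c)
Bounded-closeM {st = ps , x ∷ op , un} (bounded a (b ∷ bs) c) = bounded ((b , ℕP.≤-refl) ∷ a) bs c

Bounded-openM : ∀ {c} {st : MatchState A} → Bounded (suc m) st → Bounded (suc m) (openM (m , c) st)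
Bounded-openM (bounded a b c) = bounded a (ℕP.≤-refl ∷ b) c

match-bounded : (U V : Cells A m) → Bounded m (match U V)
match-bounded [] [] = bounded [] [] []
match-bounded (nothing ∷ U) (nothing ∷ V) = Bounded-suc (match-bounded U V)
match-bounded (just a ∷ U) (nothing ∷ V) = Bounded-openM (Bounded-suc (match-bounded U V))
match-bounded (nothing ∷ U) (just c ∷ V) = Bounded-closeM (Bounded-suc (match-bounded U V))
match-bounded (just a ∷ U) (just c ∷ V) = Bounded-openM (Bounded-closeM (Bounded-suc (match-bounded U V)))

Closed : Cells A m → Cells A m → Set
Closed U V = proj₂ (sig U V) ≡ 0

Closed⇒match : (U V : Cells A m) → Closed U V → ∃₂ λ ps un → match U V ≡ (ps , [] , un)
Closed⇒match U V o with match U V | sig-match U V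
... | ps , [] , un | _ = ps , un , refl
... | ps , x ∷ op , un | e with trans (cong proj₂ e) o
...   | ()

-- A letter in the top cell of `U` would stay unpaired for want of a larger letter of `V`, so that
-- cell is empty.
Closed⇒gap : (U V : Cells A m) → Closed U V → Gap m (dec U)
Closed⇒gap [] [] o = []
Closed⇒gap (nothing ∷ U) (y ∷ V) o = All.map s≤s (dec-< U)

-- The relation f (U , V) = (U' , V'), read upwards from the lowest cell.  The letter y removed from U
-- and the letter z = y - q inserted in V bound a segment on which U and V are full (up to the end cells).
-- In Mid d b e the label d is that of y, b is that of the topmost letter of U, and e is the label which
-- this letter receives, i.e. that of the next letter of V.  In Post j, j is the number of unpaired letters
-- of U above y.
data Mid {A : Set} : {m : ℕ} (d b e : A) (U V U' V' : Cells A m) → Set where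
  start : ∀ {m d b e} {U V : Cells A m} → Closed U V →
          Mid d b e (just b ∷ U) (nothing ∷ V) (just e ∷ U) (just d ∷ V)
  step  : ∀ {m d b e b' e'} {U V U' V' : Cells A m} → Mid d b e U V U' V' →
          Mid d b' e' (just b' ∷ U) (just e ∷ V) (just e' ∷ U') (just b ∷ V')

data Post {A : Set} : {m : ℕ} (j : ℕ) (U V U' V' : Cells A m) → Set where
  one   : ∀ {m d} {U V : Cells A m} → Closed U V →
          Post 0 (just d ∷ U) (nothing ∷ V) (nothing ∷ U) (just d ∷ V)
  top   : ∀ {m d b e} {U V U' V' : Cells A m} → Mid d b e U V U' V' →
          Post 0 (just d ∷ U) (just e ∷ V) (nothing ∷ U') (just b ∷ V')
  skip  : ∀ {m j} {U V U' V' : Cells A m} → Post j U V U' V' →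
          Post j (nothing ∷ U) (nothing ∷ V) (nothing ∷ U') (nothing ∷ V')
  opens : ∀ {m j a} {U V U' V' : Cells A m} → Post j U V U' V' →
          Post (suc j) (just a ∷ U) (nothing ∷ V) (just a ∷ U') (nothing ∷ V')
  close : ∀ {m j c} {U V U' V' : Cells A m} → Post (suc j) U V U' V' →
          Post j (nothing ∷ U) (just c ∷ V) (nothing ∷ U') (just c ∷ V')
  both  : ∀ {m j a c} {U V U' V' : Cells A m} → Post (suc j) U V U' V' →
          Post (suc j) (just a ∷ U) (just c ∷ V) (just a ∷ U') (just c ∷ V')

Mid-sig : ∀ {d b e} {U V U' V' : Cells A m} → Mid d b e U V U' V' →
          ∃ λ x → sig U V ≡ (x , 1) × sig U' V' ≡ (suc x , 1)
Mid-sig (start {U = U} {V} o) with sig U V | o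
... | x , .0 | refl = x , refl , refl
Mid-sig (step M) with Mid-sig M
... | x , e , e' rewrite e | e' = x , refl , refl

Post-sig : ∀ {j} {U V U' V' : Cells A m} → Post j U V U' V' →
           ∃ λ x → sig U V ≡ (x , suc j) × sig U' V' ≡ (suc x , j)
Post-sig (one {U = U} {V} o) with sig U V | o
... | x , .0 | refl = x , refl , refl
Post-sig (top M) with Mid-sig M
... | x , e , e' rewrite e | e' = x , refl , refl
Post-sig (skip P) = Post-sig P
Post-sig (opens P) with Post-sig P
... | x , e , e' rewrite e | e' = x , refl , refl
Post-sig (close P) with Post-sig P
... | x , e , e' rewrite e | e' = x , refl , refl
Post-sig (both P) with Post-sig P
... | x , e , e' rewrite e | e' = x , refl , refl

-- The operator f as a composition of moves

data Chain {A : Set} (z : ℕ) : ℕ → Pairs A → Set where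
  nil  : Chain z z []
  link : ∀ {k b c M} → Chain z k M → Chain z (suc k) (((k , b) , (suc k , c)) ∷ M)

Chain-≤ : ∀ {z y} {M : Pairs A} → Chain z y M → z ≤ y
Chain-≤ nil = ℕP.≤-refl
Chain-≤ (link c) = ℕP.m≤n⇒m≤1+n (Chain-≤ c)

swap₁ swap₂ : (ℕ × A) × (ℕ × A) → ℕ × A
swap₁ (b , c) = proj₁ b , proj₂ c
swap₂ (b , c) = proj₁ c , proj₂ b

swapPair : (ℕ × A) × (ℕ × A) → (ℕ × A) × (ℕ × A)
swapPair p = swap₁ p , swap₂ p

Chain-swap : ∀ {z y} {M : Pairs A} → Chain z y M → Chain z y (map swapPair M)
Chain-swap nil = nil
Chain-swap (link c) = link (Chain-swap c)

Chain-bounds : ∀ {z y} {M : Pairs A} → Chain z y M →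
               All (λ p → (z ≤ proj₁ (proj₁ p) × proj₁ (proj₁ p) < y) × (z < proj₁ (proj₂ p) × proj₁ (proj₂ p) ≤ y)) M
Chain-bounds nil = []
Chain-bounds (link c) =
  ((Chain-≤ c , ℕP.≤-refl) , (s≤s (Chain-≤ c) , ℕP.≤-refl)) ∷
  All.map (λ ((a , b) , (d , e)) → (a , ℕP.m≤n⇒m≤1+n b) , (d , ℕP.m≤n⇒m≤1+n e)) (Chain-bounds c)

comm-all : ∀ t (lo hi r : Word A) → Gap t lo → From t hi →
           lo ++ hi ++ r ∼ hi ++ lo ++ r
comm-all t [] hi r a b = refl∼
comm-all t (x ∷ lo) hi r (l ∷ a) b = trans∼ (cons∼ x (comm-all t lo hi r a b)) (one-all hi b)
  where
  one-all : ∀ hi → From t hi → x ∷ hi ++ lo ++ r ∼ hi ++ x ∷ lo ++ r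
  one-all [] [] = refl∼
  one-all (h ∷ hi) (l' ∷ b) = trans∼ (comm∼ _ (ℕP.≤-trans l l')) (cons∼ h (one-all hi b))

fsts snds : Pairs A → Word A
fsts = map proj₁
snds = map proj₂

-- Each pair `k`, `k + 1` of the chain costs one braid move: `k + 1, k, k + 1` becomes
-- `k, k + 1, k`, which exchanges the labels of the pair and passes `d` one value down. This is the
-- origin of the prime swaps in the operators.
Chain-∼ : ∀ {z y} {M : Pairs A} d r → Chain z y M →
          (y , d) ∷ fsts M ++ snds M ++ r ∼ map swap₁ M ++ map swap₂ M ++ (z , d) ∷ r
Chain-∼ d r nil = refl∼
Chain-∼ {z = z} d r (link {k} {b} {c} {M} ch) = begin
  (suc k , d) ∷ (k , b) ∷ fsts M ++ (suc k , c) ∷ snds M ++ r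
    ≈⟨ cons∼ _ (cons∼ _ (comm-all (suc k) (fsts M) ((suc k , c) ∷ []) _
         (AllP.map⁺ (All.map (λ ((_ , l) , _) → s≤s l) (Chain-bounds ch))) (ℕP.≤-refl ∷ []))) ⟩
  (suc k , d) ∷ (k , b) ∷ (suc k , c) ∷ fsts M ++ snds M ++ r
    ≈⟨ sym∼ (braid∼ _) ⟩
  (k , c) ∷ (suc k , b) ∷ (k , d) ∷ fsts M ++ snds M ++ r
    ≈⟨ cons∼ _ (cons∼ _ (Chain-∼ d r ch)) ⟩
  (k , c) ∷ (suc k , b) ∷ map swap₁ M ++ map swap₂ M ++ (z , d) ∷ r
    ≈⟨ cons∼ _ (sym∼ (comm-all (suc k) (map swap₁ M) ((suc k , b) ∷ []) _
         (AllP.map⁺ (All.map (λ ((_ , l) , _) → s≤s l) (Chain-bounds ch))) (ℕP.≤-refl ∷ []))) ⟩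
  (k , c) ∷ map swap₁ M ++ (suc k , b) ∷ map swap₂ M ++ (z , d) ∷ r ∎
  where open ∼-Reasoning

-- Commutations alone bring the segments `X` and `Y` together: `u0` stays below `z - 1`, and
-- everything in `vP` exceeds `y + 1`.
gather : ∀ z y (uP X u0 vP Y v0 : Word A) →
         Gap z u0 → From z vP → From z Y →
         All (λ x → proj₁ x ≤ y) X → From (suc (suc y)) vP →
         (uP ++ X ++ u0) ++ (vP ++ Y ++ v0) ∼ uP ++ vP ++ X ++ Y ++ u0 ++ v0
gather z y uP X u0 vP Y v0 u0< vP≥ Y≥ X≤ vP> = begin
  (uP ++ X ++ u0) ++ (vP ++ Y ++ v0) ≡⟨ trans (++-assoc uP (X ++ u0) _) (cong (uP ++_) (++-assoc X u0 _)) ⟩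
  uP ++ X ++ u0 ++ vP ++ Y ++ v0     ≈⟨ ++ˡ∼ uP (++ˡ∼ X (comm-all z u0 vP _ u0< vP≥)) ⟩
  uP ++ X ++ vP ++ u0 ++ Y ++ v0     ≈⟨ ++ˡ∼ uP (++ˡ∼ X (++ˡ∼ vP (comm-all z u0 Y v0 u0< Y≥))) ⟩
  uP ++ X ++ vP ++ Y ++ u0 ++ v0     ≈⟨ ++ˡ∼ uP (comm-all (suc (suc y)) X vP _ (All.map (λ l → s≤s (s≤s l)) X≤) vP>) ⟩
  uP ++ vP ++ X ++ Y ++ u0 ++ v0     ∎
  where open ∼-Reasoning

-- The segment z, …, k occurs in both words.  By Chain-∼ their product is not reduced unless the second word
-- contains k + 1.
record Danger {A : Set} (k : ℕ) (u v : Word A) : Set where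
  constructor danger
  field
    {z}     : ℕ
    {d c}   : A
    {M}     : Pairs A
    {u0 v0} : Word A
    chain   : Chain z k M
    u≡      : u ≡ (k , d) ∷ fsts M ++ u0
    v≡      : v ≡ snds M ++ (z , c) ∷ v0
    gap     : Gap z u0

-- Made to survive the reading of higher cells: `p` absorbs the higher letters of the first factor
-- and `q` those of the second, which separate the two words.
Bad : ℕ → Word A → Word A → Set
Bad m u v = ∀ β p q → From m q → ¬ RedW β (p ++ u ++ q ++ v)

-- Carried down the chain, the leading letter `k` becomes a `z` next to the `z` of the second word,
-- a square. The letters of `q` are at least `k + 2` and do not interfere.
Danger⇒Bad : ∀ {k} {u v : Word A} → Danger k u v → Bad (suc (suc k)) u v
Danger⇒Bad {k = k} (danger {z} {d} {c} {M} {u0} {v0} ch refl refl gap) β p q q> R =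
  ¬RedW-square β (p ++ q ++ map swap₁ M ++ map swap₂ M) (u0 ++ v0) (RedW-∼ β eq R)
  where
  open ∼-Reasoning
  bs = Chain-bounds ch
  q≥z : From z q
  q≥z = All.map (λ l → ℕP.≤-trans (Chain-≤ ch) (ℕP.≤-trans (ℕP.n≤1+n k) (ℕP.≤-trans (ℕP.n≤1+n _) l))) q>
  eq : p ++ ((k , d) ∷ fsts M ++ u0) ++ q ++ snds M ++ (z , c) ∷ v0 ∼
       (p ++ q ++ map swap₁ M ++ map swap₂ M) ++ (z , d) ∷ (z , c) ∷ u0 ++ v0
  eq = begin
    p ++ ((k , d) ∷ fsts M ++ u0) ++ q ++ snds M ++ (z , c) ∷ v0
      ≡⟨ cong (λ w → p ++ ((k , d) ∷ fsts M ++ u0) ++ q ++ w) (sym (++-assoc (snds M) ((z , c) ∷ []) v0)) ⟩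
    p ++ ((k , d) ∷ fsts M ++ u0) ++ q ++ (snds M ++ (z , c) ∷ []) ++ v0
      ≈⟨ ++ˡ∼ p (gather z k [] ((k , d) ∷ fsts M) u0 q (snds M ++ (z , c) ∷ []) v0 gap q≥z
           (AllP.++⁺ (AllP.map⁺ (All.map (λ (_ , l , _) → ℕP.<⇒≤ l) bs)) (ℕP.≤-refl ∷ []))
           (ℕP.≤-refl ∷ AllP.map⁺ (All.map (λ ((_ , l) , _) → ℕP.<⇒≤ l) bs)) q>) ⟩
    p ++ q ++ ((k , d) ∷ fsts M) ++ (snds M ++ (z , c) ∷ []) ++ u0 ++ v0
      ≡⟨ cong (λ w → p ++ q ++ (k , d) ∷ fsts M ++ w) (++-assoc (snds M) ((z , c) ∷ []) (u0 ++ v0)) ⟩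
    p ++ q ++ (k , d) ∷ fsts M ++ snds M ++ (z , c) ∷ u0 ++ v0
      ≈⟨ ++ˡ∼ p (++ˡ∼ q (Chain-∼ d _ ch)) ⟩
    p ++ q ++ map swap₁ M ++ map swap₂ M ++ (z , d) ∷ (z , c) ∷ u0 ++ v0
      ≡⟨ sym (trans (++-assoc p _ _) (cong (p ++_) (trans (++-assoc q _ _) (cong (q ++_) (++-assoc (map swap₁ M) _ _))))) ⟩
    (p ++ q ++ map swap₁ M ++ map swap₂ M) ++ (z , d) ∷ (z , c) ∷ u0 ++ v0 ∎

Bad-∷ : ∀ {m} (x y : Maybe A) (U V : Cells A m) → Bad m (dec U) (dec V) → Bad (suc m) (dec (x ∷ U)) (dec (y ∷ V))
Bad-∷ {A} {m} x y U V B β p q q> R =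
  B β (p ++ hd x) (q ++ hd y) (AllP.++⁺ (All.map (ℕP.≤-trans (ℕP.n≤1+n m)) q>) (hd≥ y)) (subst (RedW β) eq R)
  where
  hd : Maybe A → Word A
  hd nothing = []
  hd (just a) = (m , a) ∷ []
  hd≥ : ∀ y → From m (hd y)
  hd≥ nothing = []
  hd≥ (just a) = ℕP.≤-refl ∷ []
  dec-hd : ∀ x (U : Cells A m) → dec (x ∷ U) ≡ hd x ++ dec U
  dec-hd nothing U = refl
  dec-hd (just a) U = refl
  eq : p ++ dec (x ∷ U) ++ q ++ dec (y ∷ V) ≡ (p ++ hd x) ++ dec U ++ (q ++ hd y) ++ dec V
  eq rewrite dec-hd x U | dec-hd y V | ++-assoc p (hd x) (dec U ++ (q ++ hd y) ++ dec V)
           | ++-assoc (hd x) (dec U) (q ++ hd y ++ dec V) | ++-assoc q (hd y) (dec V) = refl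

record MidLists {A : Set} (k : ℕ) (d b e : A) (u v u' v' : Word A) (st st' : MatchState A) : Set where
  field
    {z}   : ℕ
    {M}   : Pairs A
    {u0 v0 n0} : Word A
    {p0}  : Pairs A
    chain : Chain z k M
    u≡    : u ≡ (k , b) ∷ fsts M ++ u0
    v≡    : v ≡ snds M ++ v0
    u′≡   : u' ≡ (k , e) ∷ map swap₁ M ++ u0
    v′≡   : v' ≡ map swap₂ M ++ (z , d) ∷ v0
    u0<   : Gap z u0
    v0<   : Below z v0
    st≡   : st ≡ (M ++ p0 , (k , b) ∷ [] , n0)
    st′≡  : st' ≡ (map swapPair M ++ p0 , (k , e) ∷ [] , (z , d) ∷ n0)
    p0<   : Bounded z (p0 , [] , n0)

mid-lists : ∀ {d b e} {U V U' V' : Cells A (suc k)} → Mid d b e U V U' V' →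
            MidLists k d b e (dec U) (dec V) (dec U') (dec V') (match U V) (match U' V')
mid-lists (start {U = U} {V} o) with Closed⇒match U V o | match-bounded U V
... | ps , un , e | B = record
  { chain = nil ; u≡ = refl ; v≡ = refl ; u′≡ = refl ; v′≡ = refl
  ; u0< = Closed⇒gap U V o ; v0< = dec-< V
  ; st≡ = cong (openM _) e ; st′≡ = cong (λ st → openM _ (closeM _ st)) e ; p0< = subst (Bounded _) e B }
mid-lists {k = suc k} (step P) with mid-lists P
... | L = record
  { chain = link chain ; u≡ = cong (_ ∷_) u≡ ; v≡ = cong (_ ∷_) v≡ ; u′≡ = cong (_ ∷_) u′≡ ; v′≡ = cong (_ ∷_) v′≡
  ; u0< = u0< ; v0< = v0<
  ; st≡ = cong (λ st → openM _ (closeM _ st)) st≡ ; st′≡ = cong (λ st → openM _ (closeM _ st)) st′≡ ; p0< = p0< }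
  where open MidLists L

-- A name ending in `P` denotes what lies above the segment, one ending in `0` what lies below it.
-- The bound `y+j<m` leaves room for the `j` open letters above `y`; for positive `j` it places the
-- next cell above `y + 1`, as `vP>` requires.
record PostLists {A : Set} (m j : ℕ) (u v u' v' : Word A) (st st' : MatchState A) : Set where
  field
    {y z} : ℕ
    {d}   : A
    {M}   : Pairs A
    {uP vP u0 v0 oP n0} : Word A
    {pP p0} : Pairs A
    chain : Chain z y M
    u≡    : u ≡ uP ++ (y , d) ∷ fsts M ++ u0
    v≡    : v ≡ vP ++ snds M ++ v0
    u′≡   : u' ≡ uP ++ map swap₁ M ++ u0
    v′≡   : v' ≡ vP ++ map swap₂ M ++ (z , d) ∷ v0
    uP>   : Above y uP
    vP>   : Above (suc y) vP
    u0<   : Gap z u0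
    v0<   : Below z v0
    st≡   : st ≡ (pP ++ M ++ p0 , oP ++ (y , d) ∷ [] , n0)
    st′≡  : st' ≡ (pP ++ map swapPair M ++ p0 , oP , (z , d) ∷ n0)
    pP>   : All (λ p → y < proj₁ (proj₁ p) × y < proj₁ (proj₂ p)) pP
    oP>   : Above y oP
    oP#   : length oP ≡ j
    p0<   : Bounded z (p0 , [] , n0)
    y+j<m : y + j < m

post-lists : ∀ {j} {U V U' V' : Cells A m} → Post j U V U' V' →
             PostLists m j (dec U) (dec V) (dec U') (dec V') (match U V) (match U' V')
post-lists (one {m} {U = U} {V} o) with Closed⇒match U V o | match-bounded U V
... | ps , un , e | B = record
  { chain = nil ; u≡ = refl ; v≡ = refl ; u′≡ = refl ; v′≡ = refl ; uP> = [] ; vP> = []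
  ; u0< = Closed⇒gap U V o ; v0< = dec-< V
  ; st≡ = cong (openM _) e ; st′≡ = cong (closeM _) e ; pP> = [] ; oP> = [] ; oP# = refl
  ; p0< = subst (Bounded _) e B ; y+j<m = ℕP.≤-reflexive (cong suc (ℕP.+-identityʳ m)) }
post-lists (top {suc k} P) with mid-lists P
... | L = record
  { chain = link chain ; u≡ = cong (_ ∷_) u≡ ; v≡ = cong (_ ∷_) v≡ ; u′≡ = u′≡ ; v′≡ = cong (_ ∷_) v′≡
  ; uP> = [] ; vP> = [] ; u0< = u0< ; v0< = v0<
  ; st≡ = cong (λ st → openM _ (closeM _ st)) st≡ ; st′≡ = cong (closeM _) st′≡ ; pP> = [] ; oP> = [] ; oP# = refl
  ; p0< = p0< ; y+j<m = ℕP.≤-reflexive (cong suc (ℕP.+-identityʳ (suc k))) }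
  where open MidLists L
post-lists (skip P) = record
  { chain = chain ; u≡ = u≡ ; v≡ = v≡ ; u′≡ = u′≡ ; v′≡ = v′≡ ; uP> = uP> ; vP> = vP> ; u0< = u0< ; v0< = v0<
  ; st≡ = st≡ ; st′≡ = st′≡ ; pP> = pP> ; oP> = oP> ; oP# = oP# ; p0< = p0< ; y+j<m = ℕP.m≤n⇒m≤1+n y+j<m }
  where open PostLists (post-lists P)
post-lists (opens {m} {j} {a} P) with post-lists P
... | L = record
  { chain = chain ; u≡ = cong (_ ∷_) u≡ ; v≡ = v≡ ; u′≡ = cong (_ ∷_) u′≡ ; v′≡ = v′≡
  ; uP> = y<m ∷ uP> ; vP> = vP> ; u0< = u0< ; v0< = v0<
  ; st≡ = cong (openM _) st≡ ; st′≡ = cong (openM _) st′≡ ; pP> = pP> ; oP> = y<m ∷ oP> ; oP# = cong suc oP#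
  ; p0< = p0< ; y+j<m = subst (_< suc m) (sym (ℕP.+-suc y j)) (s≤s y+j<m) }
  where
  open PostLists L
  y<m = ℕP.≤-<-trans (ℕP.m≤m+n y j) y+j<m
post-lists (close {m} {j} P) with post-lists P
... | record { oP = x ∷ oP ; chain = chain ; u≡ = u≡ ; v≡ = v≡ ; u′≡ = u′≡ ; v′≡ = v′≡ ; uP> = uP> ; vP> = vP> ; u0< = u0< ; v0< = v0<
             ; st≡ = st≡ ; st′≡ = st′≡ ; pP> = pP> ; oP> = x> ∷ oP> ; oP# = oP# ; p0< = p0< ; y+j<m = y+j<m } = record
  { chain = chain ; u≡ = u≡ ; v≡ = cong (_ ∷_) v≡ ; u′≡ = u′≡ ; v′≡ = cong (_ ∷_) v′≡
  ; uP> = uP> ; vP> = y+1<m ∷ vP> ; u0< = u0< ; v0< = v0<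
  ; st≡ = cong (closeM _) st≡ ; st′≡ = cong (closeM _) st′≡ ; pP> = (x> , ℕP.<⇒≤ y+1<m) ∷ pP> ; oP> = oP> ; oP# = ℕP.suc-injective oP#
  ; p0< = p0< ; y+j<m = ℕP.m≤n⇒m≤1+n (ℕP.<⇒≤ y+j+1<m) }
  where
  y+j+1<m = subst (_< m) (ℕP.+-suc _ j) y+j<m
  y+1<m = ℕP.≤-<-trans (s≤s (ℕP.m≤m+n _ j)) y+j+1<m
post-lists (both {m} {j} P) with post-lists P
... | record { oP = x ∷ oP ; chain = chain ; u≡ = u≡ ; v≡ = v≡ ; u′≡ = u′≡ ; v′≡ = v′≡ ; uP> = uP> ; vP> = vP> ; u0< = u0< ; v0< = v0<
             ; st≡ = st≡ ; st′≡ = st′≡ ; pP> = pP> ; oP> = x> ∷ oP> ; oP# = oP# ; p0< = p0< ; y+j<m = y+j<m } = record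
  { chain = chain ; u≡ = cong (_ ∷_) u≡ ; v≡ = cong (_ ∷_) v≡ ; u′≡ = cong (_ ∷_) u′≡ ; v′≡ = cong (_ ∷_) v′≡
  ; uP> = ℕP.<⇒≤ y+1<m ∷ uP> ; vP> = y+1<m ∷ vP> ; u0< = u0< ; v0< = v0<
  ; st≡ = cong (λ st → openM _ (closeM _ st)) st≡ ; st′≡ = cong (λ st → openM _ (closeM _ st)) st′≡
  ; pP> = (x> , ℕP.<⇒≤ y+1<m) ∷ pP> ; oP> = ℕP.<⇒≤ y+1<m ∷ oP> ; oP# = oP#
  ; p0< = p0< ; y+j<m = ℕP.m≤n⇒m≤1+n y+j<m }
  where
  y+j+1<m = subst (_< m) (ℕP.+-suc _ j) y+j<m
  y+1<m = ℕP.≤-<-trans (s≤s (ℕP.m≤m+n _ j)) y+j+1<m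

Post⇒∼ : ∀ {j} {U V U' V' : Cells A m} → Post j U V U' V' → dec U ++ dec V ∼ dec U' ++ dec V'
Post⇒∼ {U = U} {V} {U'} {V'} P = begin
  dec U ++ dec V
    ≡⟨ cong₂ _++_ u≡ v≡ ⟩
  (uP ++ ((y , d) ∷ fsts M) ++ u0) ++ (vP ++ snds M ++ v0)
    ≈⟨ gather z y uP ((y , d) ∷ fsts M) u0 vP (snds M) v0 u0< vP≥z
         (AllP.map⁺ (All.map (λ (_ , l , _) → ℕP.<⇒≤ l) bs)) (ℕP.≤-refl ∷ AllP.map⁺ (All.map (λ ((_ , l) , _) → ℕP.<⇒≤ l) bs)) vP> ⟩
  uP ++ vP ++ ((y , d) ∷ fsts M) ++ snds M ++ u0 ++ v0
    ≈⟨ ++ˡ∼ uP (++ˡ∼ vP (Chain-∼ d (u0 ++ v0) chain)) ⟩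
  uP ++ vP ++ map swap₁ M ++ map swap₂ M ++ (z , d) ∷ u0 ++ v0
    ≡⟨ cong (λ w → uP ++ vP ++ map swap₁ M ++ w) (sym (++-assoc (map swap₂ M) ((z , d) ∷ []) (u0 ++ v0))) ⟩
  uP ++ vP ++ map swap₁ M ++ (map swap₂ M ++ (z , d) ∷ []) ++ u0 ++ v0
    ≈⟨ sym∼ (gather z y uP (map swap₁ M) u0 vP (map swap₂ M ++ (z , d) ∷ []) v0 u0< vP≥z
         (AllP.++⁺ (AllP.map⁺ (All.map (λ (_ , l , _) → ℕP.<⇒≤ l) bs)) (ℕP.≤-refl ∷ []))
         (AllP.map⁺ (All.map (λ ((_ , l) , _) → ℕP.<⇒≤ l) bs)) vP>) ⟩
  (uP ++ map swap₁ M ++ u0) ++ (vP ++ (map swap₂ M ++ (z , d) ∷ []) ++ v0)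
    ≡⟨ cong₂ _++_ (sym u′≡) (trans (cong (vP ++_) (++-assoc (map swap₂ M) ((z , d) ∷ []) v0)) (sym v′≡)) ⟩
  dec U' ++ dec V' ∎
  where
  open ∼-Reasoning
  open PostLists (post-lists P)
  bs = Chain-bounds chain
  vP≥z : From z vP
  vP≥z = All.map (λ l → ℕP.≤-trans (Chain-≤ chain) (ℕP.<⇒≤ (ℕP.<⇒≤ l))) vP>

-- Totality of f and e on reduced words

Mid-relabel : ∀ {d b e} {U V U' V' : Cells A m} → Mid d b e U V U' V' →
              ∀ d' e' → ∃₂ λ U'' V'' → Mid d' b e' U V U'' V''
Mid-relabel (start o) d' e' = _ , _ , start o
Mid-relabel (step {e = e} P) d' e' with Mid-relabel P d' e
... | _ , _ , P' = _ , _ , step P'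

Mid-relabelᵇ : ∀ {d b e} {U V U' V' : Cells A m} → Mid d b e U V U' V' → ∀ b' → ∃ λ U'' → Mid d b' e U'' V U' V'
Mid-relabelᵇ (start o) b' = _ , start o
Mid-relabelᵇ (step P) b' = _ , step P

-- In `pending` the only open letter of `U` is the top one, and it stands over a segment shared with
-- `V`. The word can then be reduced only if `V` contains the next value, which pairs that letter;
-- `bad` records that this has failed.
data FStatus {A : Set} {m : ℕ} (U V : Cells A m) : Set where
  none    : Closed U V → FStatus U V
  some    : ∀ {j U' V'} → Post j U V U' V' → FStatus U V
  pending : ∀ {k} → m ≡ suc k → proj₂ (sig U V) ≡ 1 → Danger k (dec U) (dec V) → FStatus U V
  bad     : Bad m (dec U) (dec V) → FStatus U V

fstatus : (U V : Cells A m) → FStatus U V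
fstatus [] [] = none refl
fstatus (x ∷ U) (y ∷ V) with fstatus U V
fstatus (x ∷ U) (y ∷ V) | bad B = bad (Bad-∷ x y U V B)
fstatus (nothing ∷ U) (nothing ∷ V) | none o = none o
fstatus (just a ∷ U) (nothing ∷ V) | none o = some (one o)
fstatus (nothing ∷ U) (just c ∷ V) | none o = none (o′ (sig U V) o)
  where
  o′ : ∀ st → proj₂ st ≡ 0 → proj₂ (closeC st) ≡ 0
  o′ (_ , .0) refl = refl
fstatus (just a ∷ U) (just c ∷ V) | none o =
  pending refl (o′ (sig U V) o) (danger nil refl refl (Closed⇒gap U V o))
  where
  o′ : ∀ st → proj₂ st ≡ 0 → proj₂ (openB (closeC st)) ≡ 1
  o′ (_ , .0) refl = refl
fstatus (nothing ∷ U) (nothing ∷ V) | pending refl o D = bad (Danger⇒Bad D)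
fstatus {m = suc m} (just a ∷ U) (nothing ∷ V) | pending refl o D =
  bad λ β p q q> R → Danger⇒Bad D β (p ++ (m , a) ∷ []) q q> (subst (RedW β) (sym (++-assoc p _ _)) R)
fstatus (nothing ∷ U) (just c ∷ V) | pending refl o D = none (o′ (sig U V) o)
  where
  o′ : ∀ st → proj₂ st ≡ 1 → proj₂ (closeC st) ≡ 0
  o′ (_ , .1) refl = refl
fstatus (just a ∷ U) (just c ∷ V) | pending refl o (danger ch refl′ e gap) =
  pending refl (o′ (sig U V) o) (danger (link ch) (cong (_ ∷_) refl′) (cong (_ ∷_) e) gap)
  where
  o′ : ∀ st → proj₂ st ≡ 1 → proj₂ (openB (closeC st)) ≡ 1
  o′ (_ , .1) refl = refl
fstatus (nothing ∷ U) (nothing ∷ V) | some P = some (skip P)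
fstatus (just a ∷ U) (nothing ∷ V) | some P = some (opens P)
fstatus (nothing ∷ U) (just c ∷ V) | some {suc j} P = some (close P)
fstatus (just a ∷ U) (just c ∷ V) | some {suc j} P = some (both P)
fstatus (nothing ∷ U) (just c ∷ V) | some {zero} P with Post-sig P
... | x , e , _ = none (cong (λ st → proj₂ (closeC st)) e)
fstatus (just a ∷ just b ∷ U) (just c ∷ nothing ∷ V) | some {zero} (one {d = d} o) = some (top {d = a} (start {e = c} o))
-- The letter removed so far is now paired with `c`, and `a` takes its place. The segment keeps its
-- lower end, but the label arriving there becomes that of `a`.
fstatus (just a ∷ U) (just c ∷ V) | some {zero} (top {d = d} P) with Mid-relabel P a _
... | _ , _ , P' = some (top (step {e' = c} P'))
fstatus (just a ∷ nothing ∷ U) (just c ∷ nothing ∷ V) | some {zero} (skip P) with Post-sig P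
... | x , e , _ = pending refl (cong (λ st → proj₂ (openB (closeC st))) e) (danger nil refl refl (All.map s≤s (dec-< U)))
fstatus (just a ∷ nothing ∷ U) (just c ∷ just c' ∷ V) | some {zero} (close P) with Post-sig P
... | x , e , _ = pending refl (cong (λ st → proj₂ (openB (closeC (closeC st)))) e) (danger nil refl refl (All.map s≤s (dec-< U)))

data EStatus {A : Set} {m : ℕ} (U' V' : Cells A m) : Set where
  none : proj₁ (sig U' V') ≡ 0 → EStatus U' V'
  mid  : ∀ {d b e U V} → Mid d b e U V U' V' → EStatus U' V'
  some : ∀ {j U V} → Post j U V U' V' → EStatus U' V'
  bad  : Bad m (dec U') (dec V') → EStatus U' V'

-- After f both words contain the segment, since `V'` has received `z`. A `Mid` that is not
-- continued by a letter of `V'` therefore contradicts reducedness.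
Mid⇒Danger : ∀ {d b e} {U V U' V' : Cells A (suc k)} → Mid d b e U V U' V' → Danger k (dec U') (dec V')
Mid⇒Danger {d = d} P = danger (Chain-swap chain) (trans u′≡ (cong (λ w → _ ∷ w ++ u0) (map-∘ M))) (trans v′≡ (cong (_++ (z , d) ∷ v0) (map-∘ M))) u0<
  where open MidLists (mid-lists P)

new-e : (U' V' : Cells A m) (c : A) → Closed U' V' → ∀ x → EStatus (x ∷ U') (just c ∷ V')
new-e U' V' c o nothing = some (one {d = c} o)
new-e U' V' c o (just a) = mid (start {b = c} {a} o)

estatus : (U' V' : Cells A m) → EStatus U' V'
estatus [] [] = none refl
estatus (x ∷ U') (y ∷ V') with estatus U' V'
estatus (x ∷ U') (y ∷ V') | bad B = bad (Bad-∷ x y U' V' B)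
estatus (nothing ∷ U') (nothing ∷ V') | none o = none o
estatus (just a ∷ U') (nothing ∷ V') | none o = none o
estatus (x ∷ U') (just c ∷ V') | none o = closing x (sig U' V') refl o
  where
  closing : ∀ x st → sig U' V' ≡ st → proj₁ st ≡ 0 → EStatus (x ∷ U') (just c ∷ V')
  closing x (_ , zero) e o = new-e U' V' c (cong proj₂ e) x
  closing nothing (_ , suc _) e refl = none (cong (λ st → proj₁ (closeC st)) e)
  closing (just a) (_ , suc _) e refl = none (cong (λ st → proj₁ (openB (closeC st))) e)
estatus (nothing ∷ U') (nothing ∷ V') | some P = some (skip P)
estatus (just a ∷ U') (nothing ∷ V') | some P = some (opens P)
estatus (nothing ∷ U') (just c ∷ V') | some {suc j} P = some (close P)
estatus (just a ∷ U') (just c ∷ V') | some {suc j} P = some (both P)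
estatus (x ∷ U') (just c ∷ V') | some {zero} P = new-e U' V' c (cong proj₂ (proj₂ (proj₂ (Post-sig P)))) x
estatus {m = suc (suc m)} (nothing ∷ U') (nothing ∷ V') | mid P = bad (Danger⇒Bad (Mid⇒Danger P))
estatus {m = suc (suc m)} (just a ∷ U') (nothing ∷ V') | mid P =
  bad λ β p q q> R → Danger⇒Bad (Mid⇒Danger P) β (p ++ (suc m , a) ∷ []) q q> (subst (RedW β) (sym (++-assoc p _ _)) R)
estatus (nothing ∷ U') (just c ∷ V') | mid P with Mid-relabelᵇ P c
... | _ , P' = some (top P')
estatus (just a ∷ U') (just c ∷ V') | mid P with Mid-relabelᵇ P c
... | _ , P' = mid (step {b' = c} {a} P')

f-total : ∀ β p q (U V : Cells A m) → RedW β (p ++ (dec U ++ dec V) ++ q) → Closed U V ⊎ (∃ λ j → ∃₂ λ U' V' → Post j U V U' V')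
f-total β p q U V R with fstatus U V
... | none o = inj₁ o
... | some P = inj₂ (_ , _ , _ , P)
... | pending refl o D = ⊥-elim (Danger⇒Bad D β [] [] [] (RedW-mid β p _ q R))
... | bad B = ⊥-elim (B β [] [] [] (RedW-mid β p _ q R))

e-total : ∀ β p q (U' V' : Cells A m) → RedW β (p ++ (dec U' ++ dec V') ++ q) →
          proj₁ (sig U' V') ≡ 0 ⊎ (∃ λ j → ∃₂ λ U V → Post j U V U' V')
e-total β p q U' V' R with estatus U' V'
... | none o = inj₁ o
... | some P = inj₂ (_ , _ , _ , P)
e-total {m = suc m} β p q U' V' R | mid P = ⊥-elim (Danger⇒Bad (Mid⇒Danger P) β [] [] [] (RedW-mid β p _ q R))
... | bad B = ⊥-elim (B β [] [] [] (RedW-mid β p _ q R))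

-- Agreement with the operators defined by pairing and gap search

ltℤ-true : ∀ {i j} → i ℤ.< j → ltℤ i j ≡ true
ltℤ-true {i} {j} l with i ℤ.<? j
... | yes _ = refl
... | no n = ⊥-elim (n l)

ltℤ-false : ∀ {i j} → ¬ i ℤ.< j → ltℤ i j ≡ false
ltℤ-false {i} {j} n with i ℤ.<? j
... | yes l = ⊥-elim (n l)
... | no _ = refl

leℤ-true : ∀ {i j} → i ℤ.≤ j → leℤ i j ≡ true
leℤ-true {i} {j} l with i ℤ.≤? j
... | yes _ = refl
... | no n = ⊥-elim (n l)

leℤ-false : ∀ {i j} → ¬ i ℤ.≤ j → leℤ i j ≡ false
leℤ-false {i} {j} n with i ℤ.≤? j
... | yes l = ⊥-elim (n l)
... | no _ = refl

==ℤ-refl : ∀ i → (i ==ℤ i) ≡ true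
==ℤ-refl i with i ℤ.≟ i
... | yes _ = refl
... | no n = ⊥-elim (n refl)

==ℤ-false : ∀ {i j} → i ≢ j → (i ==ℤ j) ≡ false
==ℤ-false {i} {j} n with i ℤ.≟ j
... | yes e = ⊥-elim (n e)
... | no _ = refl

val-< : ∀ β {j k} → j < k → val β j ℤ.< val β k
val-< β l = ℤP.+-monoʳ-< β (ℤ.+<+ l)

val-≤ : ∀ β {j k} → j ≤ k → val β j ℤ.≤ val β k
val-≤ β l = ℤP.+-monoʳ-≤ β (ℤ.+≤+ l)

val-+ : ∀ β j k → val β (j + k) ≡ val β j ℤ.+ (+ k)
val-+ β j k = sym (ℤP.+-assoc β (+ j) (+ k))

val-∸ : ∀ β j k → val β (j + k) ℤ.- (+ k) ≡ val β j
val-∸ β j k = trans (cong (ℤ._- (+ k)) (val-+ β j k))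
  (trans (ℤP.+-assoc (val β j) (+ k) (ℤ.- (+ k))) (trans (cong (λ i → val β j ℤ.+ i) (ℤP.+-inverseʳ (+ k))) (ℤP.+-identityʳ (val β j))))

key-mono : ∀ {i j} p q → i ℤ.< j → key (i , p) ℤ.< key (j , q)
key-mono {i} {j} p q l = ℤP.≤-<-trans (upper p) (ℤP.<-≤-trans 2i<2j-1 (lower q))
  where
  two = + 2
  upper : ∀ p → key (i , p) ℤ.≤ two ℤ.* i
  upper true = ℤP.i≤j⇒i-k≤j 1ℤ ℤP.≤-refl
  upper false = ℤP.≤-reflexive (ℤP.+-identityʳ (two ℤ.* i))
  lower : ∀ q → two ℤ.* j ℤ.- 1ℤ ℤ.≤ key (j , q)
  lower true = ℤP.≤-refl
  lower false = ℤP.+-monoʳ-≤ (two ℤ.* j) { ℤ.- 1ℤ} {0ℤ} ℤ.-≤+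
  2i<2j-1 : two ℤ.* i ℤ.< two ℤ.* j ℤ.- 1ℤ
  2i<2j-1 = ℤP.suc[i]≤j⇒i<j (subst (ℤ._≤ two ℤ.* j ℤ.- 1ℤ) eq
    (ℤP.+-monoˡ-≤ (ℤ.- 1ℤ) (ℤP.*-monoˡ-≤-nonNeg two (ℤP.i<j⇒suc[i]≤j l))))
    where
    eq : two ℤ.* (1ℤ ℤ.+ i) ℤ.- 1ℤ ≡ 1ℤ ℤ.+ two ℤ.* i
    eq = trans (cong (ℤ._- 1ℤ) (trans (ℤP.*-distribˡ-+ two 1ℤ i) (ℤP.+-comm two (two ℤ.* i))))
          (trans (ℤP.+-assoc (two ℤ.* i) two (ℤ.- 1ℤ)) (ℤP.+-comm (two ℤ.* i) 1ℤ))

eqL-refl : ∀ x → eqL x x ≡ true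
eqL-refl (i , false) rewrite ==ℤ-refl i = refl
eqL-refl (i , true) rewrite ==ℤ-refl i = refl

filterB-++ : {X : Set} (p : X → Bool) (xs ys : List X) → filterB p (xs ++ ys) ≡ filterB p xs ++ filterB p ys
filterB-++ p [] ys = refl
filterB-++ p (x ∷ xs) ys with p x
... | true = cong (x ∷_) (filterB-++ p xs ys)
... | false = filterB-++ p xs ys

filterB-all : {X : Set} (p : X → Bool) {xs : List X} → All (λ x → p x ≡ true) xs → filterB p xs ≡ xs
filterB-all p [] = refl
filterB-all p (e ∷ a) rewrite e = cong (_ ∷_) (filterB-all p a)

filterB-none : {X : Set} (p : X → Bool) {xs : List X} → All (λ x → p x ≡ false) xs → filterB p xs ≡ []
filterB-none p [] = refl
filterB-none p (e ∷ a) rewrite e = filterB-none p a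

filterB-mid : {X : Set} (p : X → Bool) (xs : List X) {ys zs : List X} → All (λ x → p x ≡ false) xs →
              All (λ x → p x ≡ true) ys → All (λ x → p x ≡ false) zs → filterB p (xs ++ ys ++ zs) ≡ ys
filterB-mid p xs {ys} {zs} a b c =
  trans (filterB-++ p xs (ys ++ zs)) (cong₂ _++_ (filterB-none p a)
    (trans (filterB-++ p ys zs) (trans (cong₂ _++_ (filterB-all p b) (filterB-none p c)) (++-identityʳ ys))))

Chain-length : ∀ {z y} {M : Pairs Bool} → Chain z y M → y ≡ z + length M
Chain-length {z} nil = sym (ℕP.+-identityʳ z)
Chain-length {z} (link ch) = trans (cong suc (Chain-length ch)) (sym (ℕP.+-suc z _))

Chain-fsts : ∀ {z y} {M : Pairs Bool} → Chain z y M → ∀ k → z ≤ k → k < y → k ∈ map proj₁ (fsts M)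
Chain-fsts nil k l l' = ⊥-elim (ℕP.<-irrefl refl (ℕP.<-≤-trans l' l))
Chain-fsts (link {k'} ch) k l l' with k ℕ.≟ k'
... | yes refl = here refl
... | no n = there (Chain-fsts ch k l (ℕP.≤∧≢⇒< (ℕ.s≤s⁻¹ l') n))

Chain-snds : ∀ {z y} {M : Pairs Bool} → Chain z y M → ∀ k → z < k → k ≤ y → k ∈ map proj₁ (snds M)
Chain-snds nil k l l' = ⊥-elim (ℕP.<-irrefl refl (ℕP.<-≤-trans l l'))
Chain-snds (link {k'} ch) k l l' with k ℕ.≟ suc k'
... | yes refl = here refl
... | no n = there (Chain-snds ch k l (ℕ.s≤s⁻¹ (ℕP.≤∧≢⇒< l' n)))

-- Flipping both primes when they differ means that each letter receives the prime of its partner,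
-- which is the form used by `swap₁` and `swap₂`.
flip-if : ∀ i p q → (if p xor q then flipL (i , p) else (i , p)) ≡ (i , q)
flip-if i false false = refl
flip-if i false true = refl
flip-if i true false = refl
flip-if i true true = refl

anyB-none : {X : Set} (g : X → Bool) {xs : List X} → All (λ x → g x ≡ false) xs → anyB g xs ≡ false
anyB-none g [] = refl
anyB-none g (e ∷ a) rewrite e = anyB-none g a

anyB-∈ : {X : Set} (g : X → Bool) {xs ys : List X} {x : X} → All (λ x → g x ≡ false) xs → All (λ x → g x ≡ false) ys →
         anyB g (xs ++ x ∷ ys) ≡ g x
anyB-∈ g {x = x} [] b rewrite anyB-none g b = ∨-identityʳ (g x)
anyB-∈ g (e ∷ a) b rewrite e = anyB-∈ g a b

module _ (β : ℤ) where

  E : Word Bool → List Letter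
  E = emb β

  e₁ : ℕ × Bool → Letter
  e₁ x = val β (proj₁ x) , proj₂ x

  e₂ : (ℕ × Bool) × (ℕ × Bool) → Letter × Letter
  e₂ p = e₁ (proj₁ p) , e₁ (proj₂ p)

  Decreasing : Word Bool → Set
  Decreasing = AllPairs (λ x y → proj₁ y < proj₁ x)

  largest-∈ : ∀ w → largest (E w) ≡ nothing ⊎ ∃ λ y → y ∈ w × largest (E w) ≡ just (e₁ y)
  largest-∈ [] = inj₁ refl
  largest-∈ (x ∷ w) with largest (E w) | largest-∈ w
  ... | .nothing | inj₁ refl = inj₂ (x , here refl , refl)
  ... | .(just (e₁ y)) | inj₂ (y , i , refl) with ltℤ (key (e₁ x)) (key (e₁ y))
  ...   | true = inj₂ (y , there i , refl)
  ...   | false = inj₂ (x , here refl , refl)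

  largest-head : ∀ x w → All (λ y → proj₁ y < proj₁ x) w → largest (E (x ∷ w)) ≡ just (e₁ x)
  largest-head x w a with largest (E w) | largest-∈ w
  ... | .nothing | inj₁ refl = refl
  ... | .(just (e₁ y)) | inj₂ (y , i , refl)
    rewrite ltℤ-false {key (e₁ x)} {key (e₁ y)} (ℤP.<-asym (key-mono (proj₂ y) (proj₂ x) (val-< β (All.lookup a i)))) = refl

  smallest-last : ∀ w x → All (λ y → proj₁ x < proj₁ y) w → smallest (E (w ++ x ∷ [])) ≡ just (e₁ x)
  smallest-last [] x a = refl
  smallest-last (y ∷ w) x (l ∷ a) rewrite smallest-last w x a
    | ltℤ-true {key (e₁ x)} {key (e₁ y)} (key-mono (proj₂ x) (proj₂ y) (val-< β l)) = refl

  eqL-false : ∀ x y → proj₁ x ≢ proj₁ y → eqL (e₁ x) (e₁ y) ≡ false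
  eqL-false x y n rewrite ==ℤ-false {val β (proj₁ x)} {val β (proj₁ y)} (n ∘ val-inj β) = refl

  removeL-mid : ∀ hi x lo → All (λ y → proj₁ x < proj₁ y) hi → removeL (e₁ x) (E (hi ++ x ∷ lo)) ≡ E (hi ++ lo)
  removeL-mid [] x lo [] rewrite eqL-refl (e₁ x) = refl
  removeL-mid (y ∷ hi) x lo (l ∷ a) rewrite eqL-false y x (λ e → ℕP.<⇒≢ l (sym e)) = cong (_ ∷_) (removeL-mid hi x lo a)

  insertDesc-mid : ∀ hi x lo → All (λ y → proj₁ x < proj₁ y) hi → All (λ y → proj₁ y < proj₁ x) lo →
                   insertDesc (e₁ x) (E (hi ++ lo)) ≡ E (hi ++ x ∷ lo)
  insertDesc-mid [] x [] a b = refl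
  insertDesc-mid [] x (y ∷ lo) a (l ∷ b) rewrite ltℤ-true {key (e₁ y)} {key (e₁ x)} (key-mono (proj₂ y) (proj₂ x) (val-< β l)) = refl
  insertDesc-mid (y ∷ hi) x lo (l ∷ a) b rewrite ltℤ-false {key (e₁ y)} {key (e₁ x)} (ℤP.<-asym (key-mono (proj₂ x) (proj₂ y) (val-< β l))) =
    cong (_ ∷_) (insertDesc-mid hi x lo a b)

  open-decreasing : (U V : Cells Bool m) → Decreasing (proj₁ (proj₂ (match U V)))
  open-decreasing [] [] = []
  open-decreasing (x ∷ U) (y ∷ V) = opening x (closing y)
    where
    decr : MatchState Bool → Set
    decr st = Decreasing (proj₁ (proj₂ st)) × Below _ (proj₁ (proj₂ st))
    closeM-decr : ∀ c st → decr st → decr (closeM c st)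
    closeM-decr c (ps , [] , un) d = d
    closeM-decr c (ps , b ∷ op , un) (_ ∷ d , _ ∷ a) = d , a
    closing : ∀ y → decr (Maybe.maybe′ (λ c → closeM (_ , c)) (λ st → st) y (match U V))
    closing nothing = open-decreasing U V , Bounded.open< (match-bounded U V)
    closing (just c) = closeM-decr _ (match U V) (open-decreasing U V , Bounded.open< (match-bounded U V))
    opening : ∀ x {st} → decr st → Decreasing (proj₁ (proj₂ (Maybe.maybe′ (λ b → openM (_ , b)) (λ st → st) x st)))
    opening nothing (d , a) = d
    opening (just b) (d , a) = a ∷ d

  embSt : Word Bool → MatchState Bool → PairState
  embSt hi (ps , op , un) = map e₂ ps , E (hi ++ op) , E un

  pairStep-just : ∀ {c ps av un b} → largest (filterB (λ b → ltℤ ⌈ b ⌉ ⌈ c ⌉) av) ≡ just b →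
                  pairStep c (ps , av , un) ≡ ((b , c) ∷ ps , removeL b av , un)
  pairStep-just e rewrite e = refl

  pairStep-nothing : ∀ {c ps av un} → largest (filterB (λ b → ltℤ ⌈ b ⌉ ⌈ c ⌉) av) ≡ nothing →
                     pairStep c (ps , av , un) ≡ (ps , av , c ∷ un)
  pairStep-nothing e rewrite e = refl

  below-filter : ∀ hi c op → From (proj₁ c) hi → Below (proj₁ c) op →
                 filterB (λ b → ltℤ ⌈ b ⌉ ⌈ e₁ c ⌉) (E (hi ++ op)) ≡ E op
  below-filter hi c op hi≥ op< = trans (cong (filterB _) (map-++ e₁ hi op))
    (trans (filterB-++ _ (E hi) (E op)) (cong₂ _++_
      (filterB-none _ {E hi} (AllP.map⁺ (All.map (λ l → ltℤ-false (λ l' → ℤP.<-irrefl refl (ℤP.<-≤-trans l' (val-≤ β l)))) hi≥)))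
      (filterB-all _ {E op} (AllP.map⁺ (All.map (λ l → ltℤ-true (val-< β l)) op<)))))

  pairStep-close : ∀ hi c st → From (proj₁ c) hi → Below (proj₁ c) (proj₁ (proj₂ st)) →
                   Decreasing (proj₁ (proj₂ st)) → pairStep (e₁ c) (embSt hi st) ≡ embSt hi (closeM c st)
  pairStep-close hi c (ps , [] , un) hi≥ op< d =
    pairStep-nothing (cong largest (below-filter hi c [] hi≥ op<))
  pairStep-close hi c (ps , b ∷ op , un) hi≥ (l ∷ op<) (d ∷ _) =
    trans (pairStep-just (trans (cong largest (below-filter hi c (b ∷ op) hi≥ (l ∷ op<))) (largest-head b op d)))
          (cong (λ w → _ , w , _) (removeL-mid hi b op (All.map (ℕP.<-≤-trans l) hi≥)))

  -- `pairing` has all of `U` available from the outset, whereas `match` opens its letters one at a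
  -- time. The difference is `hi`, the letters not yet reached; none is smaller than the current
  -- letter of `V`, so none is chosen.
  pairing-match : ∀ hi (U V : Cells Bool m) → From m hi →
                  foldr pairStep ([] , E (hi ++ dec U) , []) (E (dec V)) ≡ embSt hi (match U V)
  pairing-match hi [] [] a = refl
  pairing-match hi (nothing ∷ U) (nothing ∷ V) a = pairing-match hi U V (All.map (ℕP.≤-trans (ℕP.n≤1+n _)) a)
  pairing-match hi (nothing ∷ U) (just c ∷ V) a =
    trans (cong (pairStep _) (pairing-match hi U V a'))
          (pairStep-close hi _ (match U V) a' (Bounded.open< (match-bounded U V)) (open-decreasing U V))
    where a' = All.map (ℕP.≤-trans (ℕP.n≤1+n _)) a
  pairing-match {m = suc m} hi (just b ∷ U) (y ∷ V) a = go y
    where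
    hi' = hi ++ (m , b) ∷ []
    a' : From m hi'
    a' = AllP.++⁺ (All.map (ℕP.≤-trans (ℕP.n≤1+n _)) a) (ℕP.≤-refl ∷ [])
    regroup : ∀ w → hi' ++ w ≡ hi ++ (m , b) ∷ w
    regroup = ++-assoc hi ((m , b) ∷ [])
    embSt-open : ∀ st → embSt hi' st ≡ embSt hi (openM (m , b) st)
    embSt-open (ps , op , un) = cong (λ w → _ , E w , _) (regroup op)
    ih = trans (cong (λ w → foldr pairStep ([] , E w , []) (E (dec V))) (sym (regroup (dec U)))) (pairing-match hi' U V a')
    go : ∀ y → foldr pairStep ([] , E (hi ++ (m , b) ∷ dec U) , []) (E (dec (y ∷ V))) ≡ embSt hi (match (just b ∷ U) (y ∷ V))
    go nothing = trans ih (embSt-open (match U V))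
    go (just c) = trans (cong (pairStep (e₁ (m , c))) ih)
      (trans (pairStep-close hi' (m , c) (match U V) a' (Bounded.open< (match-bounded U V)) (open-decreasing U V))
             (embSt-open (closeM (m , c) (match U V))))

  memℤ-true : ∀ {k} w → k ∈ map proj₁ w → memℤ (val β k) (map ⌈_⌉ (E w)) ≡ true
  memℤ-true (x ∷ w) (here refl) rewrite ==ℤ-refl (val β (proj₁ x)) = refl
  memℤ-true {k} (x ∷ w) (there i) rewrite memℤ-true w i with val β (proj₁ x) ==ℤ val β k
  ... | true = refl
  ... | false = refl

  memℤ-false : ∀ {k} w → All (λ x → proj₁ x ≢ k) w → memℤ (val β k) (map ⌈_⌉ (E w)) ≡ false
  memℤ-false [] a = refl
  memℤ-false {k} (x ∷ w) (n ∷ a) rewrite ==ℤ-false {val β (proj₁ x)} {val β k} (n ∘ val-inj β) = memℤ-false w a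

  gapDown-val : ∀ w z n fuel → (∀ k → z < k → k ≤ z + n → k ∈ map proj₁ w) → All (λ x → proj₁ x ≢ z) w → n ≤ fuel →
                gapDown (val β (z + n)) (map ⌈_⌉ (E w)) (suc fuel) ≡ n
  gapDown-val w z zero fuel full gap l rewrite ℕP.+-identityʳ z | memℤ-false w gap = refl
  gapDown-val w z (suc n) (suc fuel) full gap (s≤s l)
    rewrite memℤ-true w (full (z + suc n) (ℕP.m<m+n z (s≤s z≤n)) ℕP.≤-refl) =
    cong suc (trans (cong (λ i → gapDown i (map ⌈_⌉ (E w)) (suc fuel)) (trans (cong (λ i → val β i ℤ.- 1ℤ) (trans (ℕP.+-suc z n) (ℕP.+-comm 1 (z + n)))) (val-∸ β (z + n) 1)))
      (gapDown-val w z n fuel (λ k l l' → full k l (ℕP.≤-trans l' (ℕP.+-monoʳ-≤ z (ℕP.n≤1+n n)))) gap l))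

  gapUp-val : ∀ w z n fuel → (∀ k → z ≤ k → k < z + n → k ∈ map proj₁ w) → All (λ x → proj₁ x ≢ z + n) w → n ≤ fuel →
              gapUp (val β z) (map ⌈_⌉ (E w)) (suc fuel) ≡ n
  gapUp-val w z zero fuel full gap l rewrite memℤ-false w (subst (λ i → All (λ x → proj₁ x ≢ i) w) (ℕP.+-identityʳ z) gap) = refl
  gapUp-val w z (suc n) (suc fuel) full gap (s≤s l)
    rewrite memℤ-true w (full z ℕP.≤-refl (ℕP.m<m+n z (s≤s z≤n))) =
    cong suc (trans (cong (λ i → gapUp i (map ⌈_⌉ (E w)) (suc fuel)) (sym (val-suc β z)))
      (gapUp-val w (suc z) n fuel (λ k l l' → full k (ℕP.<⇒≤ l) (subst (k <_) (sym (ℕP.+-suc z n)) l'))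
        (subst (λ i → All (λ x → proj₁ x ≢ i) w) (ℕP.+-suc z n) gap) l))

  swapFst-id : ∀ M x → All (λ p → proj₁ (proj₁ p) ≢ proj₁ x) M → swapFst (map e₂ M) (e₁ x) ≡ e₁ x
  swapFst-id M x a rewrite anyB-none (λ bc → eqL (proj₁ bc) (e₁ x) ∧ (primed (proj₁ bc) xor primed (proj₂ bc))) {map e₂ M}
    (AllP.map⁺ (All.map (λ {p} n → cong (_∧ _) (eqL-false (proj₁ p) x n)) a)) = refl

  swapSnd-id : ∀ M x → All (λ p → proj₁ (proj₂ p) ≢ proj₁ x) M → swapSnd (map e₂ M) (e₁ x) ≡ e₁ x
  swapSnd-id M x a rewrite anyB-none (λ bc → eqL (proj₂ bc) (e₁ x) ∧ (primed (proj₁ bc) xor primed (proj₂ bc))) {map e₂ M}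
    (AllP.map⁺ (All.map (λ {p} n → cong (_∧ _) (eqL-false (proj₂ p) x n)) a)) = refl

  swapFst-mid : ∀ M p M' → All (λ p' → proj₁ (proj₁ p') ≢ proj₁ (proj₁ p)) M → All (λ p' → proj₁ (proj₁ p') ≢ proj₁ (proj₁ p)) M' →
                swapFst (map e₂ (M ++ p ∷ M')) (e₁ (proj₁ p)) ≡ e₁ (swap₁ p)
  swapFst-mid M p M' a b
    rewrite map-++ e₂ M (p ∷ M')
    | anyB-∈ (λ bc → eqL (proj₁ bc) (e₁ (proj₁ p)) ∧ (primed (proj₁ bc) xor primed (proj₂ bc))) {map e₂ M} {map e₂ M'} {e₂ p}
      (AllP.map⁺ (All.map (λ {p'} n → cong (_∧ _) (eqL-false (proj₁ p') (proj₁ p) n)) a))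
      (AllP.map⁺ (All.map (λ {p'} n → cong (_∧ _) (eqL-false (proj₁ p') (proj₁ p) n)) b))
    | eqL-refl (e₁ (proj₁ p)) = flip-if _ _ _

  swapSnd-mid : ∀ M p M' → All (λ p' → proj₁ (proj₂ p') ≢ proj₁ (proj₂ p)) M → All (λ p' → proj₁ (proj₂ p') ≢ proj₁ (proj₂ p)) M' →
                swapSnd (map e₂ (M ++ p ∷ M')) (e₁ (proj₂ p)) ≡ e₁ (swap₂ p)
  swapSnd-mid M p M' a b
    rewrite map-++ e₂ M (p ∷ M')
    | anyB-∈ (λ bc → eqL (proj₂ bc) (e₁ (proj₂ p)) ∧ (primed (proj₁ bc) xor primed (proj₂ bc))) {map e₂ M} {map e₂ M'} {e₂ p}
      (AllP.map⁺ (All.map (λ {p'} n → cong (_∧ _) (eqL-false (proj₂ p') (proj₂ p) n)) a))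
      (AllP.map⁺ (All.map (λ {p'} n → cong (_∧ _) (eqL-false (proj₂ p') (proj₂ p) n)) b))
    | eqL-refl (e₁ (proj₂ p)) = trans (cong (λ t → if t then flipL (e₁ (proj₂ p)) else e₁ (proj₂ p)) (xor-comm (proj₂ (proj₁ p)) (proj₂ (proj₂ p)))) (flip-if _ (proj₂ (proj₂ p)) _)

  swapFst-chain : ∀ {z y} {M : Pairs Bool} M₀ → Chain z y M → All (λ p → y ≤ proj₁ (proj₁ p)) M₀ →
                  map (swapFst (map e₂ (M₀ ++ M))) (E (fsts M)) ≡ E (map swap₁ M)
  swapFst-chain M₀ nil a = refl
  swapFst-chain {M = p ∷ M} M₀ (link ch) a = cong₂ _∷_
    (swapFst-mid M₀ p M (All.map (λ l e → ℕP.<⇒≢ l (sym e)) a) (All.map (λ ((_ , l) , _) → ℕP.<⇒≢ l) (Chain-bounds ch)))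
    (subst (λ S → map (swapFst (map e₂ S)) (E (fsts M)) ≡ E (map swap₁ M)) (++-assoc M₀ (p ∷ []) M)
      (swapFst-chain (M₀ ++ p ∷ []) ch (AllP.++⁺ (All.map ℕP.<⇒≤ a) (ℕP.≤-refl ∷ []))))

  swapSnd-chain : ∀ {z y} {M : Pairs Bool} M₀ → Chain z y M → All (λ p → y < proj₁ (proj₂ p)) M₀ →
                  map (swapSnd (map e₂ (M₀ ++ M))) (E (snds M)) ≡ E (map swap₂ M)
  swapSnd-chain M₀ nil a = refl
  swapSnd-chain {M = p ∷ M} M₀ (link ch) a = cong₂ _∷_
    (swapSnd-mid M₀ p M (All.map (λ l e → ℕP.<⇒≢ l (sym e)) a) (All.map (λ (_ , _ , l) → ℕP.<⇒≢ (s≤s l)) (Chain-bounds ch)))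
    (subst (λ S → map (swapSnd (map e₂ S)) (E (snds M)) ≡ E (map swap₂ M)) (++-assoc M₀ (p ∷ []) M)
      (swapSnd-chain (M₀ ++ p ∷ []) ch (AllP.++⁺ (All.map (ℕP.<-trans ℕP.≤-refl) a) (ℕP.≤-refl ∷ []))))

  map-id-on : {f : Letter → Letter} (w : Word Bool) → All (λ x → f (e₁ x) ≡ e₁ x) w → map f (E w) ≡ E w
  map-id-on [] [] = refl
  map-id-on (x ∷ w) (e ∷ a) = cong₂ _∷_ e (map-id-on w a)

  map-E-++₃ : {f : Letter → Letter} (a b b' c : Word Bool) → map f (E a) ≡ E a → map f (E b) ≡ E b' → map f (E c) ≡ E c →
              map f (E (a ++ b ++ c)) ≡ E (a ++ b' ++ c)
  map-E-++₃ {f} a b b' c p q r = begin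
    map f (E (a ++ b ++ c))                 ≡⟨ cong (map f) (trans (map-++ e₁ a (b ++ c)) (cong (E a ++_) (map-++ e₁ b c))) ⟩
    map f (E a ++ E b ++ E c)               ≡⟨ trans (map-++ f (E a) (E b ++ E c)) (cong (map f (E a) ++_) (map-++ f (E b) (E c))) ⟩
    map f (E a) ++ map f (E b) ++ map f (E c) ≡⟨ cong₂ _++_ p (cong₂ _++_ q r) ⟩
    E a ++ E b' ++ E c                      ≡⟨ sym (trans (map-++ e₁ a (b' ++ c)) (cong (E a ++_) (map-++ e₁ b' c))) ⟩
    E (a ++ b' ++ c) ∎
    where open ≡-Reasoning

  swapFst-word : ∀ {z y} {M : Pairs Bool} uP u0 → Chain z y M → Above y uP → Below z u0 →
                 map (swapFst (map e₂ M)) (E (uP ++ fsts M ++ u0)) ≡ E (uP ++ map swap₁ M ++ u0)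
  swapFst-word {M = M} uP u0 ch a b = map-E-++₃ uP (fsts M) (map swap₁ M) u0
    (map-id-on uP (All.map (λ {x} l → swapFst-id M x (All.map (λ ((_ , l') , _) → ℕP.<⇒≢ (ℕP.<-trans l' l)) bs)) a))
    (swapFst-chain [] ch [])
    (map-id-on u0 (All.map (λ {x} l → swapFst-id M x (All.map (λ ((l' , _) , _) e → ℕP.<⇒≢ (ℕP.<-≤-trans l l') (sym e)) bs)) b))
    where bs = Chain-bounds ch

  swapSnd-word : ∀ {z y} {M : Pairs Bool} vP v0 → Chain z y M → Above y vP → Below z v0 →
                 map (swapSnd (map e₂ M)) (E (vP ++ snds M ++ v0)) ≡ E (vP ++ map swap₂ M ++ v0)
  swapSnd-word {M = M} vP v0 ch a b = map-E-++₃ vP (snds M) (map swap₂ M) v0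
    (map-id-on vP (All.map (λ {x} l → swapSnd-id M x (All.map (λ (_ , _ , l') → ℕP.<⇒≢ (ℕP.≤-<-trans l' l)) bs)) a))
    (swapSnd-chain [] ch [])
    (map-id-on v0 (All.map (λ {x} l → swapSnd-id M x (All.map (λ (_ , l' , _) e → ℕP.<⇒≢ (ℕP.<-trans l l') (sym e)) bs)) b))
    where bs = Chain-bounds ch

fSelect eSelect : ℤ → ℕ → Letter × Letter → Bool
fSelect m q bc = ltℤ ⌈ proj₁ bc ⌉ m ∧ leℤ (m ℤ.- (+ q)) ⌈ proj₁ bc ⌉
eSelect m q bc = leℤ ⌈ proj₂ bc ⌉ (m ℤ.+ (+ q)) ∧ ltℤ m ⌈ proj₂ bc ⌉

fPair-just : ∀ u v {ps unU unV y q sel} → pairing u v ≡ (ps , unU , unV) → smallest unU ≡ just y →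
             gapDown ⌈ y ⌉ (map ⌈_⌉ v) (suc (length v)) ≡ q → filterB (fSelect ⌈ y ⌉ q) ps ≡ sel →
             fPair u v ≡ just (map (swapFst sel) (removeL y u) , insertDesc (shift y (ℤ.- (+ q))) (map (swapSnd sel) v))
fPair-just u v e e' refl refl rewrite e | e' = refl

fPair-nothing : ∀ u v {ps unV} → pairing u v ≡ (ps , [] , unV) → fPair u v ≡ nothing
fPair-nothing u v e rewrite e = refl

ePair-just : ∀ u v {ps unU unV x q sel} → pairing u v ≡ (ps , unU , unV) → largest unV ≡ just x →
             gapUp ⌈ x ⌉ (map ⌈_⌉ u) (suc (length u)) ≡ q → filterB (eSelect ⌈ x ⌉ q) ps ≡ sel →
             ePair u v ≡ just (insertDesc (shift x (+ q)) (map (swapFst sel) u) , map (swapSnd sel) (removeL x v))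
ePair-just u v e e' refl refl rewrite e | e' = refl

ePair-nothing : ∀ u v {ps unU} → pairing u v ≡ (ps , unU , []) → ePair u v ≡ nothing
ePair-nothing u v e rewrite e = refl

∧-falseˡ : ∀ {a} b → a ≡ false → a ∧ b ≡ false
∧-falseˡ b refl = refl

∧-false : ∀ a {b} → b ≡ false → a ∧ b ≡ false
∧-false true e = e
∧-false false e = refl

length-middle : {X : Set} (a b c : List X) → length b ≤ length (a ++ b ++ c)
length-middle a b c rewrite length-++ a {b ++ c} | length-++ b {c} = ℕP.m≤n⇒m≤o+n (length a) (ℕP.m≤m+n (length b) (length c))

module _ (β : ℤ) where

  fSelect-chain : ∀ {z y n} {M : Pairs Bool} pP p0 → y ≡ z + n → Chain z y M → All (λ p → y < proj₁ (proj₁ p)) pP →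
                  All (λ p → proj₁ (proj₁ p) < z) p0 → filterB (fSelect (val β y) n) (map (e₂ β) (pP ++ M ++ p0)) ≡ map (e₂ β) M
  fSelect-chain {z} {n = n} {M} pP p0 refl ch a b = trans
    (cong (filterB _) (trans (map-++ (e₂ β) pP (M ++ p0)) (cong (map (e₂ β) pP ++_) (map-++ (e₂ β) M p0))))
    (filterB-mid _ (map (e₂ β) pP)
      (AllP.map⁺ (All.map (λ l → ∧-falseˡ _ (ltℤ-false (ℤP.<-asym (val-< β l)))) a))
      (AllP.map⁺ (All.map (λ ((l , l') , _) → cong₂ _∧_ (ltℤ-true (val-< β l'))
        (leℤ-true (subst (ℤ._≤ _) (sym (val-∸ β z n)) (val-≤ β l)))) (Chain-bounds ch)))
      (AllP.map⁺ (All.map (λ l → ∧-false _ (leℤ-false (λ l' → ℤP.<-irrefl refl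
        (ℤP.<-≤-trans (val-< β l) (subst (ℤ._≤ _) (val-∸ β z n) l'))))) b)))

  eSelect-chain : ∀ {z y n} {M : Pairs Bool} pP p0 → y ≡ z + n → Chain z y M → All (λ p → y < proj₁ (proj₂ p)) pP →
                  All (λ p → proj₁ (proj₂ p) < z) p0 → filterB (eSelect (val β z) n) (map (e₂ β) (pP ++ M ++ p0)) ≡ map (e₂ β) M
  eSelect-chain {z} {n = n} {M} pP p0 refl ch a b = trans
    (cong (filterB _) (trans (map-++ (e₂ β) pP (M ++ p0)) (cong (map (e₂ β) pP ++_) (map-++ (e₂ β) M p0))))
    (filterB-mid _ (map (e₂ β) pP)
      (AllP.map⁺ (All.map (λ l → ∧-falseˡ _ (leℤ-false (λ l' → ℤP.<-irrefl refl
        (ℤP.<-≤-trans (val-< β l) (subst (_ ℤ.≤_) (sym (val-+ β z n)) l'))))) a))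
      (AllP.map⁺ (All.map (λ (_ , l , l') → cong₂ _∧_
        (leℤ-true (subst (_ ℤ.≤_) (val-+ β z n) (val-≤ β l'))) (ltℤ-true (val-< β l))) (Chain-bounds ch)))
      (AllP.map⁺ (All.map (λ l → ∧-false _ (ltℤ-false (ℤP.<-asym (val-< β l)))) b)))

  fPair-closed : (U V : Cells Bool m) → Closed U V → fPair (E β (dec U)) (E β (dec V)) ≡ nothing
  fPair-closed U V o with Closed⇒match U V o
  ... | ps , un , e = fPair-nothing _ _ (trans (pairing-match β [] U V []) (cong (embSt β []) e))

  ePair-closed : (U V : Cells Bool m) → proj₁ (sig U V) ≡ 0 → ePair (E β (dec U)) (E β (dec V)) ≡ nothing
  ePair-closed U V o with match U V | sig-match U V | pairing-match β [] U V []
  ... | ps , op , [] | _ | e = ePair-nothing _ _ e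
  ... | ps , op , x ∷ un | e' | _ with trans (cong proj₁ e') o
  ...   | ()

  module _ {j} {U V U' V' : Cells Bool m} (P : Post j U V U' V') where
    open PostLists (post-lists P)
    private
      q = length M
      M' = map swapPair M
      ch' = Chain-swap chain
      bs = Chain-bounds chain
      y≡z+q : y ≡ z + q
      y≡z+q = Chain-length chain
      y≡z+q′ : y ≡ z + length M'
      y≡z+q′ = trans y≡z+q (cong (λ i → z + i) (sym (length-map swapPair M)))
      z≤y = Chain-≤ chain
      u0<z : Below z u0
      u0<z = All.map (ℕP.<-trans ℕP.≤-refl) u0<
      vP>y : Above y vP
      vP>y = All.map (ℕP.<-trans ℕP.≤-refl) vP>
      swap₁² : map swap₁ M' ≡ fsts M
      swap₁² = sym (map-∘ M)
      swap₂² : map swap₂ M' ≡ snds M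
      swap₂² = sym (map-∘ M)
      fsts′ : fsts M' ≡ map swap₁ M
      fsts′ = sym (map-∘ M)
      snds′ : snds M' ≡ map swap₂ M
      snds′ = sym (map-∘ M)

    -- The smallest unpaired letter is `y`, as `oP` lies above it. Since `V` contains `z + 1, …, y`
    -- but not `z`, the gap search gives `q = length M`, and the selected pairs are exactly `M`.
    fPair-post : fPair (E β (dec U)) (E β (dec V)) ≡ just (E β (dec U') , E β (dec V'))
    fPair-post = trans
      (fPair-just _ _ (trans (pairing-match β [] U V []) (cong (embSt β []) st≡)) (smallest-last β oP (y , d) oP>) gap
        (fSelect-chain pP p0 y≡z+q chain (All.map proj₁ pP>) (All.map proj₁ (Bounded.pairs< p0<))))
      (cong₂ (λ a b → just (a , b)) left right)
      where
      v = vP ++ snds M ++ v0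
      gap′ : gapDown (val β (z + q)) (map ⌈_⌉ (E β v)) (suc (length v)) ≡ q
      gap′ = gapDown-val β v z q (length v)
        (λ k l l' → subst (k ∈_) (sym (map-++ proj₁ vP _)) (∈P.∈-++⁺ʳ (map proj₁ vP) (subst (k ∈_) (sym (map-++ proj₁ (snds M) v0))
          (∈P.∈-++⁺ˡ (Chain-snds chain k l (subst (k ≤_) (sym y≡z+q) l'))))))
        (AllP.++⁺ (All.map (λ l e → ℕP.<⇒≢ (ℕP.≤-<-trans z≤y l) (sym e)) vP>y)
          (AllP.++⁺ (AllP.map⁺ (All.map (λ (_ , l , _) e → ℕP.<⇒≢ l (sym e)) bs)) (All.map ℕP.<⇒≢ v0<)))
        (subst (_≤ length v) (length-map proj₂ M) (length-middle vP (snds M) v0))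
      gap : gapDown (val β y) (map ⌈_⌉ (E β (dec V))) (suc (length (E β (dec V)))) ≡ q
      gap rewrite v≡ | length-map (λ x → val β (proj₁ x) , proj₂ x) v = subst (λ i → gapDown (val β i) (map ⌈_⌉ (E β v)) (suc (length v)) ≡ q) (sym y≡z+q) gap′
      left : map (swapFst (map (e₂ β) M)) (removeL (e₁ β (y , d)) (E β (dec U))) ≡ E β (dec U')
      left rewrite u≡ | u′≡ | removeL-mid β uP (y , d) (fsts M ++ u0) uP> = swapFst-word β uP u0 chain uP> u0<z
      right : insertDesc (shift (e₁ β (y , d)) (ℤ.- (+ q))) (map (swapSnd (map (e₂ β) M)) (E β (dec V))) ≡ E β (dec V')
      right rewrite v≡ | v′≡ = trans
        (cong₂ (λ i w → insertDesc (i , d) w) (trans (cong (λ i → val β i ℤ.- (+ q)) y≡z+q) (val-∸ β z q))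
          (trans (swapSnd-word β vP v0 chain vP>y v0<) (cong (E β) (sym (++-assoc vP (map swap₂ M) v0)))))
        (trans (insertDesc-mid β (vP ++ map swap₂ M) (z , d) v0
          (AllP.++⁺ (All.map (ℕP.≤-<-trans z≤y) vP>y) (AllP.map⁺ (All.map (λ (_ , l , _) → l) bs))) v0<)
          (cong (E β) (++-assoc vP (map swap₂ M) _)))

    -- Dually, `z` is the largest unpaired letter of `V'`, and `U'` contains `z, …, y - 1` but not
    -- `y`. Swapping the primes a second time restores them.
    ePair-post : ePair (E β (dec U')) (E β (dec V')) ≡ just (E β (dec U) , E β (dec V))
    ePair-post = trans
      (ePair-just _ _ (trans (pairing-match β [] U' V' []) (cong (embSt β []) st′≡)) (largest-head β (z , d) n0 (Bounded.unpaired< p0<)) gap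
        (eSelect-chain pP p0 y≡z+q′ ch' (All.map proj₂ pP>) (All.map proj₂ (Bounded.pairs< p0<))))
      (cong₂ (λ a b → just (a , b)) left right)
      where
      u = uP ++ fsts M' ++ u0
      u′≡u : dec U' ≡ u
      u′≡u = trans u′≡ (cong (λ w → uP ++ w ++ u0) (sym fsts′))
      gap : gapUp (val β z) (map ⌈_⌉ (E β (dec U'))) (suc (length (E β (dec U')))) ≡ length M'
      gap rewrite u′≡u | length-map (λ x → val β (proj₁ x) , proj₂ x) u = gapUp-val β u z (length M') (length u)
        (λ k l l' → subst (k ∈_) (sym (map-++ proj₁ uP _)) (∈P.∈-++⁺ʳ (map proj₁ uP) (subst (k ∈_) (sym (map-++ proj₁ (fsts M') u0))
          (∈P.∈-++⁺ˡ (Chain-fsts ch' k l (subst (k <_) (sym y≡z+q′) l'))))))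
        (subst (λ i → All (λ x → proj₁ x ≢ i) u) y≡z+q′
          (AllP.++⁺ (All.map (λ l e → ℕP.<⇒≢ l (sym e)) uP>)
            (AllP.++⁺ (AllP.map⁺ (All.map (λ ((_ , l) , _) → ℕP.<⇒≢ l) (Chain-bounds ch'))) (All.map (λ l → ℕP.<⇒≢ (ℕP.<-≤-trans l z≤y)) u0<z))))
        (subst (_≤ length u) (length-map proj₁ M') (length-middle uP (fsts M') u0))
      left : insertDesc (shift (e₁ β (z , d)) (+ length M')) (map (swapFst (map (e₂ β) M')) (E β (dec U'))) ≡ E β (dec U)
      left rewrite u′≡u | u≡ = trans
        (cong₂ (λ i w → insertDesc (i , d) w) (trans (sym (val-+ β z (length M'))) (cong (val β) (sym y≡z+q′)))
          (trans (swapFst-word β uP u0 ch' uP> u0<z) (cong (λ w → E β (uP ++ w ++ u0)) swap₁²)))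
        (insertDesc-mid β uP (y , d) (fsts M ++ u0) uP>
          (AllP.++⁺ (AllP.map⁺ (All.map (λ ((_ , l) , _) → l) bs)) (All.map (λ l → ℕP.<-≤-trans l z≤y) u0<z)))
      right : map (swapSnd (map (e₂ β) M')) (removeL (e₁ β (z , d)) (E β (dec V'))) ≡ E β (dec V)
      right rewrite v≡ = trans
        (cong (map (swapSnd (map (e₂ β) M'))) (trans
          (cong (λ w → removeL (e₁ β (z , d)) (E β w)) (trans v′≡ (trans (cong (λ w → vP ++ w ++ (z , d) ∷ v0) (sym snds′)) (sym (++-assoc vP (snds M') _)))))
          (trans (removeL-mid β (vP ++ snds M') (z , d) v0
            (AllP.++⁺ (All.map (ℕP.≤-<-trans z≤y) vP>y) (AllP.map⁺ (All.map (λ (_ , l , _) → l) (Chain-bounds ch')))))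
            (cong (E β) (++-assoc vP (snds M') v0)))))
        (trans (swapSnd-word β vP v0 ch' vP>y v0<) (cong (λ w → E β (vP ++ w ++ v0)) swap₂²))

-- Row insertion of a whole factor in one pass

-- Edelman–Greene insertion of a strictly decreasing word U into an increasing row R, performed for all
-- letters of U at once by reading the window upwards.  Each value occurring in R or U is an event; its
-- output is determined by the previous event: a value is passed on to the next row when the previous
-- event involved U and it stays in the row when the previous event involved R.

pattern ○ = nothing
pattern ● = just tt

-- `bth` encodes the exceptional rule: inserting `k` into a row with `k` and `k + 1` leaves the row
-- unchanged and bumps `k + 1`. After a value in both words, the next value is therefore emitted
-- both to the row and to the factor.
data St : Set where
  row fac bth : St

inRow inFac : St → Maybe ⊤
inRow row = ●
inRow fac = ○
inRow bth = ●
inFac row = ○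
inFac fac = ●
inFac bth = ●

nextSt : Maybe ⊤ → Maybe ⊤ → St → St
nextSt ○ ○ s = s
nextSt ● ○ s = row
nextSt ○ ● s = fac
nextSt ● ● s = bth

emitU emitR : Maybe ⊤ → Maybe ⊤ → St → Maybe ⊤
emitU ○ ○ s = ○
emitU ● _ s = inFac s
emitU ○ ● s = inFac s
emitR ○ ○ s = ○
emitR ● _ s = inRow s
emitR ○ ● s = inRow s

-- Starting from `row` makes the smallest value of all stay in the row. Ending in `fac` means that
-- the row has been lengthened.
state : Cells ⊤ m → Cells ⊤ m → St
state [] [] = row
state (x ∷ R) (y ∷ U) = nextSt x y (state R U)

outU outR : Cells ⊤ m → Cells ⊤ m → Cells ⊤ m
outU [] [] = []
outU (x ∷ R) (y ∷ U) = emitU x y (state R U) ∷ outU R U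
outR [] [] = []
outR (x ∷ R) (y ∷ U) = emitR x y (state R U) ∷ outR R U

-- If both R and U contain k then one of them contains k + 1.
OkCell : Maybe ⊤ → Maybe ⊤ → St → Set
OkCell ○ ○ bth = ⊥
OkCell _ _ _ = ⊤

Ok : Cells ⊤ m → Cells ⊤ m → Set
Ok [] [] = ⊤
Ok (x ∷ R) (y ∷ U) = OkCell x y (state R U) × Ok R U

inc : Cells A m → Word A
inc [] = []
inc (nothing ∷ R) = inc R
inc {m = suc m} (just a ∷ R) = inc R ++ (m , a) ∷ []

inc-< : (R : Cells A m) → Below m (inc R)
inc-< [] = []
inc-< (nothing ∷ R) = All.map ℕP.m≤n⇒m≤1+n (inc-< R)
inc-< (just a ∷ R) = AllP.++⁺ (All.map ℕP.m≤n⇒m≤1+n (inc-< R)) (ℕP.≤-refl ∷ [])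

-- `hi` holds the letters above the window, which stand between the two words. If the top value of
-- the window lies in both words and its successor in neither, then that value commutes with `hi`
-- and a square arises.
Red⇒Ok : ∀ β hi (R U : Cells ⊤ m) → From m hi → RedW β (inc R ++ hi ++ dec U) →
         Ok R U × (Above m hi → state R U ≢ bth)
Red⇒Ok β hi [] [] a red = tt , λ _ ()
Red⇒Ok β hi (○ ∷ R) (○ ∷ U) a red with Red⇒Ok β hi R U (All.map ℕP.<⇒≤ a) red
... | ok , n = (okCell (state R U) (n a) , ok) , λ _ → n a
  where
  okCell : ∀ s → s ≢ bth → OkCell ○ ○ s
  okCell row n = tt
  okCell fac n = tt
  okCell bth n = n refl
Red⇒Ok {m = suc m} β hi (● ∷ R) (○ ∷ U) a red with
  Red⇒Ok β ((m , tt) ∷ hi) R U (ℕP.≤-refl ∷ All.map ℕP.<⇒≤ a) (subst (RedW β) (++-assoc (inc R) _ _) red)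
... | ok , n = (tt , ok) , λ _ ()
Red⇒Ok {m = suc m} β hi (○ ∷ R) (● ∷ U) a red with
  Red⇒Ok β (hi ++ (m , tt) ∷ []) R U (AllP.++⁺ (All.map ℕP.<⇒≤ a) (ℕP.≤-refl ∷ []))
    (subst (λ w → RedW β (inc R ++ w)) (sym (++-assoc hi _ _)) red)
... | ok , n = (tt , ok) , λ _ ()
Red⇒Ok {m = suc m} β hi (● ∷ R) (● ∷ U) a red with
  Red⇒Ok β ((m , tt) ∷ hi ++ (m , tt) ∷ []) R U (ℕP.≤-refl ∷ AllP.++⁺ (All.map ℕP.<⇒≤ a) (ℕP.≤-refl ∷ []))
    (subst (RedW β) (trans (++-assoc (inc R) _ _) (cong (λ w → inc R ++ (m , tt) ∷ w) (sym (++-assoc hi _ _)))) red)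
... | ok , n = (tt , ok) , λ hi> _ → ¬RedW-square β (inc R ++ hi) (dec U)
  (RedW-∼ β (trans∼ (∼-reflexive (++-assoc (inc R) _ _)) (trans∼
     (++ˡ∼ (inc R) (comm-all (suc (suc m)) ((m , tt) ∷ []) hi ((m , tt) ∷ dec U) (ℕP.≤-refl ∷ []) hi>))
     (∼-reflexive (sym (++-assoc (inc R) hi _))))) red)

Gap-suc : ∀ {w : Word A} → Gap m w → Gap (suc m) w
Gap-suc = All.map ℕP.m≤n⇒m≤1+n

-- In state bth the words are not comparable until the next value, which must occur, has been read.
Inserted : (m : ℕ) → St → (r u u' r' : Word ⊤) → Set
Inserted m row r u u' r' = Gap m u × (r ++ u ∼ u' ++ r')
Inserted m fac r u u' r' = Gap m r × (r ++ u ∼ u' ++ r')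
Inserted m bth r u u' r' = r ++ (m , tt) ∷ u ∼ (m , tt) ∷ u' ++ r' ++ (m , tt) ∷ []

-- In state `row` the factor stays below `m - 1`, so a new `m` commutes through it to the end of the
-- row. In state `fac` the row stays below `m - 1`, and `m` moves to the front. For `bth` the
-- invariant is the claim itself.
inserted-next : ∀ s (R U U' R' : Cells ⊤ m) → Inserted m s (inc R) (dec U) (dec U') (inc R') →
                inc R ++ (m , tt) ∷ dec U ∼ dec (inFac s ∷ U') ++ inc (inRow s ∷ R')
inserted-next {m = m} row R U U' R' (g , e) = begin
  inc R ++ (m , tt) ∷ dec U
    ≡⟨ cong (λ w → inc R ++ (m , tt) ∷ w) (sym (++-identityʳ (dec U))) ⟩
  inc R ++ ((m , tt) ∷ []) ++ dec U ++ []
    ≈⟨ ++ˡ∼ (inc R) (sym∼ (comm-all m (dec U) ((m , tt) ∷ []) [] g (ℕP.≤-refl ∷ []))) ⟩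
  inc R ++ dec U ++ (m , tt) ∷ []
    ≡⟨ sym (++-assoc (inc R) _ _) ⟩
  (inc R ++ dec U) ++ (m , tt) ∷ []
    ≈⟨ ++ʳ∼ _ e ⟩
  (dec U' ++ inc R') ++ (m , tt) ∷ []
    ≡⟨ ++-assoc (dec U') _ _ ⟩
  dec U' ++ inc R' ++ (m , tt) ∷ [] ∎
  where open ∼-Reasoning
inserted-next {m = m} fac R U U' R' (g , e) =
  trans∼ (comm-all m (inc R) ((m , tt) ∷ []) (dec U) g (ℕP.≤-refl ∷ [])) (cons∼ _ e)
inserted-next bth R U U' R' e = e

inserted : (R U : Cells ⊤ m) → Ok R U → Inserted m (state R U) (inc R) (dec U) (dec (outU R U)) (inc (outR R U))
inserted [] [] ok = [] , refl∼
inserted (○ ∷ R) (○ ∷ U) (ok , oks) = idle (state R U) ok (inserted R U oks)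
  where
  idle : ∀ s → OkCell ○ ○ s → ∀ {r u u' r'} → Inserted _ s r u u' r' → Inserted _ s r u u' r'
  idle row ok (g , e) = Gap-suc g , e
  idle fac ok (g , e) = Gap-suc g , e
inserted {m = suc m} (● ∷ R) (○ ∷ U) (ok , oks) =
  All.map s≤s (dec-< U) , trans∼ (∼-reflexive (++-assoc (inc R) _ _)) (inserted-next (state R U) R U _ _ (inserted R U oks))
inserted {m = suc m} (○ ∷ R) (● ∷ U) (ok , oks) =
  All.map s≤s (inc-< R) , inserted-next (state R U) R U _ _ (inserted R U oks)
-- The invariant of `bth` puts an `m + 1` between the two letters `m`. The braid move doubles it,
-- and the two copies travel to the two ends.
inserted {m = suc m} (● ∷ R) (● ∷ U) (ok , oks) = begin
  (inc R ++ (m , tt) ∷ []) ++ (suc m , tt) ∷ (m , tt) ∷ dec U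
    ≡⟨ ++-assoc (inc R) _ _ ⟩
  inc R ++ (m , tt) ∷ (suc m , tt) ∷ (m , tt) ∷ dec U
    ≈⟨ ++ˡ∼ (inc R) (braid∼ (dec U)) ⟩
  inc R ++ (suc m , tt) ∷ (m , tt) ∷ (suc m , tt) ∷ dec U
    ≈⟨ comm-all (suc m) (inc R) ((suc m , tt) ∷ []) _ (All.map s≤s (inc-< R)) (ℕP.≤-refl ∷ []) ⟩
  (suc m , tt) ∷ inc R ++ (m , tt) ∷ (suc m , tt) ∷ dec U
    ≡⟨ cong (λ w → (suc m , tt) ∷ inc R ++ (m , tt) ∷ (suc m , tt) ∷ w) (sym (++-identityʳ (dec U))) ⟩
  (suc m , tt) ∷ inc R ++ (m , tt) ∷ ((suc m , tt) ∷ []) ++ dec U ++ []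
    ≈⟨ cons∼ _ (++ˡ∼ (inc R) (cons∼ _ (sym∼ (comm-all (suc m) (dec U) ((suc m , tt) ∷ []) [] (All.map s≤s (dec-< U)) (ℕP.≤-refl ∷ []))))) ⟩
  (suc m , tt) ∷ inc R ++ (m , tt) ∷ dec U ++ (suc m , tt) ∷ []
    ≡⟨ cong (_ ∷_) (sym (++-assoc (inc R) _ _)) ⟩
  (suc m , tt) ∷ (inc R ++ (m , tt) ∷ dec U) ++ (suc m , tt) ∷ []
    ≈⟨ cons∼ _ (++ʳ∼ _ (inserted-next (state R U) R U _ _ (inserted R U oks))) ⟩
  (suc m , tt) ∷ (dec (outU (● ∷ R) (● ∷ U)) ++ inc (outR (● ∷ R) (● ∷ U))) ++ (suc m , tt) ∷ []
    ≡⟨ cong (_ ∷_) (++-assoc (dec (outU (● ∷ R) (● ∷ U))) _ _) ⟩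
  (suc m , tt) ∷ dec (outU (● ∷ R) (● ∷ U)) ++ inc (outR (● ∷ R) (● ∷ U)) ++ (suc m , tt) ∷ [] ∎
  where open ∼-Reasoning

insertion-∼ : (R U : Cells ⊤ m) → Ok R U → state R U ≢ bth → inc R ++ dec U ∼ dec (outU R U) ++ inc (outR R U)
insertion-∼ R U ok n with state R U | inserted R U ok
... | row | _ , e = e
... | fac | _ , e = e
... | bth | _ = ⊥-elim (n refl)

size : Cells A m → ℕ
size [] = 0
size (x ∷ U) = Maybe.maybe′ (λ _ → suc) (λ k → k) x (size U)

size-dec : (U : Cells A m) → length (dec U) ≡ size U
size-dec [] = refl
size-dec (nothing ∷ U) = size-dec U
size-dec (just a ∷ U) = cong suc (size-dec U)

-- The row has gained box t letters and the factor has lost boxU t; these differ only in the transient state bth.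
box : St → ℕ
box row = 0
box fac = 1
box bth = 0

boxU : St → ℕ
boxU row = 0
boxU fac = 1
boxU bth = 1

size-outU : (R U : Cells ⊤ m) → size U ≡ boxU (state R U) + size (outU R U)
size-outU [] [] = refl
size-outU (x ∷ R) (y ∷ U) = go x y (state R U) (size-outU R U)
  where
  go : ∀ x y s {a b} → a ≡ boxU s + b →
       Maybe.maybe′ (λ _ → suc) (λ k → k) y a ≡ boxU (nextSt x y s) + Maybe.maybe′ (λ _ → suc) (λ k → k) (emitU x y s) b
  go ○ ○ s e = e
  go ● ○ row e = e
  go ● ○ fac e = e
  go ● ○ bth e = e
  go ○ ● row e = cong suc e
  go ○ ● fac e = cong suc e
  go ○ ● bth e = cong suc e
  go ● ● row e = cong suc e
  go ● ● fac e = cong suc e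
  go ● ● bth e = cong suc e

size-outR : (R U : Cells ⊤ m) → size (outR R U) ≡ box (state R U) + size R
size-outR [] [] = refl
size-outR (x ∷ R) (y ∷ U) = go x y (state R U) (size-outR R U)
  where
  go : ∀ x y s {a b} → a ≡ box s + b →
       Maybe.maybe′ (λ _ → suc) (λ k → k) (emitR x y s) a ≡ box (nextSt x y s) + Maybe.maybe′ (λ _ → suc) (λ k → k) x b
  go ○ ○ s e = e
  go ● ○ row e = cong suc e
  go ● ○ fac e = e
  go ● ○ bth e = cong suc e
  go ○ ● row e = cong suc e
  go ○ ● fac e = e
  go ○ ● bth e = cong suc e
  go ● ● row e = cong suc e
  go ● ● fac e = e
  go ● ● bth e = cong suc e

-- The insertion is undone by reading the output downwards from the final state.
undoR undoU : Maybe ⊤ → Maybe ⊤ → St → Maybe ⊤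
undoR ○ ○ s = ○
undoR _ _ s = inRow s
undoU ○ ○ s = ○
undoU _ _ s = inFac s

-- Insertion is reversible event by event: the later state recovers the input cells, and the emitted
-- cells recover the earlier state.
event-undo : ∀ x y s → (undoR (emitU x y s) (emitR x y s) (nextSt x y s) , undoU (emitU x y s) (emitR x y s) (nextSt x y s) ,
                        nextSt (emitR x y s) (emitU x y s) (nextSt x y s)) ≡ (x , y , s)
event-undo ○ ○ s = refl
event-undo ● ○ row = refl
event-undo ● ○ fac = refl
event-undo ● ○ bth = refl
event-undo ○ ● row = refl
event-undo ○ ● fac = refl
event-undo ○ ● bth = refl
event-undo ● ● row = refl
event-undo ● ● fac = refl
event-undo ● ● bth = refl

insertion-injective : (R U R₁ U₁ : Cells ⊤ m) → state R U ≡ state R₁ U₁ → outU R U ≡ outU R₁ U₁ → outR R U ≡ outR R₁ U₁ →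
                      R ≡ R₁ × U ≡ U₁
insertion-injective [] [] [] [] _ _ _ = refl , refl
insertion-injective (x ∷ R) (y ∷ U) (x₁ ∷ R₁) (y₁ ∷ U₁) e eU eR
  with trans (sym (event-undo x y (state R U)))
       (trans (cong₂ (λ s (uv : Maybe ⊤ × Maybe ⊤) → undoR (proj₁ uv) (proj₂ uv) s , undoU (proj₁ uv) (proj₂ uv) s , nextSt (proj₂ uv) (proj₁ uv) s)
                     e (cong₂ _,_ (cong Vec.head eU) (cong Vec.head eR)))
              (event-undo x₁ y₁ (state R₁ U₁)))
... | eq with insertion-injective R U R₁ U₁ (cong (proj₂ ∘ proj₂) eq) (cong Vec.tail eU) (cong Vec.tail eR)
...   | refl , refl = cong (_∷ R) (cong proj₁ eq) , cong (_∷ U) (cong (proj₁ ∘ proj₂) eq)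

-- Signatures under insertion

sigCell : Maybe ⊤ → Maybe ⊤ → ℕ × ℕ → ℕ × ℕ
sigCell x y st = Maybe.maybe′ (λ _ → openB) (λ st → st) x (Maybe.maybe′ (λ _ → closeC) (λ st → st) y st)

-- The contribution of the final states of two successive insertions to the signature.
π : St → St → ℕ × ℕ → ℕ × ℕ
π row row o = o
π row fac o = closeC o
π row bth o = closeC o
π fac row o = openB o
π bth row o = openB o
π fac fac o = o
π fac bth o = openB (closeC o)
π bth fac o = openB (closeC o)
π bth bth o = openB (closeC o)

-- A finite check, uniform in the signature `o`; the combinations not listed are those excluded by
-- `OkCell`.
cell-sig : ∀ r u v s₁ s₂ → OkCell r u s₁ → OkCell (emitR r u s₁) v s₂ → ∀ o →
           sigCell u v (π s₁ s₂ o) ≡ π (nextSt r u s₁) (nextSt (emitR r u s₁) v s₂) (sigCell (emitU r u s₁) (emitU (emitR r u s₁) v s₂) o)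
cell-sig ○ ○ ○ row row _ _ o = refl
cell-sig ○ ○ ○ row fac _ _ o = refl
cell-sig ○ ○ ○ fac row _ _ o = refl
cell-sig ○ ○ ○ fac fac _ _ o = refl
cell-sig ○ ○ ● row row _ _ o = refl
cell-sig ○ ○ ● row fac _ _ o = refl
cell-sig ○ ○ ● row bth _ _ o = refl
cell-sig ○ ○ ● fac row _ _ o = refl
cell-sig ○ ○ ● fac fac _ _ o = refl
cell-sig ○ ○ ● fac bth _ _ o = refl
cell-sig ○ ● ○ row row _ _ o = refl
cell-sig ○ ● ○ row fac _ _ o = refl
cell-sig ○ ● ○ row bth _ _ o = refl
cell-sig ○ ● ○ fac row _ _ o = refl
cell-sig ○ ● ○ fac fac _ _ o = refl
cell-sig ○ ● ○ bth row _ _ o = refl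
cell-sig ○ ● ○ bth fac _ _ o = refl
cell-sig ○ ● ○ bth bth _ _ o = refl
cell-sig ○ ● ● row row _ _ o = refl
cell-sig ○ ● ● row fac _ _ o = refl
cell-sig ○ ● ● row bth _ _ o = refl
cell-sig ○ ● ● fac row _ _ o = refl
cell-sig ○ ● ● fac fac _ _ o = refl
cell-sig ○ ● ● fac bth _ _ o = refl
cell-sig ○ ● ● bth row _ _ o = refl
cell-sig ○ ● ● bth fac _ _ o = refl
cell-sig ○ ● ● bth bth _ _ o = refl
cell-sig ● ○ ○ row row _ _ o = refl
cell-sig ● ○ ○ row fac _ _ o = refl
cell-sig ● ○ ○ row bth _ _ o = refl
cell-sig ● ○ ○ fac row _ _ o = refl
cell-sig ● ○ ○ fac fac _ _ o = refl
cell-sig ● ○ ○ bth row _ _ o = refl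
cell-sig ● ○ ○ bth fac _ _ o = refl
cell-sig ● ○ ○ bth bth _ _ o = refl
cell-sig ● ○ ● row row _ _ o = refl
cell-sig ● ○ ● row fac _ _ o = refl
cell-sig ● ○ ● row bth _ _ o = refl
cell-sig ● ○ ● fac row _ _ o = refl
cell-sig ● ○ ● fac fac _ _ o = refl
cell-sig ● ○ ● fac bth _ _ o = refl
cell-sig ● ○ ● bth row _ _ o = refl
cell-sig ● ○ ● bth fac _ _ o = refl
cell-sig ● ○ ● bth bth _ _ o = refl
cell-sig ● ● ○ row row _ _ o = refl
cell-sig ● ● ○ row fac _ _ o = refl
cell-sig ● ● ○ row bth _ _ o = refl
cell-sig ● ● ○ fac row _ _ o = refl
cell-sig ● ● ○ fac fac _ _ o = refl
cell-sig ● ● ○ bth row _ _ o = refl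
cell-sig ● ● ○ bth fac _ _ o = refl
cell-sig ● ● ○ bth bth _ _ o = refl
cell-sig ● ● ● row row _ _ o = refl
cell-sig ● ● ● row fac _ _ o = refl
cell-sig ● ● ● row bth _ _ o = refl
cell-sig ● ● ● fac row _ _ o = refl
cell-sig ● ● ● fac fac _ _ o = refl
cell-sig ● ● ● fac bth _ _ o = refl
cell-sig ● ● ● bth row _ _ o = refl
cell-sig ● ● ● bth fac _ _ o = refl
cell-sig ● ● ● bth bth _ _ o = refl

closeC₂-cong : ∀ {a b : ℕ × ℕ} → proj₂ a ≡ proj₂ b → proj₂ (closeC a) ≡ proj₂ (closeC b)
closeC₂-cong {_ , zero} {_ , zero} refl = refl
closeC₂-cong {_ , suc o} {_ , suc .o} refl = refl

π₂-cong : ∀ s t {a b} → proj₂ a ≡ proj₂ b → proj₂ (π s t a) ≡ proj₂ (π s t b)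
π₂-cong row row e = e
π₂-cong row fac e = closeC₂-cong e
π₂-cong row bth e = closeC₂-cong e
π₂-cong fac row e = cong suc e
π₂-cong bth row e = cong suc e
π₂-cong fac fac e = e
π₂-cong fac bth {a} {b} e = cong suc (closeC₂-cong {a} {b} e)
π₂-cong bth fac {a} {b} e = cong suc (closeC₂-cong {a} {b} e)
π₂-cong bth bth {a} {b} e = cong suc (closeC₂-cong {a} {b} e)

-- The signature is preserved once the recorded states count as one more tensor factor in front of
-- the bumped factors; `π` is the action of that factor.
sig-insertion : (R U V : Cells ⊤ m) → Ok R U → Ok (outR R U) V →
                sig U V ≡ π (state R U) (state (outR R U) V) (sig (outU R U) (outU (outR R U) V))
sig-insertion [] [] [] _ _ = refl
sig-insertion (r ∷ R) (u ∷ U) (v ∷ V) (ok , oks) (ok′ , oks′) =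
  trans (cong (sigCell u v) (sig-insertion R U V oks oks′)) (cell-sig r u v (state R U) (state (outR R U) V) ok ok′ _)

-- Insertion commutes with f

-- Comparing the insertions of (U , V) and of f (U , V): the phases of the input and of the output are
-- correlated with the pairs of states.
data MidState : St → St → Set where
  fac-bth : MidState fac bth
  fac-fac : MidState fac fac
  bth-bth : MidState bth bth
  bth-fac : MidState bth fac

data MidSim {m : ℕ} : (s₁ s₂ t₁ t₂ : St) (U V U' V' : Cells ⊤ m) → Set where
  pre-bth : ∀ {U V} → Closed U V → MidSim bth row bth bth U V U V
  pre-fac : ∀ {U V} → Closed U V → MidSim fac row fac bth U V U V
  mid     : ∀ {s₁ s₂ U V U' V'} → MidState s₁ s₂ → Mid tt tt tt U V U' V' → MidSim s₁ s₂ s₁ s₂ U V U' V'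

-- The output trails the input by one event, so its phase may be an earlier one: in the `pre` cases
-- the outputs still agree, in the `mid` cases they are inside the segment, in `post` the removed
-- letter has been passed. The states of the two insertions differ until `post` is reached.
data PostSim {m : ℕ} : (j : ℕ) (s₁ s₂ t₁ t₂ : St) (U V U' V' : Cells ⊤ m) → Set where
  pre-bth : ∀ {U V} → Closed U V → PostSim 0 bth row row bth U V U V
  pre-fac : ∀ {U V} → Closed U V → PostSim 0 fac row row fac U V U V
  mid-bth : ∀ {U V U' V'} → Mid tt tt tt U V U' V' → PostSim 0 bth bth row bth U V U' V'
  mid-fac : ∀ {U V U' V'} → Mid tt tt tt U V U' V' → PostSim 0 bth fac row fac U V U' V'
  post    : ∀ {j s₁ s₂ j' U V U' V'} → Post j' U V U' V' → PostSim j s₁ s₂ s₁ s₂ U V U' V'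

private variable
  s₁ s₂ t₁ t₂ : St
  U V U' V' : Cells ⊤ m

-- Reading one more cell: r is the row, u v and u' v' are the cells of the two pairs of factors.
MidSim⁺ : (r u v u' v' : Maybe ⊤) (s₁ s₂ t₁ t₂ : St) (U V U' V' : Cells ⊤ m) → Set
MidSim⁺ r u v u' v' s₁ s₂ t₁ t₂ U V U' V' =
  emitR (emitR r u s₁) v s₂ ≡ emitR (emitR r u' t₁) v' t₂ ×
  MidSim (nextSt r u s₁) (nextSt (emitR r u s₁) v s₂) (nextSt r u' t₁) (nextSt (emitR r u' t₁) v' t₂)
    (emitU r u s₁ ∷ U) (emitU (emitR r u s₁) v s₂ ∷ V) (emitU r u' t₁ ∷ U') (emitU (emitR r u' t₁) v' t₂ ∷ V')

PostSim⁺ : (j : ℕ) (r u v u' v' : Maybe ⊤) (s₁ s₂ t₁ t₂ : St) (U V U' V' : Cells ⊤ m) → Set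
PostSim⁺ j r u v u' v' s₁ s₂ t₁ t₂ U V U' V' =
  emitR (emitR r u s₁) v s₂ ≡ emitR (emitR r u' t₁) v' t₂ ×
  PostSim j (nextSt r u s₁) (nextSt (emitR r u s₁) v s₂) (nextSt r u' t₁) (nextSt (emitR r u' t₁) v' t₂)
    (emitU r u s₁ ∷ U) (emitU (emitR r u s₁) v s₂ ∷ V) (emitU r u' t₁ ∷ U') (emitU (emitR r u' t₁) v' t₂ ∷ V')

-- The hypothesis leaves only the pairs of states for which `π` does not end by opening a letter.
start-cell : ∀ r s₁ s₂ → proj₂ (π s₁ s₂ (sig U V)) ≡ 0 → MidSim⁺ r ● ○ ● ● s₁ s₂ s₁ s₂ U V U V
start-cell ○ row row o = refl , pre-fac o
start-cell ● row row o = refl , pre-bth o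
start-cell ○ fac fac o = refl , mid fac-fac (start o)
start-cell ● fac fac o = refl , mid bth-fac (start o)
start-cell ○ row fac o = refl , pre-fac o
start-cell ● row fac o = refl , pre-bth o
start-cell ○ row bth o = refl , pre-fac o
start-cell ● row bth o = refl , pre-bth o

step-cell : ∀ r → MidSim s₁ s₂ t₁ t₂ U V U' V' → MidSim⁺ r ● ● ● ● s₁ s₂ t₁ t₂ U V U' V'
step-cell ○ (pre-bth o) = refl , mid fac-bth (start o)
step-cell ● (pre-bth o) = refl , mid bth-bth (start o)
step-cell ○ (pre-fac o) = refl , mid fac-fac (start o)
step-cell ● (pre-fac o) = refl , mid bth-fac (start o)
step-cell ○ (mid fac-bth M) = refl , mid fac-fac (step M)
step-cell ● (mid fac-bth M) = refl , mid bth-fac (step M)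
step-cell ○ (mid fac-fac M) = refl , mid fac-fac (step M)
step-cell ● (mid fac-fac M) = refl , mid bth-fac (step M)
step-cell ○ (mid bth-bth M) = refl , mid fac-bth (step M)
step-cell ● (mid bth-bth M) = refl , mid bth-bth (step M)
step-cell ○ (mid bth-fac M) = refl , mid fac-bth (step M)
step-cell ● (mid bth-fac M) = refl , mid bth-bth (step M)

one-cell : ∀ r s₁ s₂ → proj₂ (π s₁ s₂ (sig U V)) ≡ 0 → PostSim⁺ 0 r ● ○ ○ ● s₁ s₂ s₁ s₂ U V U V
one-cell ○ row row o = refl , pre-fac o
one-cell ● row row o = refl , pre-bth o
one-cell ○ fac fac o = refl , post (one o)
one-cell ● fac fac o = refl , mid-fac (start o)
one-cell ○ row fac o = refl , pre-fac o
one-cell ● row fac o = refl , pre-bth o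
one-cell ○ row bth o = refl , pre-fac o
one-cell ● row bth o = refl , pre-bth o

top-cell : ∀ r → OkCell r ○ t₁ → MidSim s₁ s₂ t₁ t₂ U V U' V' → PostSim⁺ 0 r ● ● ○ ● s₁ s₂ t₁ t₂ U V U' V'
top-cell ● ok (pre-bth o) = refl , mid-bth (start o)
top-cell ○ ok (pre-fac o) = refl , post (one o)
top-cell ● ok (pre-fac o) = refl , mid-fac (start o)
top-cell ○ ok (mid fac-bth M) = refl , post (top M)
top-cell ● ok (mid fac-bth M) = refl , mid-fac (step M)
top-cell ○ ok (mid fac-fac M) = refl , post (top M)
top-cell ● ok (mid fac-fac M) = refl , mid-fac (step M)
top-cell ● ok (mid bth-bth M) = refl , mid-bth (step M)
top-cell ● ok (mid bth-fac M) = refl , mid-bth (step M)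

-- The only obstruction is a letter of `V` that would pair the removed letter itself. The two sides
-- then have equally many open letters, which is the second alternative.
Post-∷ : ∀ {j} (x y : Maybe ⊤) → Post j U V U' V' →
         (∃ λ j' → Post j' (x ∷ U) (y ∷ V) (x ∷ U') (y ∷ V')) ⊎
         (proj₂ (sig (x ∷ U) (y ∷ V)) ≡ proj₂ (sig (x ∷ U') (y ∷ V')))
Post-∷ ○ ○ P = inj₁ (_ , skip P)
Post-∷ ● ○ P = inj₁ (_ , opens P)
Post-∷ {j = suc j} ○ ● P = inj₁ (_ , close P)
Post-∷ {j = suc j} ● ● P = inj₁ (_ , both P)
Post-∷ {j = zero} x ● P with Post-sig P
Post-∷ {j = zero} ○ ● P | _ , e , e' = inj₂ (trans (cong (proj₂ ∘ closeC) e) (sym (cong (proj₂ ∘ closeC) e')))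
Post-∷ {j = zero} ● ● P | _ , e , e' = inj₂ (cong suc (trans (cong (proj₂ ∘ closeC) e) (sym (cong (proj₂ ∘ closeC) e'))))

-- In the last phase the signatures force the output to remain in its last phase.
post-cell : ∀ {j j' k} r x y → OkCell r x s₁ → OkCell r x t₁ → PostSim j s₁ s₂ t₁ t₂ U V U' V' →
            (j ≡ 0 → y ≡ ○) →
            proj₂ (π (nextSt r x s₁) (nextSt (emitR r x s₁) y s₂) (sig (emitU r x s₁ ∷ U) (emitU (emitR r x s₁) y s₂ ∷ V))) ≡ suc k →
            proj₂ (π (nextSt r x t₁) (nextSt (emitR r x t₁) y t₂) (sig (emitU r x t₁ ∷ U') (emitU (emitR r x t₁) y t₂ ∷ V'))) ≡ k →
            (j ≡ 0 → x ≡ ○ → j' ≡ 0) →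
            PostSim⁺ j' r x y x y s₁ s₂ t₁ t₂ U V U' V'
post-cell r x y _ _ S low _ _ _ with S
post-cell r x y _ _ _ low _ _ _ | pre-bth o with low refl
post-cell ● ○ y _ _ _ low _ _ _ | pre-bth o | refl = refl , post (one o)
post-cell ○ ● y _ _ _ low _ _ _ | pre-bth o | refl = refl , post (one o)
post-cell ● ● y _ _ _ low _ _ _ | pre-bth o | refl = refl , post (one o)
post-cell r x y _ _ _ low _ _ _ | pre-fac o with low refl
post-cell ○ ○ y _ _ _ low _ _ z | pre-fac o | refl with z refl refl
... | refl = refl , pre-fac o
post-cell ● ○ y _ _ _ low _ _ _ | pre-fac o | refl = refl , post (one o)
post-cell ○ ● y _ _ _ low _ _ _ | pre-fac o | refl = refl , post (one o)
post-cell ● ● y _ _ _ low _ _ _ | pre-fac o | refl = refl , post (one o)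
post-cell r x y _ _ _ low _ _ _ | mid-bth M with low refl
post-cell ● ○ y _ _ _ low _ _ _ | mid-bth M | refl = refl , post (top M)
post-cell ○ ● y _ _ _ low _ _ _ | mid-bth M | refl = refl , post (top M)
post-cell ● ● y _ _ _ low _ _ _ | mid-bth M | refl = refl , post (top M)
post-cell r x y _ _ _ low _ _ _ | mid-fac M with low refl
post-cell ● ○ y _ _ _ low _ _ _ | mid-fac M | refl = refl , post (top M)
post-cell ○ ● y _ _ _ low _ _ _ | mid-fac M | refl = refl , post (top M)
post-cell ● ● y _ _ _ low _ _ _ | mid-fac M | refl = refl , post (top M)
post-cell {s₁ = s₁} {s₂ = s₂} {U = U} {V = V} {U' = U'} {V' = V'} r x y _ _ _ low e e' _ | post P
  with Post-∷ (emitU r x s₁) (emitU (emitR r x s₁) y s₂) P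
... | inj₁ (_ , P') = refl , post P'
... | inj₂ eq = ⊥-elim (ℕP.1+n≢n (trans (sym e) (trans
    (π₂-cong (nextSt r x s₁) (nextSt (emitR r x s₁) y s₂) {sig (emitU r x s₁ ∷ U) (emitU (emitR r x s₁) y s₂ ∷ V)} {sig (emitU r x s₁ ∷ U') (emitU (emitR r x s₁) y s₂ ∷ V')} eq) e')))

Sim : (T : {m : ℕ} (s₁ s₂ t₁ t₂ : St) (U V U' V' : Cells ⊤ m) → Set) (R U V U' V' : Cells ⊤ m) → Set
Sim T R U V U' V' =
  outR (outR R U) V ≡ outR (outR R U') V' ×
  T (state R U) (state (outR R U) V) (state R U') (state (outR R U') V')
    (outU R U) (outU (outR R U) V) (outU R U') (outU (outR R U') V')

Oks : (R U V : Cells ⊤ m) → Set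
Oks R U V = Ok R U × Ok (outR R U) V

Oks-tail : ∀ {r u v} {R U V : Cells ⊤ m} → Oks (r ∷ R) (u ∷ U) (v ∷ V) → Oks R U V
Oks-tail ((_ , a) , (_ , b)) = a , b

Mid-sim : (R : Cells ⊤ m) → Mid tt tt tt U V U' V' → Oks R U V → Oks R U' V' → Sim MidSim R U V U' V'
Mid-sim (r ∷ R) (start {U = U} {V} o) ok ok' with Oks-tail ok
... | ok₁ , ok₂ with start-cell r (state R U) (state (outR R U) V) (trans (cong proj₂ (sym (sig-insertion R U V ok₁ ok₂))) o)
...   | e , S = cong (_∷ _) e , S
Mid-sim (r ∷ R) (step M) ok ok' with Mid-sim R M (Oks-tail ok) (Oks-tail ok')
... | es , S with step-cell r S
...   | e , S' = cong₂ _∷_ e es , S'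

Post-sim : ∀ {j} (R : Cells ⊤ m) → Post j U V U' V' → Oks R U V → Oks R U' V' → Sim (PostSim j) R U V U' V'
common-sim : ∀ {j j'} x y r (R : Cells ⊤ m) → Post j U V U' V' → (j ≡ 0 → y ≡ ○) → (j ≡ 0 → x ≡ ○ → j' ≡ 0) →
             Post j' (x ∷ U) (y ∷ V) (x ∷ U') (y ∷ V') →
             Oks (r ∷ R) (x ∷ U) (y ∷ V) → Oks (r ∷ R) (x ∷ U') (y ∷ V') → Sim (PostSim j') (r ∷ R) (x ∷ U) (y ∷ V) (x ∷ U') (y ∷ V')

Post-sim (r ∷ R) (one {U = U} {V} o) ok ok' with Oks-tail ok
... | ok₁ , ok₂ with one-cell r (state R U) (state (outR R U) V) (trans (cong proj₂ (sym (sig-insertion R U V ok₁ ok₂))) o)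
...   | e , S = cong (_∷ _) e , S
Post-sim (r ∷ R) (top M) ok ok' with Mid-sim R M (Oks-tail ok) (Oks-tail ok')
... | es , S with top-cell r (proj₁ (proj₁ ok')) S
...   | e , S' = cong₂ _∷_ e es , S'
Post-sim (r ∷ R) (skip P) ok ok' = common-sim ○ ○ r R P (λ _ → refl) (λ e _ → e) (skip P) ok ok'
Post-sim (r ∷ R) (opens P) ok ok' = common-sim ● ○ r R P (λ _ → refl) (λ _ ()) (opens P) ok ok'
Post-sim (r ∷ R) (close P) ok ok' = common-sim ○ ● r R P (λ ()) (λ ()) (close P) ok ok'
Post-sim (r ∷ R) (both P) ok ok' = common-sim ● ● r R P (λ ()) (λ ()) (both P) ok ok'

common-sim {U = U} {V} {U'} {V'} x y r R P low z P⁺ ok ok' with Post-sim R P (Oks-tail ok) (Oks-tail ok') | Post-sig P⁺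
... | es , S | _ , eS , eS' with post-cell r x y (proj₁ (proj₁ ok)) (proj₁ (proj₁ ok')) S low
        (trans (cong proj₂ (sym (sig-insertion (r ∷ R) (x ∷ U) (y ∷ V) (proj₁ ok) (proj₂ ok)))) (cong proj₂ eS))
        (trans (cong proj₂ (sym (sig-insertion (r ∷ R) (x ∷ U') (y ∷ V') (proj₁ ok') (proj₂ ok')))) (cong proj₂ eS')) z
...   | e , S' = cong₂ _∷_ e es , S'

-- f either moves a box of the recording tableau or acts on the bumped factors.
Post-insertion : ∀ {j} (R : Cells ⊤ m) → Post j U V U' V' → Oks R U V → Oks R U' V' →
                 state R U ≢ bth → state (outR R U) V ≢ bth →
                 outR (outR R U) V ≡ outR (outR R U') V' ×
                 ((state R U ≡ fac × state (outR R U) V ≡ row × state R U' ≡ row × state (outR R U') V' ≡ fac ×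
                   outU R U ≡ outU R U' × outU (outR R U) V ≡ outU (outR R U') V' × Closed (outU R U) (outU (outR R U) V))
                  ⊎ (state R U ≡ state R U' × state (outR R U) V ≡ state (outR R U') V' ×
                     ∃ λ j' → Post j' (outU R U) (outU (outR R U) V) (outU R U') (outU (outR R U') V')))
Post-insertion R P ok ok' n n' with Post-sim R P ok ok'
... | es , S = es , final S n n'
  where
  final : ∀ {j s₁ s₂ t₁ t₂} {U V U' V' : Cells ⊤ m} → PostSim j s₁ s₂ t₁ t₂ U V U' V' → s₁ ≢ bth → s₂ ≢ bth →
          ((s₁ ≡ fac × s₂ ≡ row × t₁ ≡ row × t₂ ≡ fac × U ≡ U' × V ≡ V' × Closed U V) ⊎
           (s₁ ≡ t₁ × s₂ ≡ t₂ × ∃ λ j' → Post j' U V U' V'))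
  final (pre-bth o) n n' = ⊥-elim (n refl)
  final (pre-fac o) n n' = inj₁ (refl , refl , refl , refl , refl , refl , o)
  final (mid-bth M) n n' = ⊥-elim (n refl)
  final (mid-fac M) n n' = ⊥-elim (n refl)
  final (post P) n n' = inj₂ (refl , refl , _ , P)

-- The signature rule on words

stepW : ℕ → ℕ → ℕ × ℕ → ℕ × ℕ
stepW i x o = if x ≡ᵇ suc i then closeC o else (if x ≡ᵇ i then openB o else o)

-- The numbers of unmatched letters i + 1 and i of a word.
sigW : ℕ → List ℕ → ℕ × ℕ
sigW i = foldr (stepW i) (0 , 0)

-- The scan runs from the left with a stack, while `sigW` folds from the right. The unmatched
-- letters `i` of the word pop entries of `os`, the excess going to `cs`, and its unmatched letters
-- `i + 1` are pushed.
record Scanned (i pos : ℕ) (os cs w : List ℕ) (sg : ℕ × ℕ) : Set where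
  field
    {new newc} : List ℕ
    scan≡  : sigScan i pos os cs w ≡ (new ++ drop (proj₂ sg) os , newc ++ cs)
    new#   : length new ≡ proj₁ sg
    newc#  : length newc ≡ proj₂ sg ∸ length os

drop-[] : ∀ k → drop {A = ℕ} k [] ≡ []
drop-[] zero = refl
drop-[] (suc k) = refl

sigScan-open : ∀ {i} x pos os cs w → (x ≡ᵇ suc i) ≡ true → sigScan i pos os cs (x ∷ w) ≡ sigScan i (suc pos) (pos ∷ os) cs w
sigScan-open x pos os cs w e rewrite e = refl

sigScan-unmatched : ∀ {i} x pos cs w → (x ≡ᵇ suc i) ≡ false → (x ≡ᵇ i) ≡ true →
                    sigScan i pos [] cs (x ∷ w) ≡ sigScan i (suc pos) [] (pos ∷ cs) w
sigScan-unmatched x pos cs w e e' rewrite e | e' = refl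

sigScan-matched : ∀ {i} x pos o os cs w → (x ≡ᵇ suc i) ≡ false → (x ≡ᵇ i) ≡ true →
                  sigScan i pos (o ∷ os) cs (x ∷ w) ≡ sigScan i (suc pos) os cs w
sigScan-matched x pos o os cs w e e' rewrite e | e' = refl

sigScan-other : ∀ {i} x pos os cs w → (x ≡ᵇ suc i) ≡ false → (x ≡ᵇ i) ≡ false →
                sigScan i pos os cs (x ∷ w) ≡ sigScan i (suc pos) os cs w
sigScan-other x pos os cs w e e' rewrite e | e' = refl

scan : ∀ i pos os cs w → Scanned i pos os cs w (sigW i w)
scan i pos os cs [] = record { new = [] ; newc = [] ; scan≡ = refl ; new# = refl ; newc# = sym (ℕP.0∸n≡0 (length os)) }
scan i pos os cs (x ∷ w) with x ≡ᵇ suc i in e₁ | x ≡ᵇ i in e₂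
... | true | _ = opening (sigW i w) (scan i (suc pos) (pos ∷ os) cs w)
  where
  opening : ∀ o → Scanned i (suc pos) (pos ∷ os) cs w o → Scanned i pos os cs (x ∷ w) (closeC o)
  opening (x' , zero) record { new = new ; scan≡ = e ; new# = n ; newc# = c } = record
    { new = new ++ pos ∷ [] ; scan≡ = trans (sigScan-open x pos os cs w e₁) (trans e (cong (_, _) (sym (++-assoc new (pos ∷ []) os))))
    ; new# = trans (length-++ new) (trans (ℕP.+-comm (length new) 1) (cong suc n)) ; newc# = trans c (sym (ℕP.0∸n≡0 (length os))) }
  opening (x' , suc o) record { scan≡ = e ; new# = n ; newc# = c } =
    record { scan≡ = trans (sigScan-open x pos os cs w e₁) e ; new# = n ; newc# = c }
... | false | false = record { scan≡ = trans (sigScan-other x pos os cs w e₁ e₂) scan≡ ; new# = new# ; newc# = newc# }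
  where open Scanned (scan i (suc pos) os cs w)
... | false | true = closing os
  where
  closing : ∀ os → Scanned i pos os cs (x ∷ w) (openB (sigW i w))
  closing [] = record
    { newc = newc ++ pos ∷ []
    ; scan≡ = trans (sigScan-unmatched x pos cs w e₁ e₂) (trans scan≡
        (cong₂ _,_ (cong (new ++_) (drop-[] (proj₂ (sigW i w)))) (sym (++-assoc newc (pos ∷ []) cs))))
    ; new# = new# ; newc# = trans (length-++ newc) (trans (ℕP.+-comm (length newc) 1) (cong suc newc#)) }
    where open Scanned (scan i (suc pos) [] (pos ∷ cs) w)
  closing (o ∷ os) = record { scan≡ = trans (sigScan-matched x pos o os cs w e₁ e₂) scan≡ ; new# = new# ; newc# = newc# }
    where open Scanned (scan i (suc pos) os cs w)

sigScan-++ : ∀ i pos os cs p w → sigScan i pos os cs (p ++ w) ≡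
             sigScan i (pos + length p) (proj₁ (sigScan i pos os cs p)) (proj₂ (sigScan i pos os cs p)) w
sigScan-++ i pos os cs [] w = cong (λ k → sigScan i k os cs w) (sym (ℕP.+-identityʳ pos))
sigScan-++ i pos [] cs (x ∷ p) w rewrite ℕP.+-suc pos (length p) with x ≡ᵇ suc i | x ≡ᵇ i
... | true | _ = sigScan-++ i (suc pos) (pos ∷ []) cs p w
... | false | true = sigScan-++ i (suc pos) [] (pos ∷ cs) p w
... | false | false = sigScan-++ i (suc pos) [] cs p w
sigScan-++ i pos (o ∷ os) cs (x ∷ p) w rewrite ℕP.+-suc pos (length p) with x ≡ᵇ suc i | x ≡ᵇ i
... | true | _ = sigScan-++ i (suc pos) (pos ∷ o ∷ os) cs p w
... | false | true = sigScan-++ i (suc pos) os cs p w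
... | false | false = sigScan-++ i (suc pos) (o ∷ os) cs p w

≡ᵇ-refl : ∀ i → (i ≡ᵇ i) ≡ true
≡ᵇ-refl zero = refl
≡ᵇ-refl (suc i) = ≡ᵇ-refl i

≡ᵇ-false : ∀ {i j} → i ≢ j → (i ≡ᵇ j) ≡ false
≡ᵇ-false {zero} {zero} n = ⊥-elim (n refl)
≡ᵇ-false {zero} {suc j} n = refl
≡ᵇ-false {suc i} {zero} n = refl
≡ᵇ-false {suc i} {suc j} n = ≡ᵇ-false (n ∘ cong suc)

length-0 : {X : Set} (l : List X) → length l ≡ 0 → l ≡ []
length-0 [] e = refl

last-∷ʳ : ∀ l (x : ℕ) → last (l ++ x ∷ []) ≡ just x
last-∷ʳ [] x = refl
last-∷ʳ (y ∷ []) x = refl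
last-∷ʳ (y ∷ z ∷ l) x = last-∷ʳ (z ∷ l) x

setAt-++ : ∀ p x y s → setAt (length p) y (p ++ x ∷ s) ≡ p ++ y ∷ s
setAt-++ [] x y s = refl
setAt-++ (z ∷ p) x y s = cong (z ∷_) (setAt-++ p x y s)

-- t' arises from t by raising an unmatched letter i to i + 1; it is the rightmost one, and it becomes
-- the leftmost unmatched letter i + 1.
record Raise (i : ℕ) (t t' : List ℕ) : Set where
  constructor raise
  field
    p q  : List ℕ
    t≡   : t ≡ p ++ i ∷ q
    t′≡  : t' ≡ p ++ suc i ∷ q
    pre  : proj₁ (sigW i p) ≡ 0
    suf  : proj₂ (sigW i q) ≡ 0

sigScan-prefix : ∀ i p w → proj₁ (sigW i p) ≡ 0 → ∃ λ cs → sigScan i 0 [] [] (p ++ w) ≡ sigScan i (length p) [] cs w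
sigScan-prefix i p w e with scan i 0 [] [] p
... | record { new = new ; scan≡ = eq ; new# = n } = _ , trans (sigScan-++ i 0 [] [] p w)
  (cong₂ (λ os cs → sigScan i (length p) os cs w)
    (trans (cong proj₁ eq) (cong₂ _++_ (length-0 new (trans n e)) (drop-[] (proj₂ (sigW i p))))) refl)

fT-just : ∀ {i t q cs} → proj₂ (sigScan i 0 [] [] t) ≡ q ∷ cs → fT i t ≡ just (setAt q (suc i) t)
fT-just e rewrite e = refl

eT-just : ∀ {i t q} → last (proj₁ (sigScan i 0 [] [] t)) ≡ just q → eT i t ≡ just (setAt q i t)
eT-just e rewrite e = refl

Raise⇒fT : ∀ {i t t'} → Raise i t t' → fT i t ≡ just t'
Raise⇒fT {i} (raise p s refl refl pre suf) with sigScan-prefix i p (i ∷ s) pre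
... | cs , e with scan i (suc (length p)) [] (length p ∷ cs) s
...   | record { newc = newc ; scan≡ = e' ; newc# = n } =
  trans (fT-just {q = length p} {cs} (trans (cong proj₂ (trans e reads)) (trans (cong proj₂ e') (cong (_++ _) (length-0 newc (trans n suf))))))
        (cong just (setAt-++ p i (suc i) s))
  where
  reads : sigScan i (length p) [] cs (i ∷ s) ≡ sigScan i (suc (length p)) [] (length p ∷ cs) s
  reads rewrite ≡ᵇ-false (ℕP.1+n≢n {i} ∘ sym) | ≡ᵇ-refl i = refl

Raise⇒eT : ∀ {i t t'} → Raise i t t' → eT i t' ≡ just t
Raise⇒eT {i} (raise p s refl refl pre suf) with sigScan-prefix i p (suc i ∷ s) pre
... | cs , e with scan i (suc (length p)) (length p ∷ []) cs s
...   | record { new = new ; scan≡ = e' } =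
  trans (eT-just {q = length p} (trans (cong (last ∘ proj₁) (trans e (trans reads e')))
          (trans (cong (λ k → last (new ++ drop k (length p ∷ []))) suf) (last-∷ʳ new (length p)))))
        (cong just (setAt-++ p (suc i) i s))
  where
  reads : sigScan i (length p) [] cs (suc i ∷ s) ≡ sigScan i (suc (length p)) (length p ∷ []) cs s
  reads rewrite ≡ᵇ-refl i = refl

fT-[] : ∀ {i t} → proj₂ (sigScan i 0 [] [] t) ≡ [] → fT i t ≡ nothing
fT-[] e rewrite e = refl

eT-[] : ∀ {i t} → proj₁ (sigScan i 0 [] [] t) ≡ [] → eT i t ≡ nothing
eT-[] e rewrite e = refl

fT-nothing : ∀ i t → proj₂ (sigW i t) ≡ 0 → fT i t ≡ nothing
fT-nothing i t e = fT-[] {i} {t} (trans (cong proj₂ scan≡) (trans (++-identityʳ newc) (length-0 newc (trans newc# e))))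
  where open Scanned (scan i 0 [] [] t)

eT-nothing : ∀ i t → proj₁ (sigW i t) ≡ 0 → eT i t ≡ nothing
eT-nothing i t e = eT-[] {i} {t} (trans (cong proj₁ scan≡) (cong₂ _++_ (length-0 new (trans new# e)) (drop-[] (proj₂ (sigW i t)))))
  where open Scanned (scan i 0 [] [] t)

-- Without an unmatched `i + 1` of its own, `p` cannot match anything to its right.
runW : ∀ i p x o → proj₁ (sigW i p) ≡ 0 → foldr (stepW i) (x , o) p ≡ (x , proj₂ (sigW i p) + o)
runW i [] x o e = refl
runW i (y ∷ p) x o e with y ≡ᵇ suc i | y ≡ᵇ i
... | false | false = runW i p x o e
... | false | true = cong openB (runW i p x o e)
... | true | _ with sigW i p | runW i p x o
...   | _ , suc a | ih = cong closeC (ih e)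

sigW-++ : ∀ i p w → sigW i (p ++ w) ≡ foldr (stepW i) (sigW i w) p
sigW-++ i p w = foldr-++ (stepW i) (0 , 0) p w

Raise-sig : ∀ {i t t'} (Q : Raise i t t') → proj₂ (sigW i t) ≡ suc (proj₂ (sigW i (Raise.p Q)))
Raise-sig {i} (raise p s refl refl pre suf) =
  trans (cong proj₂ (trans (sigW-++ i p (i ∷ s)) (trans (cong (λ o → foldr (stepW i) o p) reads) (runW i p (proj₁ (sigW i s)) 1 pre))))
        (ℕP.+-comm _ 1)
  where
  reads : stepW i i (sigW i s) ≡ (proj₁ (sigW i s) , 1)
  reads rewrite ≡ᵇ-false (ℕP.1+n≢n {i} ∘ sym) | ≡ᵇ-refl i = cong (λ k → proj₁ (sigW i s) , suc k) suf

-- The raised letter stays unmatched after prefixing c, since otherwise c would provide an unmatched i + 1 and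
-- no letter i would remain.
Raise-++ : ∀ {i t t'} c → Raise i t t' → proj₂ (sigW i (c ++ t)) ≢ 0 →
           (∀ o → foldr (stepW i) o c ≡ o) ⊎ (∀ o → foldr (stepW i) o c ≡ openB o) ⊎ (∀ o → foldr (stepW i) o c ≡ closeC o) →
           Raise i (c ++ t) (c ++ t')
Raise-++ {i} {t} c Q n act = raise (c ++ p) q (trans (cong (c ++_) t≡) (sym (++-assoc c p _))) (trans (cong (c ++_) t′≡) (sym (++-assoc c p _)))
  (trans (cong proj₁ (sigW-++ i c p)) (go act)) suf
  where
  open Raise Q
  go : _ → proj₁ (foldr (stepW i) (sigW i p) c) ≡ 0
  go (inj₁ h) = trans (cong proj₁ (h (sigW i p))) pre
  go (inj₂ (inj₁ h)) = trans (cong proj₁ (h (sigW i p))) pre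
  go (inj₂ (inj₂ h)) = trans (cong proj₁ (h (sigW i p))) (closing (sigW i p) (Raise-sig Q) pre)
    where
    closing : ∀ o → proj₂ (sigW i t) ≡ suc (proj₂ o) → proj₁ o ≡ 0 → proj₁ (closeC o) ≡ 0
    closing (x , suc a) e e' = e'
    closing (x , zero) e e' = ⊥-elim (n (trans (cong proj₂ (trans (sigW-++ i c t) (h (sigW i t)))) (closed (sigW i t) e)))
      where
      closed : ∀ o → proj₂ o ≡ 1 → proj₂ (closeC o) ≡ 0
      closed (_ , .1) refl = refl

-- Iterated insertion: recording word and insertion tableau

∅ : Cells ⊤ m
∅ = Vec.replicate _ ○

wd : Vec (Cells A m) n → Word A
wd [] = []
wd (a ∷ as) = dec a ++ wd as

states : Cells ⊤ m → Vec (Cells ⊤ m) n → Vec St n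
states R [] = []
states R (a ∷ as) = state R a ∷ states (outR R a) as

outs : Cells ⊤ m → Vec (Cells ⊤ m) n → Vec (Cells ⊤ m) n
outs R [] = []
outs R (a ∷ as) = outU R a ∷ outs (outR R a) as

final : Cells ⊤ m → Vec (Cells ⊤ m) n → Cells ⊤ m
final R [] = R
final R (a ∷ as) = final (outR R a) as

OkT : Cells ⊤ m → Vec (Cells ⊤ m) n → Set
OkT R [] = ⊤
OkT R (a ∷ as) = Ok R a × state R a ≢ bth × OkT (outR R a) as

RedW-prefix : ∀ β (p q : Word A) → RedW β (p ++ q) → RedW β p
RedW-prefix β p q = RedW-mid β [] p q

RedW-suffix : ∀ β (p q : Word A) → RedW β (p ++ q) → RedW β q
RedW-suffix β p q R = RedW-mid β p q [] (subst (RedW β) (cong (p ++_) (sym (++-identityʳ q))) R)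

-- Insertion carries the row past a factor by moves, so the new row followed by the remaining
-- factors is a suffix of a reduced word, and the argument repeats.
Red⇒OkT : ∀ β R (as : Vec (Cells ⊤ m) n) → RedW β (inc R ++ wd as) → OkT R as
Red⇒OkT β R [] red = tt
Red⇒OkT β R (a ∷ as) red with Red⇒Ok β [] R a [] (RedW-prefix β (inc R ++ dec a) (wd as) (subst (RedW β) (sym (++-assoc (inc R) _ _)) red))
... | ok , nb = ok , nb [] , Red⇒OkT β (outR R a) as (RedW-suffix β (dec (outU R a)) _ (RedW-∼ β eq red))
  where
  eq : inc R ++ dec a ++ wd as ∼ dec (outU R a) ++ inc (outR R a) ++ wd as
  eq = trans∼ (∼-reflexive (sym (++-assoc (inc R) _ _)))
         (trans∼ (++ʳ∼ (wd as) (insertion-∼ R a ok (nb []))) (∼-reflexive (++-assoc (dec (outU R a)) _ _)))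

insertions-∼ : ∀ R (as : Vec (Cells ⊤ m) n) → OkT R as → inc R ++ wd as ∼ wd (outs R as) ++ inc (final R as)
insertions-∼ R [] ok = ∼-reflexive (++-identityʳ (inc R))
insertions-∼ R (a ∷ as) (ok , nb , oks) = begin
  inc R ++ dec a ++ wd as                                         ≡⟨ sym (++-assoc (inc R) _ _) ⟩
  (inc R ++ dec a) ++ wd as                                       ≈⟨ ++ʳ∼ (wd as) (insertion-∼ R a ok nb) ⟩
  (dec (outU R a) ++ inc (outR R a)) ++ wd as                     ≡⟨ ++-assoc (dec (outU R a)) _ _ ⟩
  dec (outU R a) ++ inc (outR R a) ++ wd as                       ≈⟨ ++ˡ∼ (dec (outU R a)) (insertions-∼ (outR R a) as oks) ⟩
  dec (outU R a) ++ wd (outs (outR R a) as) ++ inc (final (outR R a) as) ≡⟨ sym (++-assoc (dec (outU R a)) _ _) ⟩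
  (dec (outU R a) ++ wd (outs (outR R a) as)) ++ inc (final (outR R a) as) ∎
  where open ∼-Reasoning

inc-∅ : ∀ m → inc {m = m} ∅ ≡ []
inc-∅ zero = refl
inc-∅ (suc m) = inc-∅ m

OkT-∅ : ∀ β (as : Vec (Cells ⊤ m) n) → RedW β (wd as) → OkT ∅ as
OkT-∅ {m} β as red = Red⇒OkT β ∅ as (subst (λ w → RedW β (w ++ wd as)) (sym (inc-∅ m)) red)

-- Moving the empty row through all factors turns the word into the bumped factors followed by the
-- final row, and a prefix of a reduced word is reduced.
outs-Red : ∀ β (as : Vec (Cells ⊤ m) n) → RedW β (wd as) → RedW β (wd (outs ∅ as))
outs-Red {m} β as red = RedW-prefix β (wd (outs ∅ as)) (inc (final ∅ as)) (RedW-∼ β (insertions-∼ ∅ as (OkT-∅ β as red)) (subst (λ w → RedW β (w ++ wd as)) (sym (inc-∅ m)) red))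

size-0 : (a : Cells ⊤ m) → size a ≡ 0 → a ≡ ∅
size-0 [] e = refl
size-0 (○ ∷ a) e = cong (○ ∷_) (size-0 a e)

size-∅ : ∀ m → size {m = m} (∅ {m}) ≡ 0
size-∅ zero = refl
size-∅ (suc m) = size-∅ m

state-∅ : (a : Cells ⊤ m) → a ≡ ∅ ⊎ state ∅ a ≡ fac
state-∅ [] = inj₁ refl
state-∅ (● ∷ a) = inj₂ refl
state-∅ (○ ∷ a) with state-∅ a
... | inj₁ e = inj₁ (cong (○ ∷_) e)
... | inj₂ e = inj₂ e

outR-∅ : ∀ m → outR {m} ∅ ∅ ≡ ∅
outR-∅ zero = refl
outR-∅ (suc m) = cong (○ ∷_) (outR-∅ m)

length-wd : ∀ R (as : Vec (Cells ⊤ m) n) → length (wd (outs R as)) ≤ length (wd as)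
length-wd R [] = z≤n
length-wd R (a ∷ as) rewrite length-++ (dec (outU R a)) {wd (outs (outR R a) as)} | length-++ (dec a) {wd as}
                           | size-dec (outU R a) | size-dec a | size-outU R a =
  ℕP.+-mono-≤ (ℕP.m≤n+m (size (outU R a)) (boxU (state R a))) (length-wd (outR R a) as)

length-∷ : ∀ (a : Cells ⊤ m) (as : Vec (Cells ⊤ m) n) → length (wd (a ∷ as)) ≡ size a + length (wd as)
length-∷ a as = trans (length-++ (dec a)) (cong (_+ length (wd as)) (size-dec a))

-- The first nonempty factor lengthens the empty row and so loses a letter, while no factor gains
-- one. Hence the bound `N` can serve as fuel for `θ`.
shrink : ∀ {N} (as : Vec (Cells ⊤ m) n) → length (wd as) ≤ suc N → length (wd (outs ∅ as)) ≤ N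
shrink [] l = z≤n
shrink {m} {N = N} (a ∷ as) l with state-∅ a
... | inj₂ e = ℕ.s≤s⁻¹ (begin
  suc (length (dec (outU ∅ a) ++ wd (outs (outR ∅ a) as)))  ≡⟨ cong suc (length-∷ (outU ∅ a) (outs (outR ∅ a) as)) ⟩
  suc (size (outU ∅ a)) + length (wd (outs (outR ∅ a) as))  ≤⟨ ℕP.+-monoʳ-≤ (suc (size (outU ∅ a))) (length-wd (outR ∅ a) as) ⟩
  suc (size (outU ∅ a)) + length (wd as)                    ≡⟨ cong (_+ length (wd as)) (sym (trans (size-outU ∅ a) (cong (λ s → boxU s + size (outU ∅ a)) e))) ⟩
  size a + length (wd as)                                   ≡⟨ sym (length-∷ a as) ⟩
  length (wd (a ∷ as))                                      ≤⟨ l ⟩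
  suc N ∎)
  where open ℕP.≤-Reasoning
... | inj₁ refl = subst (_≤ N) (sym (trans (length-∷ (outU ∅ ∅) (outs (outR ∅ ∅) as))
        (cong₂ _+_ empty (cong (λ R → length (wd (outs R as))) (outR-∅ m)))))
      (shrink as (subst (_≤ suc N) (trans (length-∷ ∅ as) (cong (λ k → k + length (wd as)) (size-∅ m))) l))
  where
  empty : size (outU {m} ∅ ∅) ≡ 0
  empty = ℕP.n≤0⇒n≡0 (subst (size (outU {m} ∅ ∅) ≤_) (trans (sym (size-outU (∅ {m}) ∅)) (size-∅ m)) (ℕP.m≤n+m _ (boxU (state {m} ∅ ∅))))

-- The letters of the column given by the lengthened rows, in decreasing order, for the factors c + 1, c + 2, …
boxW : ℕ → St → List ℕ
boxW c fac = suc c ∷ []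
boxW c _ = []

col : ℕ → Vec St n → List ℕ
col c [] = []
col c (t ∷ ts) = col (suc c) ts ++ boxW c t

-- With N at least the length of as, θ N as is the column reading word of the recording tableau of as,
-- and rows N as is the insertion tableau.
θ : ℕ → Vec (Cells ⊤ m) n → List ℕ
θ zero as = []
θ (suc N) as = col 0 (states ∅ as) ++ θ N (outs ∅ as)

rows : ℕ → Vec (Cells ⊤ m) n → List (Cells ⊤ m)
rows zero as = []
rows (suc N) as = final ∅ as ∷ rows N (outs ∅ as)

data PostAt {A : Set} {m : ℕ} : {n : ℕ} → ℕ → Vec (Cells A m) n → Vec (Cells A m) n → Set where
  at    : ∀ {n j U V U' V'} {as : Vec (Cells A m) n} → Post j U V U' V' → PostAt 0 (U ∷ V ∷ as) (U' ∷ V' ∷ as)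
  there : ∀ {n k a} {as as' : Vec (Cells A m) n} → PostAt k as as' → PostAt (suc k) (a ∷ as) (a ∷ as')

sigAt : ℕ → Vec (Cells A m) n → ℕ × ℕ
sigAt zero (U ∷ V ∷ as) = sig U V
sigAt zero _ = 0 , 0
sigAt (suc k) [] = 0 , 0
sigAt (suc k) (a ∷ as) = sigAt k as

πAt : ℕ → Vec St n → ℕ × ℕ → ℕ × ℕ
πAt zero (t₁ ∷ t₂ ∷ ts) = π t₁ t₂
πAt zero _ o = o
πAt (suc k) [] o = o
πAt (suc k) (t ∷ ts) = πAt k ts

PostAt-< : ∀ {k} {as as' : Vec (Cells A m) n} → PostAt k as as' → suc k < n
PostAt-< (at P) = s≤s (s≤s z≤n)
PostAt-< (there P) = s≤s (PostAt-< P)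

PostAt-sig : ∀ {k} {as as' : Vec (Cells A m) n} → PostAt k as as' →
             ∃₂ λ x j → sigAt k as ≡ (x , suc j) × sigAt k as' ≡ (suc x , j)
PostAt-sig (at P) = _ , _ , proj₂ (Post-sig P)
PostAt-sig (there P) = PostAt-sig P

sigAt-insertion : ∀ k R (as : Vec (Cells ⊤ m) n) → OkT R as → sigAt k as ≡ πAt k (states R as) (sigAt k (outs R as))
sigAt-insertion zero R [] ok = refl
sigAt-insertion zero R (a ∷ []) ok = refl
sigAt-insertion zero R (U ∷ V ∷ as) (ok , _ , ok′ , _) = sig-insertion R U V ok ok′
sigAt-insertion (suc k) R [] ok = refl
sigAt-insertion (suc k) R (a ∷ as) (_ , _ , oks) = sigAt-insertion k (outR R a) as oks

data NoBoth : Vec St n → Set where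
  []  : NoBoth []
  _∷_ : ∀ {t} {ts : Vec St n} → t ≢ bth → NoBoth ts → NoBoth (t ∷ ts)

OkT⇒NoBoth : ∀ R (as : Vec (Cells ⊤ m) n) → OkT R as → NoBoth (states R as)
OkT⇒NoBoth R [] ok = []
OkT⇒NoBoth R (a ∷ as) (_ , nb , oks) = nb ∷ OkT⇒NoBoth (outR R a) as oks

Neutral : ℕ → List ℕ → Set
Neutral i w = ∀ o → foldr (stepW i) o w ≡ o

stepW-neutral : ∀ {i x} o → x ≢ i → x ≢ suc i → stepW i x o ≡ o
stepW-neutral {i} {x} o a b rewrite ≡ᵇ-false b | ≡ᵇ-false a = refl

Neutral-++ : ∀ {i} p q → Neutral i p → Neutral i q → Neutral i (p ++ q)
Neutral-++ {i} p q a b o = trans (foldr-++ (stepW i) o p q) (trans (cong (λ o → foldr (stepW i) o p) (b o)) (a o))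

boxW-neutral : ∀ {i c} t → suc c ≢ i → suc c ≢ suc i → Neutral i (boxW c t)
boxW-neutral row a b o = refl
boxW-neutral fac a b o = stepW-neutral o a b
boxW-neutral bth a b o = refl

col-neutral : ∀ {i c} (ts : Vec St n) → suc i ≤ c → Neutral i (col c ts)
col-neutral [] l o = refl
col-neutral {c = c} (t ∷ ts) l = Neutral-++ (col (suc c) ts) (boxW c t) (col-neutral ts (ℕP.m≤n⇒m≤1+n l))
  (boxW-neutral t (λ e → ℕP.<⇒≢ (ℕP.m≤n⇒m≤1+n l) (sym e)) (λ e → ℕP.<⇒≢ (s≤s l) (sym e)))

-- For `i = suc (c + k)` the column has at most one `i + 1` and one `i`, the former on the left, so
-- that the two cancel if both occur. Its other letters are neutral.
col-act : ∀ c k (ts : Vec St n) → suc k < n → NoBoth ts → ∀ o → foldr (stepW (suc (c + k))) o (col c ts) ≡ πAt k ts o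
col-act c zero (_ ∷ []) (s≤s ()) _ _
col-act c zero (t₁ ∷ t₂ ∷ ts) l (n₁ ∷ n₂ ∷ nb) o rewrite ℕP.+-identityʳ c =
  trans (foldr-++ (stepW (suc c)) o (col (suc (suc c)) ts ++ boxW (suc c) t₂) (boxW c t₁))
    (trans (foldr-++ (stepW (suc c)) _ (col (suc (suc c)) ts) (boxW (suc c) t₂))
      (trans (col-neutral ts ℕP.≤-refl _) (trans (cong (λ o → foldr (stepW (suc c)) o (boxW (suc c) t₂)) (first t₁ n₁)) (second t₁ t₂ n₁ n₂))))
  where
  first : ∀ t → t ≢ bth → foldr (stepW (suc c)) o (boxW c t) ≡ π t row o
  first row n = refl
  first fac n rewrite ≡ᵇ-false (ℕP.1+n≢n {c} ∘ sym) | ≡ᵇ-refl c = refl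
  first bth n = ⊥-elim (n refl)
  second : ∀ t₁ t₂ → t₁ ≢ bth → t₂ ≢ bth → foldr (stepW (suc c)) (π t₁ row o) (boxW (suc c) t₂) ≡ π t₁ t₂ o
  second bth t₂ n₁ n₂ = ⊥-elim (n₁ refl)
  second t₁ bth n₁ n₂ = ⊥-elim (n₂ refl)
  second row row n₁ n₂ = refl
  second fac row n₁ n₂ = refl
  second row fac n₁ n₂ rewrite ≡ᵇ-refl c = refl
  second fac fac n₁ n₂ rewrite ≡ᵇ-refl c = refl
col-act c (suc k) (t ∷ ts) (s≤s l) (_ ∷ nb) o rewrite ℕP.+-suc c k =
  trans (foldr-++ (stepW (suc (suc (c + k)))) o (col (suc c) ts) (boxW c t))
    (trans (cong (λ o → foldr (stepW (suc (suc (c + k)))) o (col (suc c) ts))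
             (boxW-neutral t (λ e → ℕP.<⇒≢ (s≤s (s≤s (ℕP.m≤m+n c k))) e) (λ e → ℕP.<⇒≢ (s≤s (ℕP.m≤n⇒m≤1+n (s≤s (ℕP.m≤m+n c k)))) e) o))
           (col-act (suc c) k ts l nb o))

πAt-cases : ∀ k (ts : Vec St n) → NoBoth ts → (∀ o → πAt k ts o ≡ o) ⊎ (∀ o → πAt k ts o ≡ openB o) ⊎ (∀ o → πAt k ts o ≡ closeC o)
πAt-cases zero [] _ = inj₁ λ _ → refl
πAt-cases zero (_ ∷ []) _ = inj₁ λ _ → refl
πAt-cases zero (bth ∷ _ ∷ ts) (n ∷ _) = ⊥-elim (n refl)
πAt-cases zero (row ∷ bth ∷ ts) (_ ∷ n ∷ _) = ⊥-elim (n refl)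
πAt-cases zero (fac ∷ bth ∷ ts) (_ ∷ n ∷ _) = ⊥-elim (n refl)
πAt-cases zero (row ∷ row ∷ ts) _ = inj₁ λ _ → refl
πAt-cases zero (row ∷ fac ∷ ts) _ = inj₂ (inj₂ λ _ → refl)
πAt-cases zero (fac ∷ row ∷ ts) _ = inj₂ (inj₁ λ _ → refl)
πAt-cases zero (fac ∷ fac ∷ ts) _ = inj₁ λ _ → refl
πAt-cases (suc k) [] _ = inj₁ λ _ → refl
πAt-cases (suc k) (t ∷ ts) (_ ∷ nb) = πAt-cases k ts nb

sig-∅ : ∀ m → sig {m = m} ∅ ∅ ≡ (0 , 0)
sig-∅ zero = refl
sig-∅ (suc m) = sig-∅ m

size-wd-0 : (a : Cells ⊤ m) (as : Vec (Cells ⊤ m) n) → length (wd (a ∷ as)) ≤ 0 → a ≡ ∅ × length (wd as) ≤ 0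
size-wd-0 a as l with subst (_≤ 0) (length-∷ a as) l
... | l' = size-0 a (ℕP.m+n≡0⇒m≡0 (size a) (ℕP.n≤0⇒n≡0 l')) , ℕP.≤-trans (ℕP.m≤n+m _ (size a)) l'

sigAt-0 : ∀ k (as : Vec (Cells ⊤ m) n) → length (wd as) ≤ 0 → sigAt k as ≡ (0 , 0)
sigAt-0 zero [] l = refl
sigAt-0 zero (a ∷ []) l = refl
sigAt-0 {m} zero (U ∷ V ∷ as) l with size-wd-0 U (V ∷ as) l
... | refl , l' with size-wd-0 V as l'
...   | refl , _ = sig-∅ m
sigAt-0 (suc k) [] l = refl
sigAt-0 (suc k) (a ∷ as) l = sigAt-0 k as (proj₂ (size-wd-0 a as l))

-- Both sides satisfy the same recursion: the first column acts by `πAt`, and the bumped factors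
-- supply the rest.
θ-sig : ∀ β N k (as : Vec (Cells ⊤ m) n) → RedW β (wd as) → length (wd as) ≤ N → suc k < n → sigW (suc k) (θ N as) ≡ sigAt k as
θ-sig β zero k as red l k< = sym (sigAt-0 k as l)
θ-sig β (suc N) k as red l k< =
  trans (sigW-++ (suc k) (col 0 (states ∅ as)) (θ N (outs ∅ as)))
    (trans (col-act 0 k (states ∅ as) k< (OkT⇒NoBoth ∅ as ok) _)
      (trans (cong (πAt k (states ∅ as)) (θ-sig β N k (outs ∅ as) (outs-Red β as red) (shrink as l) k<)) (sym (sigAt-insertion k ∅ as ok))))
  where ok = OkT-∅ β as red

data Raised : {n : ℕ} → ℕ → Vec St n → Vec St n → Set where
  at    : ∀ {n} {ts : Vec St n} → Raised 0 (fac ∷ row ∷ ts) (row ∷ fac ∷ ts)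
  there : ∀ {n k t} {ts ts' : Vec St n} → Raised k ts ts' → Raised (suc k) (t ∷ ts) (t ∷ ts')

col-raised : ∀ c {k} {ts ts' : Vec St n} → Raised k ts ts' →
             ∃₂ λ p q → col c ts ≡ p ++ suc (c + k) ∷ q × col c ts' ≡ p ++ suc (suc (c + k)) ∷ q ×
                        Neutral (suc (c + k)) p × Neutral (suc (c + k)) q
col-raised c (at {ts = ts}) rewrite ℕP.+-identityʳ c =
  col (suc (suc c)) ts , [] , cong (_++ suc c ∷ []) (++-identityʳ (col (suc (suc c)) ts)) , ++-identityʳ _ , col-neutral ts ℕP.≤-refl , λ _ → refl
col-raised c (there {k = k} {t} Q) with col-raised (suc c) Q
... | p , q , e , e' , a , b rewrite ℕP.+-suc c k =
  p , q ++ boxW c t , trans (cong (_++ boxW c t) e) (++-assoc p _ _) , trans (cong (_++ boxW c t) e') (++-assoc p _ _) , a ,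
  Neutral-++ q (boxW c t) b (boxW-neutral t (λ e → ℕP.<⇒≢ (s≤s (s≤s (ℕP.m≤m+n c k))) e) (λ e → ℕP.<⇒≢ (s≤s (ℕP.m≤n⇒m≤1+n (s≤s (ℕP.m≤m+n c k)))) e))

raised : ∀ {n s₁ s₂ t₁ t₂} {ts ts' : Vec St n} → s₁ ≡ fac → s₂ ≡ row → t₁ ≡ row → t₂ ≡ fac → ts ≡ ts' →
         Raised 0 (s₁ ∷ s₂ ∷ ts) (t₁ ∷ t₂ ∷ ts')
raised refl refl refl refl refl = at

PostAt-insertions : ∀ {k} R {as as' : Vec (Cells ⊤ m) n} → PostAt k as as' → OkT R as → OkT R as' →
  final R as ≡ final R as' ×
  ((Raised k (states R as) (states R as') × outs R as ≡ outs R as' × proj₂ (sigAt k (outs R as)) ≡ 0) ⊎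
   (states R as ≡ states R as' × PostAt k (outs R as) (outs R as')))
PostAt-insertions R (at {U = U} {V} {U'} {V'} {as} P) (ok , nb , ok′ , nb′ , _) (ok₁ , _ , ok₁′ , _ , _)
  with Post-insertion R P (ok , ok′) (ok₁ , ok₁′) nb nb′
... | eR , inj₁ (a , b , c , d , e , e' , o) = cong (λ R → final R as) eR , inj₁
  ( raised a b c d (cong (λ R → states R as) eR)
  , cong₂ _∷_ e (cong₂ _∷_ e' (cong (λ R → outs R as) eR)) , o )
... | eR , inj₂ (a , b , _ , P') = cong (λ R → final R as) eR , inj₂
  ( cong₂ _∷_ a (cong₂ _∷_ b (cong (λ R → states R as) eR))
  , subst (λ bs → PostAt 0 (outU R U ∷ outU (outR R U) V ∷ outs _ as) (outU R U' ∷ outU (outR R U') V' ∷ bs)) (cong (λ R → outs R as) eR) (at P') )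
PostAt-insertions R (there {a = a} P) (_ , _ , oks) (_ , _ , oks') with PostAt-insertions (outR R a) P oks oks'
... | e , inj₁ (r , o , z) = e , inj₁ (there r , cong (_ ∷_) o , z)
... | e , inj₂ (s , P') = e , inj₂ (cong (_ ∷_) s , there P')

θ-raise : ∀ β N {k} {as as' : Vec (Cells ⊤ m) n} → PostAt k as as' → RedW β (wd as) → RedW β (wd as') →
          length (wd as) ≤ N → length (wd as') ≤ N → Raise (suc k) (θ N as) (θ N as') × rows N as ≡ rows N as'
θ-raise β zero {k} {as} P red red' l l' with trans (sym (sigAt-0 k as l)) (proj₁ (proj₂ (proj₂ (PostAt-sig P))))
... | ()
θ-raise β (suc N) {k} {as} {as'} P red red' l l' with PostAt-insertions ∅ P (OkT-∅ β as red) (OkT-∅ β as' red')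
... | e , inj₁ (r , o , z) with col-raised 0 r
...   | p , q , e₁ , e₂ , a , b =
  raise p (q ++ θ N (outs ∅ as))
    (trans (cong (_++ θ N (outs ∅ as)) e₁) (++-assoc p _ _))
    (trans (cong₂ _++_ e₂ (cong (θ N) (sym o))) (++-assoc p _ _))
    (cong proj₁ (a (0 , 0)))
    (trans (cong proj₂ (trans (sigW-++ (suc k) q (θ N (outs ∅ as))) (trans (b _)
       (θ-sig β N k (outs ∅ as) (outs-Red β as red) (shrink as l) (PostAt-< P))))) z) ,
  cong₂ _∷_ e (cong (rows N) o)
θ-raise β (suc N) {k} {as} {as'} P red red' l l' | e , inj₂ (ss , P')
  with θ-raise β N P' (outs-Red β as red) (outs-Red β as' red') (shrink as l) (shrink as' l')
...   | Q , e' =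
  subst (λ ts → Raise (suc k) (θ (suc N) as) (col 0 ts ++ θ N (outs ∅ as'))) ss
    (Raise-++ (col 0 (states ∅ as)) Q nonzero act) ,
  cong₂ _∷_ e e'
  where
  nb = OkT⇒NoBoth ∅ as (OkT-∅ β as red)
  nonzero : proj₂ (sigW (suc k) (θ (suc N) as)) ≢ 0
  nonzero z with trans (sym (cong proj₂ (trans (θ-sig β (suc N) k as red l (PostAt-< P)) (proj₁ (proj₂ (proj₂ (PostAt-sig P))))))) z
  ... | ()
  act : _
  act with πAt-cases k (states ∅ as) nb
  ... | inj₁ h = inj₁ λ o → trans (col-act 0 k (states ∅ as) (PostAt-< P) nb o) (h o)
  ... | inj₂ (inj₁ h) = inj₂ (inj₁ λ o → trans (col-act 0 k (states ∅ as) (PostAt-< P) nb o) (h o))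
  ... | inj₂ (inj₂ h) = inj₂ (inj₂ λ o → trans (col-act 0 k (states ∅ as) (PostAt-< P) nb o) (h o))

insertions-injective : ∀ R R' (as as' : Vec (Cells ⊤ m) n) → final R as ≡ final R' as' → states R as ≡ states R' as' →
                       outs R as ≡ outs R' as' → R ≡ R' × as ≡ as'
insertions-injective R R' [] [] e _ _ = e , refl
insertions-injective R R' (a ∷ as) (a' ∷ as') e s o
  with insertions-injective (outR R a) (outR R' a') as as' e (cong Vec.tail s) (cong Vec.tail o)
... | eR , refl with insertion-injective R a R' a' (cong Vec.head s) (cong Vec.head o) eR
...   | refl , refl = refl , refl

boxes : Vec St n → ℕ
boxes [] = 0
boxes (t ∷ ts) = boxes ts + box t

length-col : ∀ c (ts : Vec St n) → length (col c ts) ≡ boxes ts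
length-col c [] = refl
length-col c (t ∷ ts) = trans (length-++ (col (suc c) ts)) (cong₂ _+_ (length-col (suc c) ts) (one-box t))
  where
  one-box : ∀ t → length (boxW c t) ≡ box t
  one-box row = refl
  one-box fac = refl
  one-box bth = refl

size-final : ∀ R (as : Vec (Cells ⊤ m) n) → size (final R as) ≡ boxes (states R as) + size R
size-final R [] = refl
size-final R (a ∷ as) = trans (size-final (outR R a) as)
  (trans (cong (λ k → boxes (states (outR R a) as) + k) (size-outR R a)) (sym (ℕP.+-assoc (boxes (states (outR R a) as)) _ _)))

col-range : ∀ c (ts : Vec St n) → All (λ x → suc c ≤ x × x ≤ c + n) (col c ts)
col-range c [] = []
col-range {n = suc n} c (t ∷ ts) = AllP.++⁺
  (All.map (λ {x} (l , l') → ℕP.<⇒≤ l , subst (x ≤_) (sym (ℕP.+-suc c n)) l') (col-range (suc c) ts)) (one-box t)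
  where
  one-box : ∀ t → All (λ x → suc c ≤ x × x ≤ c + suc n) (boxW c t)
  one-box row = []
  one-box fac = (ℕP.≤-refl , subst (suc c ≤_) (sym (ℕP.+-suc c n)) (s≤s (ℕP.m≤m+n c n))) ∷ []
  one-box bth = []

col-injective : ∀ c {ts ts' : Vec St n} → NoBoth ts → NoBoth ts' → col c ts ≡ col c ts' → ts ≡ ts'
col-injective c [] [] e = refl
col-injective c (_∷_ {t = row} _ nb) (_∷_ {t = row} _ nb') e =
  cong (row ∷_) (col-injective (suc c) nb nb' (trans (sym (++-identityʳ _)) (trans e (++-identityʳ _))))
col-injective c (_∷_ {t = fac} _ nb) (_∷_ {t = fac} _ nb') e =
  cong (fac ∷_) (col-injective (suc c) nb nb' (proj₁ (∷ʳ-injective _ _ e)))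
col-injective c (_∷_ {t = row} {ts} _ _) (_∷_ {t = fac} {ts'} _ _) e =
  ⊥-elim (ℕP.<-irrefl refl (proj₁ (All.lookup (col-range (suc c) ts)
    (subst (suc c ∈_) (trans (sym e) (++-identityʳ _)) (∈P.∈-++⁺ʳ (col (suc c) ts') (here refl))))))
col-injective c (_∷_ {t = fac} {ts} _ _) (_∷_ {t = row} {ts'} _ _) e =
  ⊥-elim (ℕP.<-irrefl refl (proj₁ (All.lookup (col-range (suc c) ts')
    (subst (suc c ∈_) (trans e (++-identityʳ _)) (∈P.∈-++⁺ʳ (col (suc c) ts) (here refl))))))
col-injective c (_∷_ {t = bth} n _) _ e = ⊥-elim (n refl)
col-injective c _ (_∷_ {t = bth} n _) e = ⊥-elim (n refl)

++-cancel-length : {X : Set} (p q : List X) {r t : List X} → length p ≡ length q → p ++ r ≡ q ++ t → p ≡ q × r ≡ t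
++-cancel-length [] [] l e = refl , e
++-cancel-length (x ∷ p) (y ∷ q) l e with ∷-injective e
... | refl , e' with ++-cancel-length p q (ℕP.suc-injective l) e'
...   | refl , e'' = refl , e''

empty-unique : (as as' : Vec (Cells ⊤ m) n) → length (wd as) ≤ 0 → length (wd as') ≤ 0 → as ≡ as'
empty-unique [] [] _ _ = refl
empty-unique (a ∷ as) (a' ∷ as') l l' with size-wd-0 a as l | size-wd-0 a' as' l'
... | refl , k | refl , k' = cong (∅ ∷_) (empty-unique as as' k k')

θ-injective : ∀ β N (as as' : Vec (Cells ⊤ m) n) → RedW β (wd as) → RedW β (wd as') → length (wd as) ≤ N → length (wd as') ≤ N →
              rows N as ≡ rows N as' → θ N as ≡ θ N as' → as ≡ as'
θ-injective β zero as as' _ _ l l' _ _ = empty-unique as as' l l'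
θ-injective {m} β (suc N) as as' red red' l l' er eθ =
  proj₂ (insertions-injective ∅ ∅ as as' (proj₁ (∷-injective er)) states≡ outs≡)
  where
  -- The column has as many letters as the final row, which is given; this locates the end of the
  -- first column in `θ`.
  lengths≡ : length (col 0 (states ∅ as)) ≡ length (col 0 (states ∅ as'))
  lengths≡ = trans (length-col 0 (states ∅ as)) (trans (ℕP.+-cancelʳ-≡ (size (∅ {m})) _ _
    (trans (sym (size-final ∅ as)) (trans (cong size (proj₁ (∷-injective er))) (size-final ∅ as')))) (sym (length-col 0 (states ∅ as'))))
  parts = ++-cancel-length (col 0 (states ∅ as)) (col 0 (states ∅ as')) lengths≡ eθ
  states≡ : states ∅ as ≡ states ∅ as'
  states≡ = col-injective 0 (OkT⇒NoBoth ∅ as (OkT-∅ β as red)) (OkT⇒NoBoth ∅ as' (OkT-∅ β as' red')) (proj₁ parts)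
  outs≡ : outs ∅ as ≡ outs ∅ as'
  outs≡ = θ-injective β N (outs ∅ as) (outs ∅ as') (outs-Red β as red) (outs-Red β as' red') (shrink as l) (shrink as' l')
            (proj₂ (∷-injective er)) (proj₂ parts)

θ-range : ∀ N (as : Vec (Cells ⊤ m) n) → All (λ x → 1 ≤ x × x ≤ n) (θ N as)
θ-range zero as = []
θ-range (suc N) as = AllP.++⁺ (col-range 0 (states ∅ as)) (θ-range N (outs ∅ as))

countB-++ : {X : Set} (p : X → Bool) (xs ys : List X) → countB p (xs ++ ys) ≡ countB p xs + countB p ys
countB-++ p [] ys = refl
countB-++ p (x ∷ xs) ys with p x
... | true = cong suc (countB-++ p xs ys)
... | false = countB-++ p xs ys

countB-none : {X : Set} (p : X → Bool) {xs : List X} → All (λ x → p x ≡ false) xs → countB p xs ≡ 0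
countB-none p [] = refl
countB-none p (e ∷ a) rewrite e = countB-none p a

col-count : ∀ c (ts : Vec St n) j → countB (λ x → x ≡ᵇ suc (c + toℕ j)) (col c ts) ≡ box (Vec.lookup ts j)
col-count c (t ∷ ts) Fin.zero rewrite ℕP.+-identityʳ c = trans (countB-++ _ (col (suc c) ts) (boxW c t))
  (cong₂ _+_ (countB-none _ (All.map (λ (l , _) → ≡ᵇ-false (λ e → ℕP.<⇒≢ l (sym e))) (col-range (suc c) ts))) (one-box t))
  where
  one-box : ∀ t → countB (λ x → x ≡ᵇ suc c) (boxW c t) ≡ box t
  one-box row = refl
  one-box fac rewrite ≡ᵇ-refl c = refl
  one-box bth = refl
col-count c (t ∷ ts) (Fin.suc j) rewrite ℕP.+-suc c (toℕ j) = trans (countB-++ _ (col (suc c) ts) (boxW c t))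
  (trans (cong₂ _+_ (col-count (suc c) ts j) (no-box t)) (ℕP.+-identityʳ _))
  where
  no-box : ∀ t → countB (λ x → x ≡ᵇ suc (suc (c + toℕ j))) (boxW c t) ≡ 0
  no-box row = refl
  no-box fac rewrite ≡ᵇ-false (ℕP.<⇒≢ (s≤s (ℕP.m≤m+n c (toℕ j)))) = refl
  no-box bth = refl

size-lookup : ∀ R (as : Vec (Cells ⊤ m) n) → OkT R as → ∀ j →
              box (Vec.lookup (states R as) j) + size (Vec.lookup (outs R as) j) ≡ size (Vec.lookup as j)
size-lookup R (a ∷ as) (_ , nb , _) Fin.zero = trans (cong (_+ size (outU R a)) (box≡ (state R a) nb)) (sym (size-outU R a))
  where
  box≡ : ∀ t → t ≢ bth → box t ≡ boxU t
  box≡ row n = refl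
  box≡ fac n = refl
  box≡ bth n = ⊥-elim (n refl)
size-lookup R (a ∷ as) (_ , _ , oks) (Fin.suc j) = size-lookup (outR R a) as oks j

θ-count : ∀ β N (as : Vec (Cells ⊤ m) n) → RedW β (wd as) → length (wd as) ≤ N → ∀ j →
          countB (λ x → x ≡ᵇ suc (toℕ j)) (θ N as) ≡ size (Vec.lookup as j)
θ-count {m} β zero as red l j = sym (ℕP.n≤0⇒n≡0 (empty as l j))
  where
  empty : ∀ {n} (as : Vec (Cells ⊤ m) n) → length (wd as) ≤ 0 → ∀ j → size (Vec.lookup as j) ≤ 0
  empty (a ∷ as) l Fin.zero with size-wd-0 a as l
  ... | refl , _ = ℕP.≤-reflexive (size-∅ m)
  empty (a ∷ as) l (Fin.suc j) = empty as (proj₂ (size-wd-0 a as l)) j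
θ-count β (suc N) as red l j = trans (countB-++ _ (col 0 (states ∅ as)) (θ N (outs ∅ as)))
  (trans (cong₂ _+_ (col-count 0 (states ∅ as) j) (θ-count β N (outs ∅ as) (outs-Red β as red) (shrink as l) j))
         (size-lookup ∅ as (OkT-∅ β as red) j))

-- Crystals realised by words

module Connected {X : Set} (_≟_ : DecidableEquality X) (n : ℕ) (P : X → Set) (f : ℕ → X → Maybe X) where

  data Conn : X → X → Set where
    edge   : ∀ {i x y} → 1 ≤ i → i < n → P x → f i x ≡ just y → Conn x y
    refl~  : ∀ {x} → Conn x x
    sym~   : ∀ {x y} → Conn x y → Conn y x
    trans~ : ∀ {x y z} → Conn x y → Conn y z → Conn x z

  -- The representative of a class after identifying the two ends of every edge in the list.
  merge : List (X × X) → X → X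
  merge [] z = z
  merge ((x , y) ∷ es) z = if ⌊ merge es z ≟ merge es y ⌋ then merge es x else merge es z

  merge-sound : ∀ es → (∀ {x y} → (x , y) ∈ es → Conn x y) → ∀ z → Conn (merge es z) z
  merge-sound [] h z = refl~
  merge-sound ((x , y) ∷ es) h z with merge es z ≟ merge es y
  ... | no _ = merge-sound es (h ∘ there) z
  ... | yes e = trans~ (merge-sound es (h ∘ there) x) (trans~ (h (here refl))
                  (trans~ (sym~ (merge-sound es (h ∘ there) y)) (subst (λ r → Conn r z) e (merge-sound es (h ∘ there) z))))

  merge-complete : ∀ es {x y} → (x , y) ∈ es → merge es x ≡ merge es y
  merge-complete ((x , y) ∷ es) (here refl) with merge es x ≟ merge es y | merge es y ≟ merge es y
  ... | yes _ | yes _ = refl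
  ... | no _ | yes _ = refl
  ... | _ | no n = ⊥-elim (n refl)
  merge-complete ((x₁ , y₁) ∷ es) {x} {y} (there i) rewrite merge-complete es i = refl

  edgesOf : X → Maybe X → List (X × X)
  edgesOf x nothing = []
  edgesOf x (just y) = (x , y) ∷ []

  edges : List X → List (X × X)
  edges xs = concat (map (λ x → concat (map (λ j → edgesOf x (f (suc j) x)) (upTo (n ∸ 1)))) xs)

  ∈-edgesOf : ∀ x o {e} → e ∈ edgesOf x o → ∃ λ y → e ≡ (x , y) × o ≡ just y
  ∈-edgesOf x (just y) (here refl) = y , refl , refl

  edges-sound : ∀ xs → (∀ {x} → x ∈ xs → P x) → ∀ {x y} → (x , y) ∈ edges xs → Conn x y
  edges-sound xs h i with ∈P.∈-concat⁻′ (map _ xs) i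
  ... | l , i₁ , i₂ with ∈P.∈-map⁻ _ i₂
  ...   | x , x∈ , refl with ∈P.∈-concat⁻′ (map _ (upTo (n ∸ 1))) i₁
  ...     | l' , i₃ , i₄ with ∈P.∈-map⁻ _ i₄
  ...       | j , j∈ , refl with ∈-edgesOf x (f (suc j) x) i₃
  ...         | y , refl , e = edge (s≤s z≤n) (ℕP.<-≤-trans (s≤s (∈P.∈-upTo⁻ j∈)) (ℕP.≤-reflexive (ℕP.m+[n∸m]≡n {1} {n} (positive j∈)))) (h x∈) e
    where
    positive : ∀ {n j} → j ∈ upTo (n ∸ 1) → 1 ≤ n
    positive {suc n} _ = s≤s z≤n

  edges-complete : ∀ xs {i x y} → 1 ≤ i → i < n → x ∈ xs → f i x ≡ just y → (x , y) ∈ edges xs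
  edges-complete xs {suc j} {x} {y} _ (s≤s l) x∈ e =
    ∈P.∈-concat⁺′ (∈P.∈-concat⁺′ (subst (λ o → (x , y) ∈ edgesOf x o) (sym e) (here refl))
      (∈P.∈-map⁺ (λ j → edgesOf x (f (suc j) x)) (∈P.∈-upTo⁺ l))) (∈P.∈-map⁺ _ x∈)

Unique-lookup : {X : Set} {xs : List X} → Unique xs → ∀ {i j} → lookup xs i ≡ lookup xs j → i ≡ j
Unique-lookup (a ∷ u) {Fin.zero} {Fin.zero} e = refl
Unique-lookup (a ∷ u) {Fin.zero} {Fin.suc j} e = ⊥-elim (All.lookup a (∈P.∈-lookup j) e)
Unique-lookup (a ∷ u) {Fin.suc i} {Fin.zero} e = ⊥-elim (All.lookup a (∈P.∈-lookup i) (sym e))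
Unique-lookup (a ∷ u) {Fin.suc i} {Fin.suc j} e = cong Fin.suc (Unique-lookup u e)

-- `τ` has to separate only the elements of one component. Components with equal words are told
-- apart by their tag, the index of the representative computed by `merge`, whose word is the root.
normal-crystal : {X : Set} (_≟_ : DecidableEquality X) (n : ℕ) (P : X → Set) (wt : X → Vec ℕ n) (e f : ℕ → X → Maybe X)
  (xs : List X) → (∀ {x} → x ∈ xs → P x) → (∀ {x} → P x → x ∈ xs) → ∃ P →
  (τ : X → List ℕ) → (∀ {x} → P x → All (λ k → 1 ≤ k × k ≤ n) (τ x)) → (∀ {x} → P x → wtT n (τ x) ≡ wt x) →
  (∀ {i x y} → 1 ≤ i → i < n → P x → f i x ≡ just y → P y × e i y ≡ just x × fT i (τ x) ≡ just (τ y)) →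
  (∀ {i x y} → 1 ≤ i → i < n → P x → e i x ≡ just y → P y × f i y ≡ just x × eT i (τ x) ≡ just (τ y)) →
  (∀ {i x} → 1 ≤ i → i < n → P x → f i x ≡ nothing → fT i (τ x) ≡ nothing) →
  (∀ {i x} → 1 ≤ i → i < n → P x → e i x ≡ nothing → eT i (τ x) ≡ nothing) →
  (∀ {x y} → P x → P y → Connected.Conn _≟_ n P f x y → τ x ≡ τ y → x ≡ y) →
  IsNormalCrystal n P wt e f
normal-crystal {X} _≟_ n P wt e f xs xs⊆P P⊆xs (x₀ , Px₀) τ range weight f-just e-just f-nothing e-nothing inj = record
  { K = length reps
  ; roots = λ k → τ (lookup reps k)
  ; roots-in-range = λ k → range (P-rep k)
  ; ψ = ψ
  ; ψ-into = λ x Px → subst (λ r → Reach n (τ r) (τ x)) (sym (lookup-idx Px)) (proj₁ (reach-conn (c-conn x) (P-c Px)) here)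
  ; ψ-injective = λ x y Px Py eq → inj Px Py
      (trans~ (sym~ (c-conn x)) (subst (λ r → Conn r y) (sym (trans (sym (lookup-idx Px))
        (trans (cong (lookup reps ∘ proj₁) eq) (lookup-idx Py)))) (c-conn y))) (cong proj₂ eq)
  ; ψ-surjective = surj
  ; ψ-wt = λ x Px → weight Px
  ; ψ-e = λ i l l' x Px → compat-e l l' Px
  ; ψ-f = λ i l l' x Px → compat-f l l' Px }
  where
  open Connected _≟_ n P f
  es = edges xs
  c = merge es
  c-conn : ∀ z → Conn (c z) z
  c-conn = merge-sound es (edges-sound xs xs⊆P)
  c-const : ∀ {x y} → Conn x y → c x ≡ c y
  c-const (edge l l' Px e) = merge-complete es (edges-complete xs l l' (P⊆xs Px) e)
  c-const refl~ = refl
  c-const (sym~ h) = sym (c-const h)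
  c-const (trans~ h h') = trans (c-const h) (c-const h')
  P-conn : ∀ {x y} → Conn x y → (P x → P y) × (P y → P x)
  P-conn (edge l l' Px e) = (λ _ → proj₁ (f-just l l' Px e)) , λ _ → Px
  P-conn refl~ = (λ p → p) , λ p → p
  P-conn (sym~ h) = proj₂ (P-conn h) , proj₁ (P-conn h)
  P-conn (trans~ h h') = proj₁ (P-conn h') ∘ proj₁ (P-conn h) , proj₂ (P-conn h) ∘ proj₂ (P-conn h')
  P-c : ∀ {x} → P x → P (c x)
  P-c {x} = proj₂ (P-conn (c-conn x))
  reach-conn : ∀ {t x y} → Conn x y → P x → (Reach n t (τ x) → Reach n t (τ y)) × (Reach n t (τ y) → Reach n t (τ x))
  reach-conn (edge l l' _ e) Px with f-just l l' Px e
  ... | Py , e' , eT≡ = (λ r → viaF _ l l' r eT≡) , λ r → viaE _ l l' r (proj₂ (proj₂ (e-just l l' Py e')))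
  reach-conn refl~ Px = (λ r → r) , λ r → r
  reach-conn (sym~ h) Px with reach-conn h (proj₂ (P-conn h) Px)
  ... | a , b = b , a
  reach-conn (trans~ h h') Px with reach-conn h Px | reach-conn h' (proj₁ (P-conn h) Px)
  ... | a , b | a' , b' = a' ∘ a , b ∘ b'
  reps = deduplicate _≟_ (map c xs)
  c∈reps : ∀ {x} → P x → c x ∈ reps
  c∈reps Px = ∈P.∈-deduplicate⁺ _≟_ (∈P.∈-map⁺ c (P⊆xs Px))
  idx : X → Fin (length reps)
  idx r with Any.any? (r ≟_) reps
  ... | yes i = Any.index i
  -- An arbitrary value outside `P`; the given `x₀` provides an index.
  ... | no _ = Any.index (c∈reps Px₀)
  lookup-idx′ : ∀ {r} → r ∈ reps → lookup reps (idx r) ≡ r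
  lookup-idx′ {r} i with Any.any? (r ≟_) reps
  ... | yes i = sym (AnyP.lookup-index i)
  ... | no n = ⊥-elim (n i)
  lookup-idx : ∀ {x} → P x → lookup reps (idx (c x)) ≡ c x
  lookup-idx Px = lookup-idx′ (c∈reps Px)
  ψ : X → Fin (length reps) × List ℕ
  ψ x = idx (c x) , τ x
  rep : ∀ k → ∃ λ z → P z × lookup reps k ≡ c z
  rep k with ∈P.∈-map⁻ c (∈P.∈-deduplicate⁻ _≟_ (map c xs) (∈P.∈-lookup {xs = reps} k))
  ... | z , z∈ , e = z , xs⊆P z∈ , e
  P-rep : ∀ k → P (lookup reps k)
  P-rep k with rep k
  ... | z , Pz , e = subst P (sym e) (P-c Pz)
  c-rep : ∀ k → c (lookup reps k) ≡ lookup reps k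
  c-rep k with rep k
  ... | z , Pz , e = trans (cong c e) (trans (c-const (c-conn z)) (sym e))
  -- A path of words is lifted edge by edge: an operator that vanishes on an element of `P` vanishes
  -- on its word, so a defined step on the word comes from a step in `P`.
  lift : ∀ {r t} → P r → Reach n (τ r) t → ∃ λ x → P x × Conn r x × τ x ≡ t
  lift Pr here = _ , Pr , refl~ , refl
  lift Pr (viaE i l l' R eq) with lift Pr R
  ... | x , Px , h , refl with e i x in ex
  ...   | nothing with trans (sym eq) (e-nothing l l' Px ex)
  ...     | ()
  lift Pr (viaE i l l' R eq) | x , Px , h , refl | just y with e-just l l' Px ex
  ... | Py , fy , eq' = y , Py , trans~ h (sym~ (edge l l' Py fy)) , just-injective (trans (sym eq') eq)
  lift Pr (viaF i l l' R eq) with lift Pr R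
  ... | x , Px , h , refl with f i x in fx
  ...   | nothing with trans (sym eq) (f-nothing l l' Px fx)
  ...     | ()
  lift Pr (viaF i l l' R eq) | x , Px , h , refl | just y with f-just l l' Px fx
  ... | Py , _ , eq' = y , Py , trans~ h (edge l l' Px fx) , just-injective (trans (sym eq') eq)
  surj : ∀ k t → Reach n (τ (lookup reps k)) t → ∃ λ x → P x × ψ x ≡ (k , t)
  surj k t R with lift (P-rep k) R
  ... | x , Px , h , e = x , Px , cong₂ _,_ (Unique-lookup (UniqueP.deduplicate-! _≟_ (map c xs))
      (trans (lookup-idx Px) (trans (sym (c-const h)) (c-rep k)))) e
  compat-e : ∀ {i x} → 1 ≤ i → i < n → P x → Compat P ψ (e i x) (onComp eT i (ψ x))
  compat-e {i} {x} l l' Px with e i x in ex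
  ... | nothing rewrite e-nothing l l' Px ex = tt
  ... | just y with e-just l l' Px ex
  ...   | Py , fy , eq rewrite eq = Py , cong (λ r → idx r , τ y) (c-const (edge l l' Py fy))
  compat-f : ∀ {i x} → 1 ≤ i → i < n → P x → Compat P ψ (f i x) (onComp fT i (ψ x))
  compat-f {i} {x} l l' Px with f i x in fx
  ... | nothing rewrite f-nothing l l' Px fx = tt
  ... | just y with f-just l l' Px fx
  ...   | Py , _ , eq rewrite eq = Py , cong (λ r → idx r , τ y) (sym (c-const (edge l l' Px fx)))

-- Independence of the operators from the labels

cmap : (A → B) → Cells A m → Cells B m
cmap g = Vec.map (Maybe.map g)

relabel : (A → B) → Word A → Word B
relabel g = map (λ x → proj₁ x , g (proj₂ x))

dec-cmap : (g : A → B) (U : Cells A m) → dec (cmap g U) ≡ relabel g (dec U)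
dec-cmap g [] = refl
dec-cmap g (nothing ∷ U) = dec-cmap g U
dec-cmap g (just a ∷ U) = cong (_ ∷_) (dec-cmap g U)

wd-cmap : (g : A → B) (as : Vec (Cells A m) n) → wd (Vec.map (cmap g) as) ≡ relabel g (wd as)
wd-cmap g [] = refl
wd-cmap g (a ∷ as) = trans (cong₂ _++_ (dec-cmap g a) (wd-cmap g as)) (sym (map-++ _ (dec a) (wd as)))

vals-cmap : ∀ β (g : A → B) (as : Vec (Cells A m) n) → vals β (wd (Vec.map (cmap g) as)) ≡ vals β (wd as)
vals-cmap β g as = trans (cong (vals β) (wd-cmap g as)) (sym (map-∘ (wd as)))

sig-cmap : (g : A → B) (U V : Cells A m) → sig (cmap g U) (cmap g V) ≡ sig U V
sig-cmap g [] [] = refl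
sig-cmap g (nothing ∷ U) (nothing ∷ V) = sig-cmap g U V
sig-cmap g (just a ∷ U) (nothing ∷ V) = cong openB (sig-cmap g U V)
sig-cmap g (nothing ∷ U) (just c ∷ V) = cong closeC (sig-cmap g U V)
sig-cmap g (just a ∷ U) (just c ∷ V) = cong (openB ∘ closeC) (sig-cmap g U V)

sigAt-cmap : ∀ (g : A → B) k (as : Vec (Cells A m) n) → sigAt k (Vec.map (cmap g) as) ≡ sigAt k as
sigAt-cmap g zero [] = refl
sigAt-cmap g zero (a ∷ []) = refl
sigAt-cmap g zero (U ∷ V ∷ as) = sig-cmap g U V
sigAt-cmap g (suc k) [] = refl
sigAt-cmap g (suc k) (a ∷ as) = sigAt-cmap g k as

Closed-cmap : (g : A → B) (U V : Cells A m) → Closed U V → Closed (cmap g U) (cmap g V)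
Closed-cmap g U V o = trans (cong proj₂ (sig-cmap g U V)) o

Mid-cmap : ∀ (g : A → B) {d b e} {U V U' V' : Cells A m} → Mid d b e U V U' V' →
           Mid (g d) (g b) (g e) (cmap g U) (cmap g V) (cmap g U') (cmap g V')
Mid-cmap g (start {U = U} {V} o) = start (Closed-cmap g U V o)
Mid-cmap g (step M) = step (Mid-cmap g M)

Post-cmap : ∀ (g : A → B) {j} {U V U' V' : Cells A m} → Post j U V U' V' →
            Post j (cmap g U) (cmap g V) (cmap g U') (cmap g V')
Post-cmap g (one {U = U} {V} o) = one (Closed-cmap g U V o)
Post-cmap g (top M) = top (Mid-cmap g M)
Post-cmap g (skip P) = skip (Post-cmap g P)
Post-cmap g (opens P) = opens (Post-cmap g P)
Post-cmap g (close P) = close (Post-cmap g P)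
Post-cmap g (both P) = both (Post-cmap g P)

PostAt-cmap : ∀ (g : A → B) {k} {as as' : Vec (Cells A m) n} → PostAt k as as' → PostAt k (Vec.map (cmap g) as) (Vec.map (cmap g) as')
PostAt-cmap g (at P) = at (Post-cmap g P)
PostAt-cmap g (there P) = there (PostAt-cmap g P)

PostAt⇒∼ : ∀ {k} {as as' : Vec (Cells A m) n} → PostAt k as as' → wd as ∼ wd as'
PostAt⇒∼ (at {U = U} {V} {U'} {V'} {as} P) = trans∼ (∼-reflexive (sym (++-assoc (dec U) (dec V) (wd as))))
  (trans∼ (++ʳ∼ (wd as) (Post⇒∼ P)) (∼-reflexive (++-assoc (dec U') (dec V') (wd as))))
PostAt⇒∼ (there {a = a} P) = ++ˡ∼ (dec a) (PostAt⇒∼ P)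

fAt : ∀ β k p (as : Vec (Cells A m) n) → RedW β (p ++ wd as) → proj₂ (sigAt k as) ≡ 0 ⊎ ∃ (PostAt k as)
fAt β zero p [] red = inj₁ refl
fAt β zero p (a ∷ []) red = inj₁ refl
fAt β zero p (U ∷ V ∷ as) red with f-total β p (wd as) U V (subst (λ w → RedW β (p ++ w)) (sym (++-assoc (dec U) (dec V) (wd as))) red)
... | inj₁ o = inj₁ o
... | inj₂ (_ , _ , _ , P) = inj₂ (_ , at P)
fAt β (suc k) p [] red = inj₁ refl
fAt β (suc k) p (a ∷ as) red with fAt β k (p ++ dec a) as (subst (RedW β) (sym (++-assoc p (dec a) (wd as))) red)
... | inj₁ o = inj₁ o
... | inj₂ (_ , P) = inj₂ (_ , there P)

eAt : ∀ β k p (as : Vec (Cells A m) n) → RedW β (p ++ wd as) → proj₁ (sigAt k as) ≡ 0 ⊎ ∃ λ as' → PostAt k as' as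
eAt β zero p [] red = inj₁ refl
eAt β zero p (a ∷ []) red = inj₁ refl
eAt β zero p (U ∷ V ∷ as) red with e-total β p (wd as) U V (subst (λ w → RedW β (p ++ w)) (sym (++-assoc (dec U) (dec V) (wd as))) red)
... | inj₁ o = inj₁ o
... | inj₂ (_ , _ , _ , P) = inj₂ (_ , at P)
eAt β (suc k) p [] red = inj₁ refl
eAt β (suc k) p (a ∷ as) red with eAt β k (p ++ dec a) as (subst (RedW β) (sym (++-assoc p (dec a) (wd as))) red)
... | inj₁ o = inj₁ o
... | inj₂ (_ , P) = inj₂ (_ , there P)

-- Tuples of primed words and vectors of cells

module _ (β : ℤ) where

  tup : Vec (Cells Bool m) n → Tuple n
  tup = Vec.map (λ U → emb β (dec U))

  word-tup : (as : Vec (Cells Bool m) n) → word (tup as) ≡ emb β (wd as)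
  word-tup [] = refl
  word-tup (a ∷ as) = trans (cong (emb β (dec a) ++_) (word-tup as)) (sym (map-++ _ (dec a) (wd as)))

  ⌈word-tup⌉ : (as : Vec (Cells Bool m) n) → map ⌈_⌉ (word (tup as)) ≡ vals β (wd as)
  ⌈word-tup⌉ as = trans (cong (map ⌈_⌉) (word-tup as)) (⌈emb⌉ β (wd as))

  f-lift : ∀ {k} {as as' : Vec (Cells Bool m) n} → PostAt k as as' → liftPair fPair k (tup as) ≡ just (tup as')
  f-lift (at {as = as} P) = cong (Maybe.map (λ uv → proj₁ uv ∷ proj₂ uv ∷ tup as)) (fPair-post β P)
  f-lift (there {a = a} P) = cong (Maybe.map (emb β (dec a) ∷_)) (f-lift P)

  e-lift : ∀ {k} {as as' : Vec (Cells Bool m) n} → PostAt k as as' → liftPair ePair k (tup as') ≡ just (tup as)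
  e-lift (at {as = as} P) = cong (Maybe.map (λ uv → proj₁ uv ∷ proj₂ uv ∷ tup as)) (ePair-post β P)
  e-lift (there {a = a} P) = cong (Maybe.map (emb β (dec a) ∷_)) (e-lift P)

  f-lift-none : ∀ k (as : Vec (Cells Bool m) n) → proj₂ (sigAt k as) ≡ 0 → liftPair fPair k (tup as) ≡ nothing
  f-lift-none zero [] o = refl
  f-lift-none zero (a ∷ []) o = refl
  f-lift-none zero (U ∷ V ∷ as) o = cong (Maybe.map _) (fPair-closed β U V o)
  f-lift-none (suc k) [] o = refl
  f-lift-none (suc k) (a ∷ as) o = cong (Maybe.map _) (f-lift-none k as o)

  e-lift-none : ∀ k (as : Vec (Cells Bool m) n) → proj₁ (sigAt k as) ≡ 0 → liftPair ePair k (tup as) ≡ nothing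
  e-lift-none zero [] o = refl
  e-lift-none zero (a ∷ []) o = refl
  e-lift-none zero (U ∷ V ∷ as) o = cong (Maybe.map _) (ePair-closed β U V o)
  e-lift-none (suc k) [] o = refl
  e-lift-none (suc k) (a ∷ as) o = cong (Maybe.map _) (e-lift-none k as o)

  Descends : List Letter → Set
  Descends = Linked (λ x y → ⌈ y ⌉ ℤ.< ⌈ x ⌉)

  dec-descends : (U : Cells Bool m) → Descends (emb β (dec U))
  dec-descends [] = []
  dec-descends (nothing ∷ U) = dec-descends U
  dec-descends (just a ∷ U) with dec U | dec-< U | dec-descends U
  ... | [] | _ | _ = [-]
  ... | x ∷ w | l ∷ _ | d = val-< β l ∷ d

  Descends⇒StrictlyDecreasing : ∀ {l} → Descends l → StrictlyDecreasing l
  Descends⇒StrictlyDecreasing [] = []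
  Descends⇒StrictlyDecreasing [-] = [-]
  Descends⇒StrictlyDecreasing (_∷_ {x} {y} l d) = key-mono (proj₂ y) (proj₂ x) l ∷ Descends⇒StrictlyDecreasing d

  tup-descends : (as : Vec (Cells Bool m) n) → VecAll.All Descends (tup as)
  tup-descends [] = VecAll.[]
  tup-descends (a ∷ as) = dec-descends a VecAll.∷ tup-descends as

  -- The order on primed letters allows `k` to be followed by `k'`, but the unprimed word then has a
  -- square. Reducedness thus gives strict descent of the underlying integers.
  decreasing-word : ∀ w → StrictlyDecreasing (emb β w) → RedW β w → Linked (λ x y → proj₁ y < proj₁ x) w
  decreasing-word [] _ _ = []
  decreasing-word (x ∷ []) _ _ = [-]
  decreasing-word (x ∷ y ∷ w) (l ∷ d) red with ℕP.<-cmp (proj₁ y) (proj₁ x)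
  ... | tri< a _ _ = a ∷ decreasing-word (y ∷ w) d (RedW-suffix β (x ∷ []) (y ∷ w) red)
  ... | tri≈ _ refl _ = ⊥-elim (¬RedW-square β {A = Bool} [] {proj₁ x} {proj₂ x} {proj₂ y} w red)
  ... | tri> _ _ a = ⊥-elim (ℤP.<-asym l (key-mono (proj₂ x) (proj₂ y) (val-< β a)))

  cells : ∀ m (w : Word A) → AllPairs (λ x y → proj₁ y < proj₁ x) w → Below m w → ∃ λ (U : Cells A m) → dec U ≡ w
  cells zero [] _ _ = [] , refl
  cells zero (x ∷ w) _ (() ∷ _)
  cells (suc m) [] _ _ with cells m [] [] []
  ... | U , e = nothing ∷ U , e
  cells (suc m) ((k , p) ∷ w) (a ∷ d) (l ∷ b) with k ℕ.≟ m
  ... | yes refl with cells m w d a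
  ...   | U , e = just p ∷ U , cong ((m , p) ∷_) e
  cells (suc m) ((k , p) ∷ w) (a ∷ d) (l ∷ b) | no k≢m with ℕP.≤∧≢⇒< (ℕ.s≤s⁻¹ l) k≢m
  ...   | k<m with cells m ((k , p) ∷ w) (a ∷ d) (k<m ∷ All.map (λ l' → ℕP.<-trans l' k<m) a)
  ...     | U , e = nothing ∷ U , e

  -- The cells are read off the letters and not off a chosen code, so that the word assigned to a
  -- tuple is defined on all tuples.
  occupied : ∀ m → List ℤ → Cells ⊤ m
  occupied zero l = []
  occupied (suc m) l = (if memℤ (val β m) l then ● else ○) ∷ occupied m l

  shape : Cells A m → Cells ⊤ m
  shape = cmap (λ _ → tt)

  occupied-dec : ∀ hi (U : Cells Bool m) → From m hi → occupied m (map ⌈_⌉ (emb β (hi ++ dec U))) ≡ shape U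
  occupied-dec hi [] a = refl
  occupied-dec {m = suc m} hi (nothing ∷ U) a
    rewrite memℤ-false β {m} (hi ++ dec U) (AllP.++⁺ (All.map (λ l e → ℕP.<⇒≢ l (sym e)) a) (All.map ℕP.<⇒≢ (dec-< U))) =
    cong (○ ∷_) (occupied-dec hi U (All.map ℕP.<⇒≤ a))
  occupied-dec {m = suc m} hi (just b ∷ U) a
    rewrite memℤ-true β {m} (hi ++ (m , b) ∷ dec U) (subst (m ∈_) (sym (map-++ proj₁ hi _)) (∈P.∈-++⁺ʳ (map proj₁ hi) (here refl))) =
    cong (● ∷_) (trans (cong (λ w → occupied m (map ⌈_⌉ (emb β w))) (sym (++-assoc hi ((m , b) ∷ []) (dec U))))
      (occupied-dec (hi ++ (m , b) ∷ []) U (AllP.++⁺ (All.map ℕP.<⇒≤ a) (ℕP.≤-refl ∷ []))))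

  shapes : ∀ m → Tuple n → Vec (Cells ⊤ m) n
  shapes m = Vec.map (λ l → occupied m (map ⌈_⌉ l))

  shapes-tup : (as : Vec (Cells Bool m) n) → shapes m (tup as) ≡ Vec.map shape as
  shapes-tup [] = refl
  shapes-tup (a ∷ as) = cong₂ _∷_ (occupied-dec [] a []) (shapes-tup as)

size-shape : ∀ (g : A → B) (U : Cells A m) → size (cmap g U) ≡ size U
size-shape g [] = refl
size-shape g (nothing ∷ U) = size-shape g U
size-shape g (just a ∷ U) = cong suc (size-shape g U)

-- A crude bound `b` for the letters of `u`. By `Red-support` it bounds the letters of every reduced
-- word of `perm u`, so the `2b + 1` values from `-b` to `b` form one window for all factorizations.
radius : List ℤ → ℕ
radius [] = 0
radius (x ∷ u) = ℤ.∣ x ∣ + radius u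

∈⇒≤radius : ∀ {x} u → x ∈ u → ℤ.∣ x ∣ ≤ radius u
∈⇒≤radius (x ∷ u) (here refl) = ℕP.m≤m+n _ _
∈⇒≤radius (x ∷ u) (there i) = ℕP.≤-trans (∈⇒≤radius u i) (ℕP.m≤n+m _ _)

in-window : ∀ b v → ℤ.∣ v ∣ ≤ b → ∃ λ k → k < suc (b + b) × v ≡ val (ℤ.- (+ b)) k
in-window b (+ a) l = b + a , s≤s (ℕP.+-monoʳ-≤ b l) ,
  sym (trans (sym (ℤP.+-assoc (ℤ.- (+ b)) (+ b) (+ a))) (trans (cong (ℤ._+ (+ a)) (ℤP.+-inverseˡ (+ b))) (ℤP.+-identityˡ (+ a))))
in-window b ℤ.-[1+ a ] l = b ∸ suc a , s≤s (ℕP.≤-trans (ℕP.m∸n≤m b (suc a)) (ℕP.m≤m+n b b)) , sym (begin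
  ℤ.- (+ b) ℤ.+ (+ (b ∸ suc a))              ≡⟨ cong (λ i → ℤ.- (+ b) ℤ.+ i) (sym (ℤP.⊖-≥ l)) ⟩
  ℤ.- (+ b) ℤ.+ (b ℤ.⊖ suc a)                ≡⟨ cong (λ i → ℤ.- (+ b) ℤ.+ i) (sym (ℤP.m-n≡m⊖n b (suc a))) ⟩
  ℤ.- (+ b) ℤ.+ ((+ b) ℤ.- (+ suc a))        ≡⟨ sym (ℤP.+-assoc (ℤ.- (+ b)) (+ b) (ℤ.- (+ suc a))) ⟩
  (ℤ.- (+ b) ℤ.+ (+ b)) ℤ.- (+ suc a)        ≡⟨ cong (ℤ._- (+ suc a)) (ℤP.+-inverseˡ (+ b)) ⟩
  0ℤ ℤ.- (+ suc a)                           ≡⟨ ℤP.+-identityˡ _ ⟩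
  ℤ.-[1+ a ] ∎)
  where open ≡-Reasoning

window-word : ∀ b (l : List Letter) → All (λ x → ℤ.∣ ⌈ x ⌉ ∣ ≤ b) l →
              ∃ λ w → emb (ℤ.- (+ b)) w ≡ l × All (λ x → proj₁ x < suc (b + b)) w
window-word b [] [] = [] , refl , []
window-word b ((v , p) ∷ l) (h ∷ a) with in-window b v h | window-word b l a
... | k , k< , refl | w , refl , w< = (k , p) ∷ w , refl , k< ∷ w<

_≟ₚ_ : DecidableEquality (ℤ × ℤ)
_≟ₚ_ = ProductP.≡-dec ℤ._≟_ ℤ._≟_

open import Data.List.Membership.DecPropositional _≟ₚ_ using () renaming (_∈?_ to _∈ₚ?_)

-- Primes and marked pairs

marked⊆crossings : ∀ l {q} → q ∈ marked l → q ∈ crossings (map ⌈_⌉ l)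
marked⊆crossings ((k , true) ∷ l) (here e) = here e
marked⊆crossings ((k , true) ∷ l) (there i) = there (marked⊆crossings l i)
marked⊆crossings ((k , false) ∷ l) i = there (marked⊆crossings l i)

Red-tail : ∀ c cs → Red (c ∷ cs) → Red cs
Red-tail c cs R = Red-mid (c ∷ []) cs [] (subst (λ w → Red (c ∷ w)) (sym (++-identityʳ cs)) R)

-- A reduced word crosses each pair only once, so its primes are determined by the marked pairs.
marked-determines : ∀ l l' → map ⌈_⌉ l ≡ map ⌈_⌉ l' → Red (map ⌈_⌉ l) →
                    (∀ {q} → q ∈ marked l → q ∈ marked l') → (∀ {q} → q ∈ marked l' → q ∈ marked l) → l ≡ l'
marked-determines [] [] _ _ _ _ = refl
marked-determines ((k , p) ∷ l) ((k' , p') ∷ l') e R f g with ∷-injective e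
... | refl , e' = same p p' f g
  where
  new : ¬ (perm (reverse (map ⌈_⌉ l)) k , perm (reverse (map ⌈_⌉ l)) (k ℤ.+ 1ℤ)) ∈ marked l
  new i = Red⇒crossing-new k (map ⌈_⌉ l) R (marked⊆crossings l i)
  new' : ¬ (perm (reverse (map ⌈_⌉ l')) k , perm (reverse (map ⌈_⌉ l')) (k ℤ.+ 1ℤ)) ∈ marked l'
  new' i = Red⇒crossing-new k (map ⌈_⌉ l') (subst (λ w → Red (k ∷ w)) e' R) (marked⊆crossings l' i)
  tails : (∀ {q} → q ∈ marked l → q ∈ marked l') → (∀ {q} → q ∈ marked l' → q ∈ marked l) → l ≡ l'
  tails = marked-determines l l' e' (Red-tail k (map ⌈_⌉ l) R)
  same : ∀ p p' → (∀ {q} → q ∈ marked ((k , p) ∷ l) → q ∈ marked ((k , p') ∷ l')) →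
         (∀ {q} → q ∈ marked ((k , p') ∷ l') → q ∈ marked ((k , p) ∷ l)) → (k , p) ∷ l ≡ (k , p') ∷ l'
  same false false f g = cong (_ ∷_) (tails f g)
  same true true f g = cong (_ ∷_) (tails f' g')
    where
    f' : ∀ {q} → q ∈ marked l → q ∈ marked l'
    f' i with f (there i)
    ... | there j = j
    ... | here refl = ⊥-elim (new (subst (λ w → (perm (reverse w) k , perm (reverse w) (k ℤ.+ 1ℤ)) ∈ marked l) (sym e') i))
    g' : ∀ {q} → q ∈ marked l' → q ∈ marked l
    g' i with g (there i)
    ... | there j = j
    ... | here refl = ⊥-elim (new' (subst (λ w → (perm (reverse w) k , perm (reverse w) (k ℤ.+ 1ℤ)) ∈ marked l') e' i))
  same true false f g = ⊥-elim (new' (subst (λ w → (perm (reverse w) k , perm (reverse w) (k ℤ.+ 1ℤ)) ∈ marked l') e' (f (here refl))))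
  same false true f g = ⊥-elim (new (subst (λ w → (perm (reverse w) k , perm (reverse w) (k ℤ.+ 1ℤ)) ∈ marked l) (sym e') (g (here refl))))

word-unique : (x y : Tuple n) → Vec.map length x ≡ Vec.map length y → word x ≡ word y → x ≡ y
word-unique [] [] _ _ = refl
word-unique (a ∷ x) (b ∷ y) el ew with ++-cancel-length a b (cong Vec.head el) ew
... | refl , e = cong (a ∷_) (word-unique x y (cong Vec.tail el) e)

word-map : ∀ g (x : Tuple n) → word (Vec.map (map g) x) ≡ map g (word x)
word-map g [] = refl
word-map g (a ∷ x) = trans (cong (map g a ++_) (word-map g x)) (sym (map-++ g a (word x)))

bare : Letter → Letter
bare x = ⌈ x ⌉ , false

⌈bare⌉ : ∀ l → map ⌈_⌉ (map bare l) ≡ map ⌈_⌉ l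
⌈bare⌉ l = sym (map-∘ l)

marked-bare : ∀ l → marked (map bare l) ≡ []
marked-bare [] = refl
marked-bare (x ∷ l) = marked-bare l

unmarked⇒bare : ∀ l → (∀ {q} → ¬ q ∈ marked l) → map bare l ≡ l
unmarked⇒bare [] h = refl
unmarked⇒bare ((k , false) ∷ l) h = cong (_ ∷_) (unmarked⇒bare l h)
unmarked⇒bare ((k , true) ∷ l) h = ⊥-elim (h (here refl))

⌈word-unprime⌉ : (x : Tuple n) → map ⌈_⌉ (word (unprime x)) ≡ map ⌈_⌉ (word x)
⌈word-unprime⌉ x = trans (cong (map ⌈_⌉) (word-map bare x)) (⌈bare⌉ (word x))

length-unprime : (x : Tuple n) → Vec.map length (unprime x) ≡ Vec.map length x
length-unprime [] = refl
length-unprime (a ∷ x) = cong₂ _∷_ (length-map bare a) (length-unprime x)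

unprime-tup : ∀ β (as : Vec (Cells Bool m) n) → unprime (tup β as) ≡ tup β (Vec.map (cmap (λ _ → false)) as)
unprime-tup β [] = refl
unprime-tup β (a ∷ as) = cong₂ _∷_
  (trans (sym (map-∘ (dec a))) (trans (map-∘ (dec a)) (cong (emb β) (sym (dec-cmap (λ _ → false) a))))) (unprime-tup β as)

module Priming (A : List (ℤ × ℤ)) where

  crossing : ℤ → List ℤ → ℤ × ℤ
  crossing k cs = perm (reverse cs) k , perm (reverse cs) (k ℤ.+ 1ℤ)

  -- `cs` lists the letters of the later factors: the pair crossed by a letter depends on everything
  -- to its right.
  primeWord : List ℤ → List Letter → List Letter
  primeWord cs [] = []
  primeWord cs ((k , _) ∷ l) = (k , ⌊ crossing k (map ⌈_⌉ l ++ cs) ∈ₚ? A ⌋) ∷ primeWord cs l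

  prime : Tuple n → Tuple n
  prime [] = []
  prime (a ∷ x) = primeWord (map ⌈_⌉ (word x)) a ∷ prime x

  ⌈primeWord⌉ : ∀ cs l → map ⌈_⌉ (primeWord cs l) ≡ map ⌈_⌉ l
  ⌈primeWord⌉ cs [] = refl
  ⌈primeWord⌉ cs (x ∷ l) = cong (_ ∷_) (⌈primeWord⌉ cs l)

  primeWord-++ : ∀ l r → primeWord [] (l ++ r) ≡ primeWord (map ⌈_⌉ r) l ++ primeWord [] r
  primeWord-++ [] r = refl
  primeWord-++ ((k , _) ∷ l) r = cong₂ _∷_
    (cong (λ cs → k , ⌊ crossing k cs ∈ₚ? A ⌋) (trans (++-identityʳ _) (map-++ ⌈_⌉ l r))) (primeWord-++ l r)

  word-prime : (x : Tuple n) → word (prime x) ≡ primeWord [] (word x)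
  word-prime [] = refl
  word-prime (a ∷ x) = trans (cong (primeWord (map ⌈_⌉ (word x)) a ++_) (word-prime x)) (sym (primeWord-++ a (word x)))

  length-prime : (x : Tuple n) → Vec.map length (prime x) ≡ Vec.map length x
  length-prime [] = refl
  length-prime (a ∷ x) = cong₂ _∷_
    (trans (sym (length-map ⌈_⌉ (primeWord (map ⌈_⌉ (word x)) a))) (trans (cong length (⌈primeWord⌉ (map ⌈_⌉ (word x)) a)) (length-map ⌈_⌉ a))) (length-prime x)

  bare-primeWord : ∀ cs l → map bare (primeWord cs l) ≡ map bare l
  bare-primeWord cs [] = refl
  bare-primeWord cs (x ∷ l) = cong (_ ∷_) (bare-primeWord cs l)

  prime-descends : ∀ {x : Tuple n} β → VecAll.All (Descends β) x → VecAll.All (Descends β) (prime x)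
  prime-descends β VecAll.[] = VecAll.[]
  prime-descends {x = a ∷ x} β (d VecAll.∷ ds) =
    LinkedP.map⁻ (subst (Linked _) (sym (⌈primeWord⌉ (map ⌈_⌉ (word x)) a)) (LinkedP.map⁺ d)) VecAll.∷ prime-descends β ds

  private
    ⌈tail⌉ : ∀ l → map ⌈_⌉ (primeWord [] l) ≡ map ⌈_⌉ l ++ []
    ⌈tail⌉ l = trans (⌈primeWord⌉ [] l) (sym (++-identityʳ _))

  marked-prime⇒∈ : ∀ l {q} → q ∈ marked (primeWord [] l) → q ∈ A
  marked-prime⇒∈ ((k , _) ∷ l) i with crossing k (map ⌈_⌉ l ++ []) ∈ₚ? A
  ... | no _ = marked-prime⇒∈ l i
  marked-prime⇒∈ ((k , _) ∷ l) (here refl) | yes h = subst (λ cs → crossing k cs ∈ A) (sym (⌈tail⌉ l)) h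
  marked-prime⇒∈ ((k , _) ∷ l) (there i) | yes h = marked-prime⇒∈ l i

  ∈⇒marked-prime : ∀ l {q} → q ∈ crossings (map ⌈_⌉ l) → q ∈ A → q ∈ marked (primeWord [] l)
  ∈⇒marked-prime ((k , _) ∷ l) i h with crossing k (map ⌈_⌉ l ++ []) ∈ₚ? A
  ∈⇒marked-prime ((k , _) ∷ l) (here refl) h | no n = ⊥-elim (n (subst (λ cs → crossing k cs ∈ A) (sym (++-identityʳ (map ⌈_⌉ l))) h))
  ∈⇒marked-prime ((k , _) ∷ l) (there i) h | no n = ∈⇒marked-prime l i h
  ∈⇒marked-prime ((k , _) ∷ l) (here refl) h | yes _ = here (cong (crossing k) (sym (⌈primeWord⌉ [] l)))
  ∈⇒marked-prime ((k , _) ∷ l) (there i) h | yes _ = there (∈⇒marked-prime l i h)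

-- Decidability and enumeration

perm-fixes : ∀ {x} cs → ¬ x ∈ cs → ¬ x ∈ map (ℤ._+ 1ℤ) cs → perm cs x ≡ x
perm-fixes [] _ _ = refl
perm-fixes (c ∷ cs) a b rewrite perm-fixes cs (a ∘ there) (b ∘ there) = s-off (a ∘ here) (b ∘ here)

-- Both permutations fix every integer that is neither a letter nor the successor of a letter, so
-- finitely many values decide.
_≗ₚ?_ : ∀ cs ds → Dec (cs ≗ₚ ds)
cs ≗ₚ? ds with All.all? (λ x → perm cs x ℤ.≟ perm ds x) ((cs ++ map (ℤ._+ 1ℤ) cs) ++ (ds ++ map (ℤ._+ 1ℤ) ds))
... | no n = no λ h → n (All.tabulate λ {x} _ → h x)
... | yes a = yes h
  where
  h : cs ≗ₚ ds
  h x with x ∈ℤ? ((cs ++ map (ℤ._+ 1ℤ) cs) ++ (ds ++ map (ℤ._+ 1ℤ) ds))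
  ... | yes i = All.lookup a i
  ... | no n = trans (perm-fixes cs (n ∘ ∈P.∈-++⁺ˡ ∘ ∈P.∈-++⁺ˡ) (n ∘ ∈P.∈-++⁺ˡ ∘ ∈P.∈-++⁺ʳ cs))
      (sym (perm-fixes ds (n ∘ ∈P.∈-++⁺ʳ (cs ++ map (ℤ._+ 1ℤ) cs) ∘ ∈P.∈-++⁺ˡ) (n ∘ ∈P.∈-++⁺ʳ (cs ++ map (ℤ._+ 1ℤ) cs) ∘ ∈P.∈-++⁺ʳ ds)))

allVec : {X : Set} → List X → (n : ℕ) → List (Vec X n)
allVec xs zero = [] ∷ []
allVec xs (suc n) = concat (map (λ x → map (x ∷_) (allVec xs n)) xs)

∈-allVec : {X : Set} {xs : List X} → (∀ x → x ∈ xs) → (v : Vec X n) → v ∈ allVec xs n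
∈-allVec h [] = here refl
∈-allVec h (x ∷ v) = ∈P.∈-concat⁺′ (∈P.∈-map⁺ (x ∷_) (∈-allVec h v)) (∈P.∈-map⁺ _ (h x))

cell∈ : (x : Maybe Bool) → x ∈ nothing ∷ just true ∷ just false ∷ []
cell∈ nothing = here refl
cell∈ (just true) = there (here refl)
cell∈ (just false) = there (there (here refl))

lengths-tup : ∀ β (as : Vec (Cells Bool m) n) → Vec.map length (tup β as) ≡ Vec.map size (Vec.map (shape β) as)
lengths-tup β [] = refl
lengths-tup β (a ∷ as) = cong₂ _∷_ (trans (length-map _ (dec a)) (trans (size-dec a) (sym (size-shape (λ _ → tt) a)))) (lengths-tup β as)

-- The crystals of factorizations of a fixed permutation

module Factorizations (u : List ℤ) (n : ℕ) where

  private
    b = radius u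
    β = ℤ.- (+ b)
    M = suc (b + b)
    -- The length of `u` bounds that of every reduced word of `perm u`, so `N` rounds of insertion
    -- exhaust each factorization.
    N = length u

  IsReducedWord⇒Red : ∀ cs → IsReducedWord (perm u) cs → Red cs
  IsReducedWord⇒Red cs (e , R) ds h = R ds λ x → trans (h x) (e x)

  record Coded (x : Tuple n) : Set where
    field
      as    : Vec (Cells Bool M) n
      x≡    : x ≡ tup β as
      red   : RedW β (wd as)
      value : vals β (wd as) ≗ₚ u

  factor-cells : ∀ {n} (x : Tuple n) p → VecAll.All StrictlyDecreasing x → Red (p ++ map ⌈_⌉ (word x)) →
                 All (λ v → ℤ.∣ v ∣ ≤ b) (map ⌈_⌉ (word x)) → ∃ λ (as : Vec (Cells Bool M) n) → x ≡ tup β as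
  factor-cells [] p _ _ _ = [] , refl
  factor-cells (l ∷ x) p (d VecAll.∷ ds) R a
    with window-word b l (AllP.map⁻ (AllP.++⁻ˡ (map ⌈_⌉ l) (subst (All _) (map-++ ⌈_⌉ l (word x)) a)))
  ... | w , refl , w< with cells β M w (Linked⇒AllPairs (λ l l' → ℕP.<-trans l' l)
          (decreasing-word β w d (subst Red (⌈emb⌉ β w) (Red-mid p _ (map ⌈_⌉ (word x)) (subst (λ v → Red (p ++ v)) (map-++ ⌈_⌉ l (word x)) R))))) w<
  ...   | U , refl with factor-cells x (p ++ map ⌈_⌉ l) ds
            (subst Red (trans (cong (p ++_) (map-++ ⌈_⌉ l (word x))) (sym (++-assoc p _ _))) R)
            (AllP.++⁻ʳ (map ⌈_⌉ l) (subst (All _) (map-++ ⌈_⌉ l (word x)) a))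
  ...     | as , refl = U ∷ as , refl

  code : ∀ {x} → RFplus n (perm u) x → Coded x
  code {x} (d , r@(e , _)) with factor-cells x [] d R (All.tabulate λ i → ∈⇒≤radius u (Red-support R e i))
    where R = IsReducedWord⇒Red (map ⌈_⌉ (word x)) r
  ... | as , refl = record { as = as ; x≡ = refl ; red = subst Red (⌈word-tup⌉ β as) (IsReducedWord⇒Red (map ⌈_⌉ (word (tup β as))) r)
                           ; value = λ y → trans (cong (λ w → perm w y) (sym (⌈word-tup⌉ β as))) (e y) }

  isReducedWord : ∀ cs → Red cs → cs ≗ₚ u → IsReducedWord (perm u) cs
  isReducedWord cs R e = e , λ ds h → R ds λ x → trans (h x) (sym (e x))

  RFplus-tup : ∀ (as : Vec (Cells Bool M) n) → RedW β (wd as) → vals β (wd as) ≗ₚ u → RFplus n (perm u) (tup β as)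
  RFplus-tup as R e = VecAll.map (Descends⇒StrictlyDecreasing β) (tup-descends β as) ,
    subst (IsReducedWord (perm u)) (sym (⌈word-tup⌉ β as)) (isReducedWord (vals β (wd as)) R e)

  -- The common form of a step of f and of a step of e read backwards, with both ends coded in the
  -- same window.
  record Edge (k : ℕ) (x y : Tuple n) : Set where
    field
      {as as'} : Vec (Cells Bool M) n
      x≡   : x ≡ tup β as
      y≡   : y ≡ tup β as'
      red  : RedW β (wd as)
      red′ : RedW β (wd as')
      rf   : RFplus n (perm u) x
      rf′  : RFplus n (perm u) y
      step′ : PostAt k as as'

  f-edge : ∀ {k x y} → RFplus n (perm u) x → fRF n (suc k) x ≡ just y → Edge k x y
  f-edge {k} h e with code h
  ... | record { as = as ; x≡ = refl ; red = R ; value = v } with fAt β k [] as R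
  ...   | inj₁ o with trans (sym e) (f-lift-none β k as o)
  ...     | ()
  f-edge {k} h e | record { as = as ; x≡ = refl ; red = R ; value = v } | inj₂ (as' , P)
    with just-injective (trans (sym e) (f-lift β P))
  ... | refl = record { x≡ = refl ; y≡ = refl ; red = R ; red′ = R' ; rf = h ; rf′ = RFplus-tup as' R' v' ; step′ = P }
    where
    R' = RedW-∼ β (PostAt⇒∼ P) R
    v' : vals β (wd as') ≗ₚ u
    v' x = trans (sym (∼-perm β (PostAt⇒∼ P) x)) (v x)

  e-edge : ∀ {k x y} → RFplus n (perm u) x → eRF n (suc k) x ≡ just y → Edge k y x
  e-edge {k} h e with code h
  ... | record { as = as ; x≡ = refl ; red = R ; value = v } with eAt β k [] as R
  ...   | inj₁ o with trans (sym e) (e-lift-none β k as o)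
  ...     | ()
  e-edge {k} h e | record { as = as ; x≡ = refl ; red = R ; value = v } | inj₂ (as' , P)
    with just-injective (trans (sym e) (e-lift β P))
  ... | refl = record { x≡ = refl ; y≡ = refl ; red = R' ; red′ = R ; rf = RFplus-tup as' R' v' ; rf′ = h ; step′ = P }
    where
    R' = RedW-∼ β (sym∼ (PostAt⇒∼ P)) R
    v' : vals β (wd as') ≗ₚ u
    v' x = trans (∼-perm β (PostAt⇒∼ P) x) (v x)

  τ : Tuple n → List ℕ
  τ x = θ N (shapes β M x)

  shaped : Vec (Cells Bool M) n → Vec (Cells ⊤ M) n
  shaped = Vec.map (shape β)

  red-shaped : ∀ {as} → RedW β (wd as) → RedW β (wd (shaped as))
  red-shaped {as} = subst Red (sym (vals-cmap β (λ _ → tt) as))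

  length-shaped : ∀ as → RFplus n (perm u) (tup β as) → length (wd (shaped as)) ≤ N
  length-shaped as (_ , _ , R) = subst (_≤ N)
    (trans (cong length (trans (⌈word-tup⌉ β as) (sym (vals-cmap β (λ _ → tt) as)))) (length-map _ (wd (shaped as)))) (R u λ _ → refl)

  Edge-raise : ∀ {k x y} → Edge k x y → Raise (suc k) (τ x) (τ y) × rows N (shapes β M x) ≡ rows N (shapes β M y)
  Edge-raise {k} record { as = as ; as' = as' ; x≡ = refl ; y≡ = refl ; red = R ; red′ = R' ; rf = h ; rf′ = h' ; step′ = P } =
    subst₂ (λ X Y → Raise (suc k) (θ N X) (θ N Y) × rows N X ≡ rows N Y) (sym (shapes-tup β as)) (sym (shapes-tup β as'))
      (θ-raise β N (PostAt-cmap (λ _ → tt) P) (red-shaped {as} R) (red-shaped {as'} R') (length-shaped as h) (length-shaped as' h'))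

  Edge-marked : ∀ {k x y} → Edge k x y → marked (word x) ↭ marked (word y)
  Edge-marked record { as = as ; as' = as' ; x≡ = refl ; y≡ = refl ; step′ = P } =
    subst₂ (λ X Y → marked X ↭ marked Y) (sym (word-tup β as)) (sym (word-tup β as')) (∼-marked β (PostAt⇒∼ P))

  Edge-e : ∀ {k x y} → Edge k x y → eRF n (suc k) y ≡ just x
  Edge-e record { x≡ = refl ; y≡ = refl ; step′ = P } = e-lift β P

  Edge-f : ∀ {k x y} → Edge k x y → fRF n (suc k) x ≡ just y
  Edge-f record { x≡ = refl ; y≡ = refl ; step′ = P } = f-lift β P

  sig-τ : ∀ {k} as → RFplus n (perm u) (tup β as) → RedW β (wd as) → suc k < n → sigW (suc k) (τ (tup β as)) ≡ sigAt k as
  sig-τ {k} as h R l = trans (cong (λ X → sigW (suc k) (θ N X)) (shapes-tup β as))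
    (trans (θ-sig β N k (shaped as) (red-shaped {as} R) (length-shaped as h) l) (sigAt-cmap (λ _ → tt) k as))

  f-stop : ∀ {k x} → suc k < n → RFplus n (perm u) x → fRF n (suc k) x ≡ nothing → fT (suc k) (τ x) ≡ nothing
  f-stop {k} l h e with code h
  ... | record { as = as ; x≡ = refl ; red = R } with fAt β k [] as R
  ...   | inj₁ o = fT-nothing (suc k) _ (trans (cong proj₂ (sig-τ as h R l)) o)
  ...   | inj₂ (_ , P) with trans (sym e) (f-lift β P)
  ...     | ()

  e-stop : ∀ {k x} → suc k < n → RFplus n (perm u) x → eRF n (suc k) x ≡ nothing → eT (suc k) (τ x) ≡ nothing
  e-stop {k} l h e with code h
  ... | record { as = as ; x≡ = refl ; red = R } with eAt β k [] as R
  ...   | inj₁ o = eT-nothing (suc k) _ (trans (cong proj₁ (sig-τ as h R l)) o)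
  ...   | inj₂ (_ , P) with trans (sym e) (e-lift β P)
  ...     | ()

  τ-weight : ∀ {x} → RFplus n (perm u) x → wtT n (τ x) ≡ wtRF n x
  τ-weight h with code h
  ... | record { as = as ; x≡ = refl ; red = R } = trans (VecP.tabulate-cong count) (VecP.tabulate∘lookup (Vec.map length (tup β as)))
    where
    count : ∀ j → countB (λ x → x ≡ᵇ suc (toℕ j)) (τ (tup β as)) ≡ Vec.lookup (Vec.map length (tup β as)) j
    count j = trans (cong (λ X → countB _ (θ N X)) (shapes-tup β as))
      (trans (θ-count β N (shaped as) (red-shaped {as} R) (length-shaped as h) j)
        (sym (trans (cong (λ X → Vec.lookup X j) (lengths-tup β as)) (VecP.lookup-map j size (shaped as)))))

  τ-injective : ∀ {x y} → RFplus n (perm u) x → RFplus n (perm u) y → τ x ≡ τ y →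
                rows N (shapes β M x) ≡ rows N (shapes β M y) → marked (word x) ↭ marked (word y) → x ≡ y
  τ-injective h h' eτ er em with code h | code h'
  ... | record { as = as ; x≡ = refl ; red = R } | record { as = bs ; x≡ = refl ; red = R' } =
    word-unique (tup β as) (tup β bs) (trans (lengths-tup β as) (trans (cong (Vec.map size) same) (sym (lengths-tup β bs))))
      (marked-determines _ _ letters (subst Red (sym (⌈word-tup⌉ β as)) R) (↭P.∈-resp-↭ em) (↭P.∈-resp-↭ (↭.↭-sym em)))
    where
    same : shaped as ≡ shaped bs
    same = θ-injective β N (shaped as) (shaped bs) (red-shaped {as} R) (red-shaped {bs} R') (length-shaped as h) (length-shaped bs h')
      (subst₂ (λ X Y → rows N X ≡ rows N Y) (shapes-tup β as) (shapes-tup β bs) er)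
      (subst₂ (λ X Y → θ N X ≡ θ N Y) (shapes-tup β as) (shapes-tup β bs) eτ)
    letters : map ⌈_⌉ (word (tup β as)) ≡ map ⌈_⌉ (word (tup β bs))
    letters = trans (⌈word-tup⌉ β as) (trans (sym (vals-cmap β (λ _ → tt) as))
      (trans (cong (λ X → vals β (wd X)) same) (trans (vals-cmap β (λ _ → tt) bs) (sym (⌈word-tup⌉ β bs)))))

  -- Minimality quantifies over all words. The given factorization has the minimal length, so a
  -- comparison with it settles the matter.
  RFplus? : ∀ {x₀} → RFplus n (perm u) x₀ → ∀ x → Dec (RFplus n (perm u) x)
  RFplus? {x₀} (_ , e₀ , R₀) x = VecAll.all? (Linked.linked? λ x y → key y ℤ.<? key x) x ×-dec reduced?
    where
    reduced? : Dec (IsReducedWord (perm u) (map ⌈_⌉ (word x)))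
    reduced? = map′ (λ (e , l) → e , λ ds h → ℕP.≤-trans l (R₀ ds h)) (λ (e , R) → e , R (map ⌈_⌉ (word x₀)) e₀)
      ((map ⌈_⌉ (word x) ≗ₚ? u) ×-dec (length (map ⌈_⌉ (word x)) ℕ.≤? length (map ⌈_⌉ (word x₀))))

  _≟ₜ_ : DecidableEquality (Tuple n)
  _≟ₜ_ = VecP.≡-dec (ListP.≡-dec (ProductP.≡-dec ℤ._≟_ BoolP._≟_))

  -- Covers both sets of the theorem: a step only permutes the marked pairs, so a condition on them
  -- is kept along each component.
  normal : (P : Tuple n → Set) → (∀ {x} → P x → RFplus n (perm u) x) →
           (∀ {x y} → RFplus n (perm u) y → marked (word x) ↭ marked (word y) → P x → P y) →
           (∀ x → RFplus n (perm u) x → Dec (P x)) → ∃ P → IsNormalCrystal n P (wtRF n) (eRF n) (fRF n)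
  normal P P⇒RF resp P? (x₀ , Px₀) = normal-crystal _≟ₜ_ n P (wtRF n) (eRF n) (fRF n)
    (filter Q? candidates) (λ i → proj₂ (∈P.∈-filter⁻ Q? {xs = candidates} i)) (λ Px → ∈P.∈-filter⁺ Q? (candidate (P⇒RF Px)) Px) (x₀ , Px₀)
    τ (λ _ → θ-range N _) (τ-weight ∘ P⇒RF)
    (λ { {suc k} _ _ Px e → let E = f-edge {k} (P⇒RF Px) e in
           resp (Edge.rf′ E) (Edge-marked E) Px , Edge-e E , Raise⇒fT (proj₁ (Edge-raise E)) })
    (λ { {suc k} _ _ Px e → let E = e-edge {k} (P⇒RF Px) e in
           resp (Edge.rf E) (↭.↭-sym (Edge-marked E)) Px , Edge-f E , Raise⇒eT (proj₁ (Edge-raise E)) })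
    (λ { {suc k} _ l Px → f-stop l (P⇒RF Px) }) (λ { {suc k} _ l Px → e-stop l (P⇒RF Px) })
    (λ Px Py h e → τ-injective (P⇒RF Px) (P⇒RF Py) e (proj₁ (invariants h)) (proj₂ (invariants h)))
    where
    open Connected _≟ₜ_ n P (fRF n)
    -- All fillings of the window, each cell empty, primed or unprimed: a finite list that contains
    -- every factorization.
    candidates = map (tup β) (allVec (allVec (nothing ∷ just true ∷ just false ∷ []) M) n)
    candidate : ∀ {x} → RFplus n (perm u) x → x ∈ candidates
    candidate h with code h
    ... | record { as = as ; x≡ = refl } = ∈P.∈-map⁺ (tup β) (∈-allVec (∈-allVec cell∈) as)
    Q? : ∀ x → Dec (P x)
    Q? x with RFplus? (P⇒RF Px₀) x
    ... | yes h = P? x h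
    ... | no ¬h = no (¬h ∘ P⇒RF)
    invariants : ∀ {x y} → Conn x y → rows N (shapes β M x) ≡ rows N (shapes β M y) × marked (word x) ↭ marked (word y)
    invariants (edge {suc k} _ _ Px e) = let E = f-edge {k} (P⇒RF Px) e in proj₂ (Edge-raise E) , Edge-marked E
    invariants refl~ = refl , ↭.refl
    invariants (sym~ h) = sym (proj₁ (invariants h)) , ↭.↭-sym (proj₂ (invariants h))
    invariants (trans~ h h') = trans (proj₁ (invariants h)) (proj₁ (invariants h')) , ↭.trans (proj₂ (invariants h)) (proj₂ (invariants h'))

  unprime-RFplus : ∀ {x} → RFplus n (perm u) x → RFplus n (perm u) (unprime x)
  unprime-RFplus {x} h@(_ , r) with code h
  ... | record { as = as ; x≡ = refl } =
    subst (VecAll.All StrictlyDecreasing) (sym (unprime-tup β as))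
      (VecAll.map (Descends⇒StrictlyDecreasing β) (tup-descends β (Vec.map (cmap (λ _ → false)) as))) ,
    subst (IsReducedWord (perm u)) (sym (⌈word-unprime⌉ (tup β as))) r

  unprime-f : ∀ {k x} → RFplus n (perm u) x → Maybe.map unprime (fRF n (suc k) x) ≡ fRF n (suc k) (unprime x)
  unprime-f {k} h with code h
  ... | record { as = as ; x≡ = refl ; red = R } with fAt β k [] as R
  ...   | inj₁ o rewrite f-lift-none β k as o | unprime-tup β as =
    sym (f-lift-none β k _ (trans (cong proj₂ (sigAt-cmap (λ _ → false) k as)) o))
  ...   | inj₂ (as' , P) rewrite f-lift β P | unprime-tup β as | unprime-tup β as' = sym (f-lift β (PostAt-cmap (λ _ → false) P))

  unprime-e : ∀ {k x} → RFplus n (perm u) x → Maybe.map unprime (eRF n (suc k) x) ≡ eRF n (suc k) (unprime x)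
  unprime-e {k} h with code h
  ... | record { as = as ; x≡ = refl ; red = R } with eAt β k [] as R
  ...   | inj₁ o rewrite e-lift-none β k as o | unprime-tup β as =
    sym (e-lift-none β k _ (trans (cong proj₁ (sigAt-cmap (λ _ → false) k as)) o))
  ...   | inj₂ (as' , P) rewrite e-lift β P | unprime-tup β as | unprime-tup β as' = sym (e-lift β (PostAt-cmap (λ _ → false) P))

  module _ (A : List (ℤ × ℤ)) (A⊆Inv : All (λ p → p ∈Inv perm u) A) where
    open Priming A

    unprime-injective : ∀ {x y} → RFplusA n (perm u) A x → RFplusA n (perm u) A y → unprime x ≡ unprime y → x ≡ y
    unprime-injective {x} {y} ((_ , r) , a) (_ , a') e = word-unique x y
      (trans (sym (length-unprime x)) (trans (cong (Vec.map length) e) (length-unprime y)))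
      (marked-determines (word x) (word y)
        (trans (sym (⌈word-unprime⌉ x)) (trans (cong (map ⌈_⌉ ∘ word) e) (⌈word-unprime⌉ y))) (IsReducedWord⇒Red (map ⌈_⌉ (word x)) r)
        (λ {q} i → Equivalence.from (a' q) (Equivalence.to (a q) i)) (λ {q} i → Equivalence.from (a q) (Equivalence.to (a' q) i)))

    unprime-surjective : ∀ {y} → RF n (perm u) y → ∃ λ x → RFplusA n (perm u) A x × unprime x ≡ y
    unprime-surjective {y} (h@(_ , r) , a) with code h
    ... | record { as = bs ; x≡ = refl } = prime y ,
      ((VecAll.map (Descends⇒StrictlyDecreasing β) (prime-descends β (tup-descends β bs)) ,
        subst (IsReducedWord (perm u)) (sym ⌈word-prime⌉) r) ,
       λ q → mk⇔ (λ i → marked-prime⇒∈ (word y) (subst (λ w → q ∈ marked w) (word-prime y) i))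
                 (λ i → subst (λ w → q ∈ marked w) (sym (word-prime y)) (∈⇒marked-prime (word y) (crossed i) i))) ,
      word-unique (unprime (prime y)) y (trans (length-unprime (prime y)) (length-prime y))
        (trans (word-map bare (prime y)) (trans (cong (map bare) (word-prime y)) (trans (bare-primeWord [] (word y)) (unmarked⇒bare (word y) unmarked))))
      where
      ⌈word-prime⌉ : map ⌈_⌉ (word (prime y)) ≡ map ⌈_⌉ (word y)
      ⌈word-prime⌉ = trans (cong (map ⌈_⌉) (word-prime y)) (⌈primeWord⌉ [] (word y))
      -- Every word of a permutation crosses all its inversions, so each pair of `A` belongs to a
      -- letter that can be primed.
      crossed : ∀ {q} → q ∈ A → q ∈ crossings (map ⌈_⌉ (word y))
      crossed {q} i with All.lookup A⊆Inv i
      ... | l , l' = inversion⇒crossing (map ⌈_⌉ (word y)) l (subst₂ ℤ._<_ (sym (proj₁ r _)) (sym (proj₁ r _)) l')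
      unmarked : ∀ {q} → ¬ q ∈ marked (word y)
      unmarked {q} i with Equivalence.to (a q) i
      ... | ()

    unprime-iso : IsCrystalIso n (RFplusA n (perm u) A) (RF n (perm u)) (wtRF n) (wtRF n) (eRF n) (fRF n) (eRF n) (fRF n) unprime
    unprime-iso = record
      { into = λ x (h , _) → unprime-RFplus h , λ q → mk⇔ (subst (q ∈_) (trans (cong marked (word-map bare x)) (marked-bare (word x)))) λ ()
      ; injective = λ x y → unprime-injective
      ; surjective = λ y → unprime-surjective
      ; wt-preserving = λ x _ → length-unprime x
      ; commute-e = λ { (suc k) _ _ x (h , _) → unprime-e {k} h }
      ; commute-f = λ { (suc k) _ _ x (h , _) → unprime-f {k} h } }

  marked⇔? : ∀ (A l : List (ℤ × ℤ)) → Dec (∀ p → (p ∈ l) ⇔ (p ∈ A))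
  marked⇔? A l = map′ (λ (a , a') p → mk⇔ (All.lookup a) (All.lookup a'))
    (λ h → All.tabulate (λ {p} → Equivalence.to (h p)) , All.tabulate (λ {p} → Equivalence.from (h p)))
    (All.all? (_∈ₚ? A) l ×-dec All.all? (_∈ₚ? l) A)

theorem3p13 : (u : List ℤ) (n : ℕ) → 1 ≤ n →
    (A : List (ℤ × ℤ)) → All (λ p → p ∈Inv perm u) A →
    ((∃ λ a → RFplusA n (perm u) A a) →
    IsNormalCrystal n (RFplusA n (perm u) A) (wtRF n) (eRF n) (fRF n)
    × IsCrystalIso n (RFplusA n (perm u) A) (RF n (perm u)) (wtRF n) (wtRF n)
    (eRF n) (fRF n) (eRF n) (fRF n) unprime)
    × ((∃ λ a → RFplus n (perm u) a) →
    IsNormalCrystal n (RFplus n (perm u)) (wtRF n) (eRF n) (fRF n))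
theorem3p13 u n _ A A⊆Inv =
  (λ nonempty →
    normal (RFplusA n (perm u) A) proj₁
      (λ h m (_ , a) → h , λ p → mk⇔ (λ i → Equivalence.to (a p) (↭P.∈-resp-↭ (↭.↭-sym m) i)) (λ i → ↭P.∈-resp-↭ m (Equivalence.from (a p) i)))
      (λ x h → map′ (λ a → h , a) proj₂ (marked⇔? A (marked (word x)))) nonempty ,
    unprime-iso A A⊆Inv) ,
  normal (RFplus n (perm u)) (λ h → h) (λ h _ _ → h) (λ _ h → yes h)
  where open Factorizations u n
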